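{- Let $P$ be a finite set of polyominoes and let $G$ be an undirected graph whose vertex set is the set of edges of the polyominoes of $P$. Then it is always possible to construct a KL labeling $KL(P)$ (choosing the key index $k_e$ and lock index set $S_e$ on each edge $e$) such that the set of tilings of the plane by $KL(P)$ is in one-to-one correspondence with the set of tilings of the plane by $P_G$.
   Context: For a finite polyomino set $P$ and an undirected graph $G$ on the edges of $P$ (edges meaning the unit boundary edges of the polyominoes), $P_G$ denotes the set $P$ with the matching rule that in a tiling two edges may be placed against each other only if they are adjacent in $G$. The tooth is the plus-shaped $9$-omino consisting of a central unit square and two unit squares extending in a straight line from it in each of the four directions. A key of length $l$ and index $k$ is a bump on an edge consisting of a $(6l-2)\times 1$ rectangle perpendicular to the edge with one copy of the tooth attached to its side at the $(6k-2)$-th square (counting from the edge). A lock of length $l$ and index set $S$ is a dent on an edge whose negative space is a $(6l-2)\times 1$ rectangle perpendicular to the edge with a tooth-shaped region attached at the $(6x-2)$-th square for each $x\in S$. A KL labeling $KL(P)$ is obtained by scaling every polyomino of $P$ by a sufficiently large integer factor and labeling the centre of every edge $e$ with one key of index $k_e$ and one lock of index set $S_e$, of the same length, placed side by side in a consistent orientation so that when two labeled edges face each other the key of each faces the lock of the other; $KL(P)$ consists of these labeled polyominoes together with the tooth. -}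

module Defs where

open import Data.Fin.Base using (Fin; zero; toℕ)
open import Data.Fin.Subset using (Subset; ⁅_⁆) renaming (_∈_ to _∈ˢ_)
open import Data.Integer.Base as ℤ using (ℤ; +_; 0ℤ; 1ℤ; -1ℤ)
import Data.Integer.Properties as ℤ
open import Data.List.Base using (List)
open import Data.List.Membership.Propositional using (_∈_; _∉_)
open import Data.Maybe.Base using (Maybe; just; nothing)
open import Data.Nat.Base as ℕ using (ℕ; suc)
open import Data.Nat.GeneralisedArithmetic using (fold)
open import Data.Product.Base using (∃-syntax; Σ-syntax; _×_; _,_; proj₁; proj₂)
open import Data.Sum.Base using (_⊎_)
open import Data.Unit.Base using (⊤)
open import Function.Base using (_on_)
open import Level using (0ℓ)
open import Relation.Binary.Bundles using (Setoid)
open import Relation.Binary.Core using (Rel)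
open import Relation.Binary.Construct.Closure.ReflexiveTransitive using (Star)
open import Relation.Binary.Definitions using (Decidable; Symmetric)
open import Relation.Binary.PropositionalEquality
  using (_≡_; refl; sym; trans; cong; cong₂; subst; isEquivalence)
open import Relation.Binary.Structures using (IsEquivalence)
import Relation.Binary.Construct.On as On
open import Relation.Nullary.Negation using (¬_)
open import Relation.Unary using (Pred; _≐_)
open import Relation.Unary.Relation.Binary.Equality using (≐-isEquivalence)

------------------------------------------------------------------------
-- The square grid

-- A unit square of the plane, named by the integer coordinates of its centre.
Cell : Set
Cell = ℤ × ℤ

Region : Set₁
Region = Pred Cell 0ℓ

infixl 6 _⊕_
infixl 7 _⊛_

_⊕_ : Cell → Cell → Cell
(x , y) ⊕ (x′ , y′) = x ℤ.+ x′ , y ℤ.+ y′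

⊖_ : Cell → Cell
⊖ (x , y) = ℤ.- x , ℤ.- y

_⊛_ : ℤ → Cell → Cell
a ⊛ (x , y) = a ℤ.* x , a ℤ.* y

origin : Cell
origin = 0ℤ , 0ℤ

-- Counterclockwise quarter turn about the centre of the cell (0 , 0).
quarterTurn : Cell → Cell
quarterTurn (x , y) = ℤ.- y , x

data Dir : Set where
  east north west south : Dir

vec : Dir → Cell
vec east  = 1ℤ  , 0ℤ
vec north = 0ℤ  , 1ℤ
vec west  = -1ℤ , 0ℤ
vec south = 0ℤ  , -1ℤ

turn : Dir → Dir
turn east  = north
turn north = west
turn west  = south
turn south = east

opposite : Dir → Dir
opposite d = turn (turn d)

-- A rotation is given by its number of counterclockwise quarter turns.
Rotation : Set
Rotation = Fin 4

rotate : Rotation → Cell → Cell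
rotate r c = fold c quarterTurn (toℕ r)

rotateDir : Rotation → Dir → Dir
rotateDir r d = fold d turn (toℕ r)

-- The side of a cell that faces in a given direction.  Every unit segment of
-- the grid is a side of two cells.
Side : Set
Side = Cell × Dir

otherSide : Side → Side
otherSide (c , d) = c ⊕ vec d , opposite d

------------------------------------------------------------------------
-- Polyominoes, their edges, and graphs on the edges

AdjacentIn : List Cell → Rel Cell 0ℓ
AdjacentIn cs c c′ = c ∈ cs × c′ ∈ cs × ∃[ d ] c′ ≡ c ⊕ vec d

record Polyomino : Set where
  field
    cells     : List Cell
    nonempty  : ∃[ c ] c ∈ cells
    connected : ∀ {c c′} → c ∈ cells → c′ ∈ cells → Star (AdjacentIn cells) c c′

open Polyomino public

-- The proofs are irrelevant, so that an edge is determined by its side.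
record EdgeOf (p : Polyomino) : Set where
  field
    cell     : Cell
    dir      : Dir
    .inside  : cell ∈ cells p
    .outside : cell ⊕ vec dir ∉ cells p

  side : Side
  side = cell , dir

-- A finite collection of polyominoes is a family P : Fin n → Polyomino; this
-- lets the same shape occur several times with different matching rules.
-- Edges of different members are different.
Edge : ∀ {n} → (Fin n → Polyomino) → Set
Edge {n} P = Σ[ i ∈ Fin n ] EdgeOf (P i)

edgeSide : ∀ {n} {P : Fin n → Polyomino} → Edge P → Side
edgeSide (_ , e) = EdgeOf.side e

-- Loops are allowed: copies of one edge may be placed against each other.
record UndirectedGraph (V : Set) : Set₁ where
  field
    Adj  : Rel V 0ℓ
    symm : Symmetric Adj
    adj? : Decidable Adj

------------------------------------------------------------------------
-- Tilings

record Placement (I : Set) : Set where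
  constructor place
  field
    tile  : I
    rot   : Rotation
    shift : Cell

  move : Cell → Cell
  move c = rotate rot c ⊕ shift

  moveSide : Side → Side
  moveSide (c , d) = move c , rotateDir rot d

open Placement public

translate : ∀ {I} → Cell → Placement I → Placement I
translate v (place i r s) = place i r (s ⊕ v)

covered : ∀ {I} → (I → Region) → Placement I → Region
covered shape p c = ∃[ c₀ ] shape (tile p) c₀ × move p c₀ ≡ c

-- The motions by which copies of the tiles may be moved into place.
-- Reflections are never allowed: a reflected key and lock would be
-- interchanged with respect to the middle of their edge.
data Motions : Set where
  translations translationsAndRotations : Motions

Allowed : Motions → Rotation → Set
Allowed translations             r = r ≡ zero
Allowed translationsAndRotations r = ⊤

-- p ~ q means that p and q are the same tile of a tiling.
record Prototiles : Set₁ where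
  field
    Index         : Set
    shape         : Index → Region
    _~_           : Rel (Placement Index) 0ℓ
    ~-equivalence : IsEquivalence _~_
    ~-translate   : ∀ v {p q} → p ~ q → translate v p ~ translate v q

-- A tiling assigns to each cell the placed tile that covers it.
record Tiling (μ : Motions) (𝒫 : Prototiles) : Set where
  open Prototiles 𝒫
  field
    at       : Cell → Placement Index
    allowed  : ∀ c → Allowed μ (rot (at c))
    covers   : ∀ c → covered shape (at c) c
    coherent : ∀ {c c′} → covered shape (at c) c′ → at c′ ~ at c

-- Tilings are identified when they differ by a translation of the plane: the
-- position of the origin carries no meaning, and the labeled tiles live on a
-- finer grid than the tiles they come from.
record _≈_ {μ 𝒫} (T U : Tiling μ 𝒫) : Set where
  constructor _,_
  open Prototiles 𝒫
  field
    offset : Cell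
    agree  : ∀ c → Tiling.at U (c ⊕ offset) ~ translate offset (Tiling.at T c)

⊕-identityʳ : ∀ c → c ⊕ origin ≡ c
⊕-identityʳ (x , y) = cong₂ _,_ (ℤ.+-identityʳ x) (ℤ.+-identityʳ y)

⊕-assoc : ∀ a b c → (a ⊕ b) ⊕ c ≡ a ⊕ (b ⊕ c)
⊕-assoc (x , y) (x′ , y′) (x″ , y″) =
  cong₂ _,_ (ℤ.+-assoc x x′ x″) (ℤ.+-assoc y y′ y″)

⊕-comm : ∀ a b → a ⊕ b ≡ b ⊕ a
⊕-comm (x , y) (x′ , y′) = cong₂ _,_ (ℤ.+-comm x x′) (ℤ.+-comm y y′)

⊕-inverseʳ : ∀ c → c ⊕ (⊖ c) ≡ origin
⊕-inverseʳ (x , y) = cong₂ _,_ (ℤ.+-inverseʳ x) (ℤ.+-inverseʳ y)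

cancelʳ : ∀ c v → (c ⊕ v) ⊕ (⊖ v) ≡ c
cancelʳ c v =
  trans (⊕-assoc c v (⊖ v)) (trans (cong (c ⊕_) (⊕-inverseʳ v)) (⊕-identityʳ c))

cancelʳ′ : ∀ c v → (c ⊕ (⊖ v)) ⊕ v ≡ c
cancelʳ′ c v = trans (⊕-assoc c (⊖ v) v)
  (trans (cong (c ⊕_) (trans (⊕-comm (⊖ v) v) (⊕-inverseʳ v))) (⊕-identityʳ c))

≈-isEquivalence : ∀ {μ 𝒫} → IsEquivalence (_≈_ {μ} {𝒫})
≈-isEquivalence {μ} {𝒫} = record { refl = ≈-refl ; sym = ≈-sym ; trans = ≈-trans }
  where
  open Prototiles 𝒫
  module ~ = IsEquivalence ~-equivalence

  placed : ∀ (p : Placement Index) {s} → s ≡ shift p → place (tile p) (rot p) s ≡ p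
  placed p eq = cong (place (tile p) (rot p)) eq

  ≈-refl : ∀ {T : Tiling μ 𝒫} → T ≈ T
  ≈-refl {T} = origin , λ c → ~.reflexive
    (trans (cong (Tiling.at T) (⊕-identityʳ c))
           (sym (placed (Tiling.at T c) (⊕-identityʳ _))))

  ≈-sym : ∀ {T U : Tiling μ 𝒫} → T ≈ U → U ≈ T
  ≈-sym {T} {U} (v , agree) = (⊖ v) , λ c →
    let p = Tiling.at T (c ⊕ (⊖ v)) in
    ~.sym (~.trans
      (~-translate (⊖ v)
        (subst (λ x → Tiling.at U x ~ translate v p) (cancelʳ′ c v) (agree (c ⊕ (⊖ v)))))
      (~.reflexive (placed p (cancelʳ _ v))))

  ≈-trans : ∀ {T U W : Tiling μ 𝒫} → T ≈ U → U ≈ W → T ≈ W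
  ≈-trans {T} {U} {W} (v , agree₁) (w , agree₂) = (v ⊕ w) , λ c →
    subst (λ x → Tiling.at W x ~ translate (v ⊕ w) (Tiling.at T c)) (⊕-assoc c v w)
      (~.trans (agree₂ (c ⊕ v))
        (~.trans (~-translate w (agree₁ c))
          (~.reflexive
            (placed (translate (v ⊕ w) (Tiling.at T c)) (⊕-assoc (shift (Tiling.at T c)) v w)))))

tilings : Motions → Prototiles → Setoid 0ℓ 0ℓ
tilings μ 𝒫 = record { Carrier = Tiling μ 𝒫 ; _≈_ = _≈_ ; isEquivalence = ≈-isEquivalence }

-- Tiles without a matching rule are mere regions: in particular the four
-- rotations of a tooth about its centre are the same placed tile.
unmarked : {I : Set} → (I → Region) → Prototiles
unmarked shape = record
  { shape         = shape
  ; _~_           = _≐_ on covered shape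
  ; ~-equivalence = On.isEquivalence (covered shape) ≐-isEquivalence
  ; ~-translate   = λ v {p} {q} (p⊆q , q⊆p) → half v p q p⊆q , half v q p q⊆p
  }
  where
  half : ∀ v p q → (∀ {c} → covered shape p c → covered shape q c) →
         ∀ {c} → covered shape (translate v p) c → covered shape (translate v q) c
  half v p q p⊆q (c₀ , c₀∈ , refl) with p⊆q (c₀ , c₀∈ , refl)
  ... | c₁ , c₁∈ , eq = c₁ , c₁∈ ,
    trans (sym (⊕-assoc (rotate (rot q) c₁) (shift q) v))
      (trans (cong (_⊕ v) eq) (⊕-assoc (rotate (rot p) c₀) (shift p) v))

-- The edges of tiles with a matching rule are distinguishable, so different
-- placements are different even if they cover the same cells.
marked : {I : Set} → (I → Region) → Prototiles
marked shape = record
  { shape         = shape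
  ; _~_           = _≡_
  ; ~-equivalence = isEquivalence
  ; ~-translate   = λ v → cong (translate v)
  }

------------------------------------------------------------------------
-- Tilings by P with the matching rule G

module _ {n} (P : Fin n → Polyomino) (G : UndirectedGraph (Edge P)) where

  open UndirectedGraph G

  polyominoTiles : Prototiles
  polyominoTiles = marked (λ i c → c ∈ cells (P i))

  ObeysMatchingRule : ∀ {μ} → Tiling μ polyominoTiles → Set
  ObeysMatchingRule T = ∀ (c c′ : Cell) (e e′ : Edge P) →
    proj₁ e ≡ tile (at c) → proj₁ e′ ≡ tile (at c′) →
    moveSide (at c′) (edgeSide {P = P} e′) ≡ otherSide (moveSide (at c) (edgeSide {P = P} e)) →
    Adj e e′
    where open Tiling T

  matchedTilings : Motions → Setoid 0ℓ 0ℓ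
  matchedTilings μ = On.setoid (tilings μ polyominoTiles)
    (proj₁ {B = ObeysMatchingRule {μ}})

------------------------------------------------------------------------
-- Keys, locks and KL labelings

Tooth : Region
Tooth (x , y) = (x ≡ 0ℤ × ℤ.∣ y ∣ ℕ.≤ 2) ⊎ (y ≡ 0ℤ × ℤ.∣ x ∣ ℕ.≤ 2)

-- A (6l-2)×1 rectangle in column 0, in rows 1, …, 6l-2, with a tooth attached
-- by the tip of an arm to its side at row 6k-2 for each k ∈ S.  The element
-- j : Fin l stands for the index k = suc (toℕ j); the centre of its tooth is
-- in column 3.
Toothed : (l : ℕ) → Subset l → Region
Toothed l S (x , y) =
  (x ≡ 0ℤ × 1ℤ ℤ.≤ y × y ℤ.≤ + (6 ℕ.* l ℕ.∸ 2)) ⊎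
  (∃[ j ] j ∈ˢ S × Tooth (x ℤ.- + 3 , y ℤ.- + (6 ℕ.* suc (toℕ j) ℕ.∸ 2)))

-- Scaling by the odd factor 2m+1 turns the cell c into the square block of
-- cells with centre (2m+1)c, and makes the middle of an edge a cell.
Block : ℕ → Cell → Region
Block m c q = ∃[ x ] ∃[ y ] ℤ.∣ x ∣ ℕ.≤ m × ℤ.∣ y ∣ ℕ.≤ m ×
  q ≡ (+ suc (2 ℕ.* m)) ⊛ c ⊕ (x , y)

-- The coordinate system of a scaled side: y counts the rows from the side
-- outwards, starting with 1 for the first row outside the block; x counts the
-- columns from the one next to the middle column, away from the middle.
frame : ℕ → Side → Cell → Cell
frame m (c , d) (x , y) =
  (+ suc (2 ℕ.* m)) ⊛ c ⊕ (+ m ℤ.+ y) ⊛ vec d ⊕ (1ℤ ℤ.+ x) ⊛ vec (turn d)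

Bump : (m l : ℕ) → Side → Fin l → Region
Bump m l s k q = ∃[ p ] Toothed l ⁅ k ⁆ p × frame m s p ≡ q

-- Keys and locks lie in the two columns next to the middle of the edge, with
-- their teeth pointing away from the middle.  A half turn about the midpoint
-- of the edge takes keys to locks, so that the place of a lock, inside the
-- block, is the place of a key on the facing edge.
Dent : (m l : ℕ) → Side → Subset l → Region
Dent m l s S q = ∃[ p ] Toothed l S p × frame m (otherSide s) p ≡ q

module _ {n} (P : Fin n → Polyomino) where

  -- Toothed l S has height at most 6l and stays within 6 columns of the middle
  -- of the edge, so the bound keeps the labels at different edges apart.
  record KLLabeling : Set where
    field
      len       : ℕ
      halfScale : ℕ
      large     : 6 ℕ.* len ℕ.+ 6 ℕ.< halfScale
      key       : Edge P → Fin len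
      lock      : Edge P → Subset len

  module _ (L : KLLabeling) where
    open KLLabeling L

    Body : Fin n → Region
    Body i q = ∃[ c ] c ∈ cells (P i) × Block halfScale c q

    LabeledPolyomino : Fin n → Region
    LabeledPolyomino i q =
      (Body i q × ¬ (∃[ e ] Dent halfScale len (EdgeOf.side e) (lock (i , e)) q)) ⊎
      (∃[ e ] Bump halfScale len (EdgeOf.side e) (key (i , e)) q)

    klShape : Maybe (Fin n) → Region
    klShape (just i) = LabeledPolyomino i
    klShape nothing  = Tooth

    KL : Prototiles
    KL = unmarked klShape

{-# OPTIONS --safe #-}
-- The edges are numbered.  The key of an edge is its number, and its lock lists the
-- numbers of the adjacent edges.  One more place for a tooth is never used, so that
-- all keys have the same tip and all locks the same dead end.
--
-- In a tiling by labeled polyominoes the dead end of a lock is too narrow for a tooth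
-- and for the body of a polyomino.  So it is filled by the tip of a key that is fully
-- inserted: the polyomino of the key is aligned with that of the lock, and the tooth
-- of the key fits only if the two edges are adjacent.  Starting from one labeled
-- polyomino, which exists because teeth alone do not tile, the labeled polyominoes
-- therefore cover a whole grid of blocks, and any other one would overlap these.
-- The holes that are left can each be filled in exactly one way, with a tooth.  So
-- the labeled polyominoes determine the tiling, shrinking them gives a tiling by P
-- that obeys G, and every such tiling arises in this way.

module Submission where

-- Labeled tiles may lie anywhere on the fine grid, so alignment has to be proved. The tool is the
-- solid position: one of its coordinates has absolute value between 7 and `M - 6ℓ`, so no dent
-- reaches it, whatever the lock. Two blocks whose centres differ by at most `M + 7` in one
-- coordinate and `2M` in the other share a cell that is solid in both (`common-solid-cell`); in a
-- tiling their bodies then belong to one tile. The bound `M ≥ 12ℓ + 40` leaves room for this. A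
-- tile of `KL` is merely a region, whereas turned copies of a symmetric polyomino are different
-- tiles under the matching rule. Hence every edge has a key of its own, even if two edges have the
-- same neighbours, and `region-unique` recovers the placement from the region. The grid found in a
-- tiling depends on arbitrary choices. Tilings on both sides are taken up to translation, so any
-- choice of base will do. Finite facts about teeth are decided by enumeration, inequalities in `ℓ`
-- and `M` by a checker for linear arithmetic.

open import Defs
open import Data.Bool.Base using (Bool; true; false; if_then_else_; _∧_; T)
open import Data.Empty using (⊥; ⊥-elim; ⊥-elim-irr)
open import Data.Fin.Base as Fin using (Fin; zero; suc; toℕ; inject₁)
import Data.Fin.Properties as Fin
open import Data.Fin.Subset using (Subset; ⁅_⁆) renaming (_∈_ to _∈ˢ_; _⊆_ to _⊆ˢ_)
open import Data.Fin.Subset.Properties using (_∈?_; x∈⁅x⁆; x∈⁅y⁆⇒x≡y)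
open import Data.Integer.Base as ℤ using (ℤ; +_; -[1+_]; 0ℤ; 1ℤ; -1ℤ; _+_; _*_; _-_; -_; _≤_; _<_)
import Data.Integer.DivMod as ℤ
import Data.Integer.Properties as ℤ
open import Data.Integer.Tactic.RingSolver using (solve-∀)
open import Data.List.Base as List using (List; []; _∷_)
open import Data.List.Extrema ℤ.≤-totalOrder using (argmax; argmax-sel; f[xs]≤f[argmax])
import Data.List.Membership.DecPropositional as DecMembership
open import Data.List.Membership.Propositional using (_∈_; _∉_; find; lose)
open import Data.List.Membership.Propositional.Properties using (∈-concatMap⁺; ∈-allFin)
open import Data.List.Relation.Unary.All as All using (All; []; _∷_)
open import Data.List.Relation.Unary.Any as Any using (Any; here; there)
import Data.List.Relation.Unary.Any.Properties as Any
open import Data.Maybe.Base as Maybe using (Maybe; just; nothing; _<∣>_; fromMaybe)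
open import Data.Nat.Base as ℕ using (ℕ; zero; suc; z≤n; s≤s)
open import Data.Nat.GeneralisedArithmetic using (fold)
import Data.Nat.Properties as ℕ
open import Data.Product.Base using (∃-syntax; Σ-syntax; _×_; _,_; proj₁; proj₂)
open import Data.Product.Properties using (≡-dec)
open import Data.Sum.Base using (_⊎_; inj₁; inj₂)
open import Data.Unit.Base using (⊤; tt)
open import Data.Vec.Base as Vec using (Vec; []; _∷_)
open import Data.Vec.N-ary using (N-ary; _$ⁿ_)
import Data.Vec.Properties as Vec
open import Function.Bundles using (Bijection)
open import Relation.Binary.Bundles using (Setoid)
open import Relation.Binary.Definitions using (DecidableEquality; tri<; tri≈; tri>)
open import Relation.Binary.PropositionalEquality hiding (_≗_)
open import Relation.Nullary using (Dec; ¬_; yes; no; does; contradiction)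
open import Relation.Nullary.Decidable using (_×-dec_; _⊎-dec_; _→-dec_; ¬?; from-yes; map′; recompute)
open import Relation.Unary using (_≐_)

-- Linear arithmetic

module LinearArithmetic where

  infixl 6 _⊞_ _⊟_
  infixl 7 _⊠_
  infix  8 ⊟_ #_
  infix  4 _≼_ _≺_ _≗_
  infixr 1 _⇒_

  data Ex (n : ℕ) : Set where
    var     : Fin n → Ex n
    #_      : ℕ → Ex n
    _⊞_ _⊟_ : Ex n → Ex n → Ex n
    ⊟_      : Ex n → Ex n
    _⊠_     : ℕ → Ex n → Ex n

  data Atom (n : ℕ) : Set where
    _≼_ _≺_ _≗_ : Ex n → Ex n → Atom n
    false : Atom n

  data Sequent (n : ℕ) : Set where
    _⇒_  : Atom n → Sequent n → Sequent n
    goal : Atom n → Sequent n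

  ⟦_⟧ : ∀ {n} → Ex n → Vec ℤ n → ℤ
  ⟦ var i ⟧ ρ = Vec.lookup ρ i
  ⟦ # k ⟧ ρ = + k
  ⟦ e ⊞ f ⟧ ρ = ⟦ e ⟧ ρ + ⟦ f ⟧ ρ
  ⟦ e ⊟ f ⟧ ρ = ⟦ e ⟧ ρ - ⟦ f ⟧ ρ
  ⟦ ⊟ e ⟧ ρ = - ⟦ e ⟧ ρ
  ⟦ k ⊠ e ⟧ ρ = + k * ⟦ e ⟧ ρ

  ⟦_⟧ᵃ : ∀ {n} → Atom n → Vec ℤ n → Set
  ⟦ e ≼ f ⟧ᵃ ρ = ⟦ e ⟧ ρ ≤ ⟦ f ⟧ ρ
  ⟦ e ≺ f ⟧ᵃ ρ = ⟦ e ⟧ ρ < ⟦ f ⟧ ρ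
  ⟦ e ≗ f ⟧ᵃ ρ = ⟦ e ⟧ ρ ≡ ⟦ f ⟧ ρ
  ⟦ false ⟧ᵃ ρ = ⊥

  ⟦_⟧ˢ : ∀ {n} → Sequent n → Vec ℤ n → Set
  ⟦ a ⇒ s ⟧ˢ ρ = ⟦ a ⟧ᵃ ρ → ⟦ s ⟧ˢ ρ
  ⟦ goal a ⟧ˢ ρ = ⟦ a ⟧ᵃ ρ

  -- The affine form k + Σ cᵢ xᵢ.
  Affine : ℕ → Set
  Affine n = ℤ × Vec ℤ n

  dot : ∀ {n} → Vec ℤ n → Vec ℤ n → ℤ
  dot []       []       = 0ℤ
  dot (c ∷ cs) (x ∷ xs) = c * x + dot cs xs

  value : ∀ {n} → Affine n → Vec ℤ n → ℤ
  value (k , cs) ρ = k + dot cs ρ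

  unit : ∀ {n} → Fin n → Vec ℤ n
  unit zero    = 1ℤ ∷ Vec.replicate _ 0ℤ
  unit (suc i) = 0ℤ ∷ unit i

  axpy : ∀ {n} → ℤ → Affine n → Affine n → Affine n
  axpy a (k , cs) (k′ , cs′) = a * k + k′ , Vec.zipWith (λ c c′ → a * c + c′) cs cs′

  dot-zero : ∀ {n} (ρ : Vec ℤ n) → dot (Vec.replicate n 0ℤ) ρ ≡ 0ℤ
  dot-zero []      = refl
  dot-zero (x ∷ ρ) = trans (ℤ.+-identityˡ _) (dot-zero ρ)

  dot-unit : ∀ {n} (i : Fin n) ρ → dot (unit i) ρ ≡ Vec.lookup ρ i
  dot-unit zero (x ∷ ρ) rewrite dot-zero ρ = trans (ℤ.+-identityʳ _) (ℤ.*-identityˡ x)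
  dot-unit (suc i) (x ∷ ρ) = trans (ℤ.+-identityˡ _) (dot-unit i ρ)

  dot-axpy : ∀ {n} a (cs cs′ ρ : Vec ℤ n) →
    dot (Vec.zipWith (λ c c′ → a * c + c′) cs cs′) ρ ≡ a * dot cs ρ + dot cs′ ρ
  dot-axpy a []       []         []      = sym (trans (ℤ.+-identityʳ _) (ℤ.*-zeroʳ a))
  dot-axpy a (c ∷ cs) (c′ ∷ cs′) (x ∷ ρ) rewrite dot-axpy a cs cs′ ρ = eq a c c′ x _ _
    where
    eq : ∀ a c c′ x d d′ → (a * c + c′) * x + (a * d + d′) ≡ a * (c * x + d) + (c′ * x + d′)
    eq = solve-∀

  value-axpy : ∀ {n} a (p q : Affine n) ρ → value (axpy a p q) ρ ≡ a * value p ρ + value q ρ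
  value-axpy a (k , cs) (k′ , cs′) ρ rewrite dot-axpy a cs cs′ ρ = eq a k k′ (dot cs ρ) (dot cs′ ρ)
    where
    eq : ∀ a k k′ d d′ → a * k + k′ + (a * d + d′) ≡ a * (k + d) + (k′ + d′)
    eq = solve-∀

  constant : ∀ {n} → ℤ → Affine n
  constant k = k , Vec.replicate _ 0ℤ

  affine : ∀ {n} → Ex n → Affine n
  affine (var i) = 0ℤ , unit i
  affine (# k)   = constant (+ k)
  affine (e ⊞ f) = axpy 1ℤ (affine e) (affine f)
  affine (e ⊟ f) = axpy -1ℤ (affine f) (affine e)
  affine (⊟ e)   = axpy -1ℤ (affine e) (constant 0ℤ)
  affine (k ⊠ e) = axpy (+ k) (affine e) (constant 0ℤ)

  value-constant : ∀ {n} k (ρ : Vec ℤ n) → value (constant k) ρ ≡ k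
  value-constant k ρ rewrite dot-zero ρ = ℤ.+-identityʳ k

  value-affine : ∀ {n} (e : Ex n) ρ → value (affine e) ρ ≡ ⟦ e ⟧ ρ
  value-affine (var i) ρ = trans (ℤ.+-identityˡ _) (dot-unit i ρ)
  value-affine (# k) ρ = value-constant (+ k) ρ
  value-affine (e ⊞ f) ρ rewrite value-axpy 1ℤ (affine e) (affine f) ρ
    | value-affine e ρ | value-affine f ρ = cong (_+ ⟦ f ⟧ ρ) (ℤ.*-identityˡ (⟦ e ⟧ ρ))
  value-affine (e ⊟ f) ρ rewrite value-axpy -1ℤ (affine f) (affine e) ρ
    | value-affine e ρ | value-affine f ρ = eq (⟦ e ⟧ ρ) (⟦ f ⟧ ρ)
    where
    eq : ∀ x y → -1ℤ * y + x ≡ x - y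
    eq = solve-∀
  value-affine (⊟ e) ρ rewrite value-axpy -1ℤ (affine e) (constant 0ℤ) ρ
    | value-affine e ρ | value-constant 0ℤ ρ = trans (ℤ.+-identityʳ _) (ℤ.-1*i≡-i (⟦ e ⟧ ρ))
  value-affine (k ⊠ e) ρ rewrite value-axpy (+ k) (affine e) (constant 0ℤ) ρ
    | value-affine e ρ | value-constant 0ℤ ρ = ℤ.+-identityʳ _

  -- An affine form that vanishes (true) or is nonnegative (false).
  Row : ℕ → Set
  Row n = Bool × Affine n

  Holds : ∀ {n} → Row n → Vec ℤ n → Set
  Holds (true  , p) ρ = 0ℤ ≡ value p ρ
  Holds (false , p) ρ = 0ℤ ≤ value p ρ

  row : ∀ {n} → Atom n → Row n
  row (e ≼ f) = false , affine (f ⊟ e)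
  row (e ≺ f) = false , affine (f ⊟ e ⊟ # 1)
  row (e ≗ f) = true  , affine (f ⊟ e)
  row false   = false , constant -1ℤ

  row-holds : ∀ {n} (a : Atom n) ρ → ⟦ a ⟧ᵃ ρ → Holds (row a) ρ
  row-holds (e ≼ f) ρ h rewrite value-affine (f ⊟ e) ρ = ℤ.i≤j⇒0≤j-i h
  row-holds (e ≺ f) ρ h rewrite value-affine (f ⊟ e ⊟ # 1) ρ =
    subst (0ℤ ≤_) (eq (⟦ e ⟧ ρ) (⟦ f ⟧ ρ)) (ℤ.i≤j⇒0≤j-i (ℤ.i<j⇒suc[i]≤j h))
    where
    eq : ∀ x y → y - (1ℤ + x) ≡ y - x - 1ℤ
    eq = solve-∀
  row-holds (e ≗ f) ρ h rewrite value-affine (f ⊟ e) ρ = sym (ℤ.i≡j⇒i-j≡0 (sym h))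

  -- Fourier–Motzkin elimination, used as an oracle for the coefficients of a
  -- combination of the hypotheses that is a negative constant.
  module Oracle where

    Work : Set
    Work = Bool × List ℤ × List ℤ × ℤ

    comb : ℤ → ℤ → Work → Work → Bool → Work
    comb a b (_ , u , cs , k) (_ , u′ , cs′ , k′) t =
      t , List.zipWith f u u′ , List.zipWith f cs cs′ , f k k′
      where
      f : ℤ → ℤ → ℤ
      f x y = a * x + b * y

    nth : ℕ → List ℤ → ℤ
    nth _       []       = 0ℤ
    nth zero    (c ∷ _)  = c
    nth (suc i) (_ ∷ cs) = nth i cs

    coeff : ℕ → Work → ℤ
    coeff i (_ , _ , cs , _) = nth i cs

    isZero isNeg isPos : ℤ → Bool
    isZero (+ zero) = true
    isZero _ = false
    isNeg -[1+ _ ] = true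
    isNeg _ = false
    isPos (+ suc _) = true
    isPos _ = false

    isEq : Work → Bool
    isEq (t , _) = t

    pick : ℕ → List Work → Maybe (Work × List Work)
    pick i [] = nothing
    pick i (w ∷ ws) with isEq w | isZero (coeff i w)
    ... | true | false = just (w , ws)
    ... | _    | _     with pick i ws
    ...   | just (v , vs) = just (v , w ∷ vs)
    ...   | nothing       = nothing

    -- The row `w` is multiplied by the absolute value of the pivot, which is positive, so that an
    -- inequality keeps its direction. The equation `e` may enter with either sign.
    eliminate : ℕ → Work → Work → Work
    eliminate i e w with coeff i e
    ... | + c      = comb (- coeff i w) (+ c) e w (isEq w)
    ... | -[1+ c ] = comb (coeff i w) (+ suc c) e w (isEq w)

    resolve : ℕ → List Work → List Work
    resolve i ws = List.concatMap
        (λ p → List.map (λ q → comb (- coeff i q) (coeff i p) p q false) (neg ws)) (pos ws)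
      List.++ List.filterᵇ (λ w → isZero (coeff i w)) ws
      where
      pos neg : List Work → List Work
      pos = List.filterᵇ (λ w → isPos (coeff i w))
      neg = List.filterᵇ (λ w → isNeg (coeff i w))

    gauss : List ℕ → List Work → List Work
    gauss []       ws = ws
    gauss (i ∷ is) ws with pick i ws
    ... | just (e , vs) = gauss is (List.map (eliminate i e) vs)
    ... | nothing       = gauss is ws

    contradiction? : Work → Maybe (List ℤ)
    contradiction? (true  , u , _ , k) = if isZero k then nothing else just
        (if isNeg k then u else List.map -_ u)
    contradiction? (false , u , _ , k) = if isNeg k then just u else nothing

    first : List Work → Maybe (List ℤ)
    first []       = nothing
    first (w ∷ ws) = contradiction? w <∣> first ws

    oracle : ∀ {n} → List (Row n) → List ℤ
    -- If the search fails there are no coefficients; the combination is then the constant 0, which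
    -- is not negative, and the check fails safely.
    oracle {n} rs = fromMaybe [] (first (List.foldl (λ ws i → resolve i ws) (gauss vars start) vars))
      where
      vars : List ℕ
      vars = List.upTo n

      flag : ℕ → ℕ → ℤ
      flag i j = if i ℕ.≡ᵇ j then 1ℤ else 0ℤ

      number : ℕ → List (Row n) → List Work
      number i [] = []
      number i ((t , k , cs) ∷ rs′) =
        (t , List.map (flag i) (List.upTo (List.length rs)) , Vec.toList cs , k) ∷ number (suc i) rs′

      start : List Work
      start = number 0 rs

  open Oracle using (oracle)

  -- Soundness rests on this evaluation alone, not on the oracle: equations accept any coefficient,
  -- inequalities only nonnegative ones.
  combination : ∀ {n} → List (Row n) → List ℤ → Maybe (Affine n)
  combination []                 _              = just (constant 0ℤ)
  combination (_ ∷ _)            []             = just (constant 0ℤ)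
  combination ((true  , p) ∷ rs) (c ∷ cs)       = Maybe.map (axpy c p) (combination rs cs)
  combination ((false , p) ∷ rs) (+ c ∷ cs)     = Maybe.map (axpy (+ c) p) (combination rs cs)
  combination ((false , p) ∷ rs) (-[1+ c ] ∷ _) = nothing

  AllHold : ∀ {n} → List (Row n) → Vec ℤ n → Set
  AllHold []       ρ = ⊤
  AllHold (r ∷ rs) ρ = Holds r ρ × AllHold rs ρ

  combination-nonneg : ∀ {n} (rs : List (Row n)) cs ρ {p} → combination rs cs ≡ just p →
                       AllHold rs ρ → 0ℤ ≤ value p ρ
  combination-nonneg [] cs ρ refl hs = ℤ.≤-reflexive (sym (value-constant 0ℤ ρ))
  combination-nonneg (_ ∷ _) [] ρ refl hs = ℤ.≤-reflexive (sym (value-constant 0ℤ ρ))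
  combination-nonneg ((true , p) ∷ rs) (c ∷ cs) ρ eq (h , hs) with combination rs cs in eq′ | eq
  ... | just q | refl rewrite value-axpy c p q ρ | sym h | ℤ.*-zeroʳ c | ℤ.+-identityˡ (value q ρ) =
    combination-nonneg rs cs ρ eq′ hs
  combination-nonneg ((false , p) ∷ rs) (+ c ∷ cs) ρ eq (h , hs) with combination rs cs in eq′ | eq
  ... | just q | refl rewrite value-axpy (+ c) p q ρ =
    ℤ.+-mono-≤ (subst (_≤ + c * value p ρ) (ℤ.*-zeroʳ (+ c)) (ℤ.*-monoˡ-≤-nonNeg (+ c) h))
               (combination-nonneg rs cs ρ eq′ hs)

  allZero : ∀ {n} → Vec ℤ n → Bool
  allZero []              = true
  allZero (+ zero ∷ cs)   = allZero cs
  allZero (_ ∷ _)         = false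

  negative : ∀ {n} → Maybe (Affine n) → Bool
  negative (just (-[1+ _ ] , cs)) = allZero cs
  negative _                      = false

  refutes : ∀ {n} → List (Row n) → Bool
  refutes rs = negative (combination rs (oracle rs))

  dot-allZero : ∀ {n} (cs ρ : Vec ℤ n) → T (allZero cs) → dot cs ρ ≡ 0ℤ
  dot-allZero []            []      _ = refl
  dot-allZero (+ zero ∷ cs) (x ∷ ρ) z = trans (ℤ.+-identityˡ _) (dot-allZero cs ρ z)

  refutes-sound : ∀ {n} (rs : List (Row n)) ρ → T (refutes rs) → AllHold rs ρ → ⊥
  refutes-sound rs ρ t hs with combination rs (oracle rs) in eq
  ... | just (-[1+ k ] , cs) with combination-nonneg rs (oracle rs) ρ eq hs
  ...   | le rewrite dot-allZero cs ρ t with () ← le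

  negations : ∀ {n} → Atom n → List (Row n)
  negations (e ≼ f) = row (f ≺ e) ∷ []
  negations (e ≺ f) = row (f ≼ e) ∷ []
  negations (e ≗ f) = row (e ≺ f) ∷ row (f ≺ e) ∷ []
  -- There is nothing to negate, so a valid row stands in, and the hypotheses must refute
  -- themselves.
  negations false   = row (# 0 ≼ # 0) ∷ []

  proves : ∀ {n} → List (Row n) → Sequent n → Bool
  proves rs (a ⇒ s)  = proves (row a ∷ rs) s
  proves rs (goal a) = List.foldr (λ r t → refutes (r ∷ rs) ∧ t) true (negations a)

  T-∧ : ∀ {a b} → T (a ∧ b) → T a × T b
  T-∧ {true} t = tt , t

  proves-sound : ∀ {n} (rs : List (Row n)) s ρ → T (proves rs s) → AllHold rs ρ → ⟦ s ⟧ˢ ρ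
  proves-sound rs (a ⇒ s) ρ t hs h = proves-sound (row a ∷ rs) s ρ t (row-holds a ρ h , hs)
  proves-sound rs (goal (e ≼ f)) ρ t hs = ℤ.≮⇒≥ λ lt →
    refutes-sound (row (f ≺ e) ∷ rs) ρ (proj₁ (T-∧ t)) (row-holds (f ≺ e) ρ lt , hs)
  proves-sound rs (goal (e ≺ f)) ρ t hs = ℤ.≰⇒> λ le →
    refutes-sound (row (f ≼ e) ∷ rs) ρ (proj₁ (T-∧ t)) (row-holds (f ≼ e) ρ le , hs)
  proves-sound rs (goal (e ≗ f)) ρ t hs = ℤ.≤-antisym
    (ℤ.≮⇒≥ λ lt → refutes-sound (row (f ≺ e) ∷ rs) ρ (proj₁ (T-∧ (proj₂ (T-∧ {refutes (row (e ≺ f) ∷ rs)} t))))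
        (row-holds (f ≺ e) ρ lt , hs))
    (ℤ.≮⇒≥ λ lt → refutes-sound (row (e ≺ f) ∷ rs) ρ (proj₁ (T-∧ t)) (row-holds (e ≺ f) ρ lt , hs))
  proves-sound rs (goal false) ρ t hs =
    refutes-sound (row (# 0 ≼ # 0) ∷ rs) ρ (proj₁ (T-∧ t)) (row-holds (# 0 ≼ # 0) ρ ℤ.≤-refl , hs)

  ∀ᵛ : ∀ n → (Vec ℤ n → Set) → Set
  ∀ᵛ zero    P = P []
  ∀ᵛ (suc n) P = ∀ x → ∀ᵛ n (λ ρ → P (x ∷ ρ))

  close : ∀ n {P : Vec ℤ n → Set} → (∀ ρ → P ρ) → ∀ᵛ n P
  close zero    f   = f []
  close (suc n) f x = close n (λ ρ → f (x ∷ ρ))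

  opaque
    -- The implicit argument is found by running the checker on the closed sequent. Products such as
    -- `σ * x` are handed over as single variables.
    lin : ∀ n (f : N-ary n (Ex n) (Sequent n)) →
          let s = f $ⁿ Vec.tabulate var in {T (proves [] s)} → ∀ᵛ n ⟦ s ⟧ˢ
    lin n f {t} = close n (λ ρ → proves-sound [] (f $ⁿ Vec.tabulate var) ρ t tt)

open LinearArithmetic
  using (lin; var; #_; _⊞_; _⊟_; ⊟_; _⊠_; _≼_; _≺_; _≗_; false; _⇒_; goal)

-- Blocks and dents

-- The cell a steps ahead and b steps to the left of the origin, seen by an
-- observer who faces in the given direction.
loc : Dir → ℤ → ℤ → Cell
loc east  a b = a   , b
loc north a b = - b , a
loc west  a b = - a , - b
loc south a b = b   , - a

cell-≡ : ∀ {c c′ : Cell} → proj₁ c ≡ proj₁ c′ → proj₂ c ≡ proj₂ c′ → c ≡ c′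
cell-≡ = cong₂ _,_

⊕-cancelʳ : ∀ a b c → b ⊕ a ≡ c ⊕ a → b ≡ c
⊕-cancelʳ a b c eq = trans (sym (cancelʳ b a)) (trans (cong (_⊕ (⊖ a)) eq) (cancelʳ c a))

loc-⊕ : ∀ D a b c d → loc D a b ⊕ loc D c d ≡ loc D (a + c) (b + d)
loc-⊕ east  a b c d = refl
loc-⊕ north a b c d = cell-≡ (sym (ℤ.neg-distrib-+ b d)) refl
loc-⊕ west  a b c d = cell-≡ (sym (ℤ.neg-distrib-+ a c)) (sym (ℤ.neg-distrib-+ b d))
loc-⊕ south a b c d = cell-≡ refl (sym (ℤ.neg-distrib-+ a c))

loc-⊖ : ∀ D a b → ⊖ (loc D a b) ≡ loc D (- a) (- b)
loc-⊖ east  a b = refl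
loc-⊖ north a b = refl
loc-⊖ west  a b = refl
loc-⊖ south a b = refl

loc-turn : ∀ D a b → loc (turn D) a b ≡ loc D (- b) a
loc-turn east  a b = refl
loc-turn north a b = refl
loc-turn west  a b = cell-≡ (sym (ℤ.neg-involutive b)) refl
loc-turn south a b = cell-≡ refl (sym (ℤ.neg-involutive b))

loc-opposite : ∀ D a b → loc (opposite D) a b ≡ loc D (- a) (- b)
loc-opposite D a b = trans (loc-turn (turn D) a b) (loc-turn D (- b) a)

loc-injective : ∀ D {a b c d} → loc D a b ≡ loc D c d → a ≡ c × b ≡ d
loc-injective east  eq = cong proj₁ eq , cong proj₂ eq
loc-injective north eq = cong proj₂ eq , ℤ.neg-injective (cong proj₁ eq)
loc-injective west  eq = ℤ.neg-injective (cong proj₁ eq) , ℤ.neg-injective (cong proj₂ eq)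
loc-injective south eq = ℤ.neg-injective (cong proj₂ eq) , cong proj₁ eq

loc-surjective : ∀ D c → ∃[ a ] ∃[ b ] c ≡ loc D a b
loc-surjective east  (x , y) = x , y , refl
loc-surjective north (x , y) = y , - x , cell-≡ (sym (ℤ.neg-involutive x)) refl
loc-surjective west  (x , y) = - x , - y , cell-≡ (sym (ℤ.neg-involutive x)) (sym (ℤ.neg-involutive y))
loc-surjective south (x , y) = - y , x , cell-≡ refl (sym (ℤ.neg-involutive y))

data Relative (D : Dir) : Dir → Set where
  same   : Relative D D
  left   : Relative D (turn D)
  behind : Relative D (opposite D)
  right  : Relative D (turn (opposite D))

relative : ∀ D D′ → Relative D D′
relative east  east  = same
relative east  north = left
relative east  west  = behind
relative east  south = right
relative north east  = right
relative north north = same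
relative north west  = left
relative north south = behind
relative west  east  = behind
relative west  north = right
relative west  west  = same
relative west  south = left
relative south east  = left
relative south north = behind
relative south west  = right
relative south south = same

opposite-involutive : ∀ D → opposite (opposite D) ≡ D
opposite-involutive east  = refl
opposite-involutive north = refl
opposite-involutive west  = refl
opposite-involutive south = refl

-- The step of a cell in the coordinate system of a dent in a side that faces in
-- the given direction: the rows of a dent count backwards, and its columns go
-- to the right.
flip : Dir → Cell → Cell
flip D (x , y) = loc D (- y) (- x)

flip-⊕ : ∀ D a b → flip D (a ⊕ b) ≡ flip D a ⊕ flip D b
flip-⊕ D (x , y) (x′ , y′) = trans (cong₂ (loc D) (ℤ.neg-distrib-+ y y′) (ℤ.neg-distrib-+ x x′))
  (sym (loc-⊕ D (- y) (- x) (- y′) (- x′)))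

flip-surjective : ∀ D c → ∃[ a ] c ≡ flip D a
flip-surjective D c with loc-surjective D c
... | a , b , eq = (- b , - a) , trans eq (cong₂ (loc D) (sym (ℤ.neg-involutive a)) (sym (ℤ.neg-involutive b)))

Within : ℤ → ℤ → Set
Within k a = - k ≤ a × a ≤ k

within-neg : ∀ {k a} → Within k a → Within k (- a)
within-neg {k} {a} (p , q) =
  lin 2 (λ k a → a ≼ k ⇒ goal (⊟ k ≼ ⊟ a)) k a q ,
  lin 2 (λ k a → ⊟ k ≼ a ⇒ goal (⊟ a ≼ k)) k a p

within-neg⁻ : ∀ {k a} → Within k (- a) → Within k a
within-neg⁻ {k} {a} w = subst (Within k) (ℤ.neg-involutive a) (within-neg w)

within-sum : ∀ {j k n a b} → Within j a → Within k b → j + k ≤ n → Within n (a + b)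
within-sum {j} {k} {n} {a} {b} (p , q) (p′ , q′) le =
  lin 5 (λ j k n a b → ⊟ j ≼ a ⇒ ⊟ k ≼ b ⇒ j ⊞ k ≼ n ⇒ goal (⊟ n ≼ a ⊞ b)) j k n a b p p′ le ,
  lin 5 (λ j k n a b → a ≼ j ⇒ b ≼ k ⇒ j ⊞ k ≼ n ⇒ goal (a ⊞ b ≼ n)) j k n a b q q′ le

-- The integers `ℓ`, `M` and `σ` are tied to the naturals only by equations, so that linear
-- arithmetic can treat them as variables.
record Scale : Set where
  field
    l m   : ℕ
    ℓ M σ : ℤ
    ℓ≡    : ℓ ≡ + l
    M≡    : M ≡ + m
    σ≡    : σ ≡ + suc (2 ℕ.* m)
    1≤l   : 1ℤ ≤ ℓ
    large : + 12 * ℓ + + 40 ≤ M  -- makes the column 6ℓ + 20 of a block solid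

module Scaled (scaling : Scale) where

  open Scale scaling

  σ-value : σ ≡ 1ℤ + + 2 * M
  σ-value = trans σ≡ (cong (_+_ 1ℤ) (trans (ℤ.pos-* 2 m) (cong (+ 2 *_) (sym M≡))))

  InBlock : Cell → Set
  InBlock (x , y) = Within M x × Within M y

  in-block-loc : ∀ D {a b} → Within M a → Within M b → InBlock (loc D a b)
  in-block-loc east  p q = p , q
  in-block-loc north p q = within-neg q , p
  in-block-loc west  p q = within-neg p , within-neg q
  in-block-loc south p q = q , within-neg p

  in-block-loc⁻ : ∀ D {a b} → InBlock (loc D a b) → Within M a × Within M b
  in-block-loc⁻ east  (p , q) = p , q
  in-block-loc⁻ north (p , q) = q , within-neg⁻ p
  in-block-loc⁻ west  (p , q) = within-neg⁻ p , within-neg⁻ q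
  in-block-loc⁻ south (p , q) = within-neg⁻ q , p

  σ-suc : ∀ x → σ * ℤ.suc x ≡ σ * x + 1ℤ + + 2 * M
  σ-suc x = trans (ℤ.*-suc σ x) (trans (ℤ.+-comm σ (σ * x))
    (trans (cong (_+_ (σ * x)) σ-value) (sym (ℤ.+-assoc (σ * x) 1ℤ (+ 2 * M)))))

  σ-mono : ∀ {x y} → x ≤ y → σ * x ≤ σ * y
  σ-mono x≤y rewrite σ≡ = ℤ.*-monoˡ-≤-nonNeg (+ suc (2 ℕ.* m)) x≤y

  -- Different centres are at least `σ = 1 + 2M` apart, while two offsets differ by at most `2M`.
  σ-apart : ∀ {x x′ a a′} → Within M a → Within M a′ → σ * x + a ≡ σ * x′ + a′ → ¬ x < x′
  σ-apart {x} {x′} {a} {a′} (p , q) (p′ , q′) eq x<x′ =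
    lin 6 (λ s t u a b m → u ≗ s ⊞ # 1 ⊞ 2 ⊠ m ⇒ u ≼ t ⇒ a ≼ m ⇒ ⊟ m ≼ b ⇒ s ⊞ a ≗ t ⊞ b ⇒ goal false)
      (σ * x) (σ * x′) (σ * ℤ.suc x) a a′ M
      (σ-suc x) (σ-mono (ℤ.i<j⇒suc[i]≤j x<x′)) q p′ eq

  σ-cancel : ∀ {x x′ a a′} → Within M a → Within M a′ → σ * x + a ≡ σ * x′ + a′ → x ≡ x′
  σ-cancel {x} {x′} wa wa′ eq with ℤ.<-cmp x x′
  ... | tri≈ _ x≡x′ _ = x≡x′
  ... | tri< x<x′ _ _ = ⊥-elim (σ-apart wa wa′ eq x<x′)
  ... | tri> _ _ x′<x = ⊥-elim (σ-apart wa′ wa (sym eq) x′<x)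

  block-unique : ∀ {g g′ o o′} → InBlock o → InBlock o′ → σ ⊛ g ⊕ o ≡ σ ⊛ g′ ⊕ o′ → g ≡ g′ × o ≡ o′
  block-unique {x , y} {x′ , y′} (p , q) (p′ , q′) eq
    with σ-cancel {x} {x′} p p′ (cong proj₁ eq) | σ-cancel {y} {y′} q q′ (cong proj₂ eq)
  ... | refl | refl = refl , cell-≡ (cancel (σ * x) _ _ (cong proj₁ eq))
                             (cancel (σ * y) _ _ (cong proj₂ eq))
    where
    cancel : ∀ s a b → s + a ≡ s + b → a ≡ b
    cancel = lin 3 (λ s a b → s ⊞ a ≗ s ⊞ b ⇒ goal (a ≗ b))

  block-coordinate : ∀ z → ∃[ x ] ∃[ a ] z ≡ σ * x + a × Within M a
  block-coordinate z = x , a , trans split (cong (_+ a) (ℤ.*-comm x σ)) , lower , upper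
    where
    -- Adding `M` before the division centres the remainder about 0.
    r : ℕ
    r = (z + M) ℤ.%ℕ suc (2 ℕ.* m)
    x a : ℤ
    x = (z + M) ℤ./ℕ suc (2 ℕ.* m)
    a = + r - M
    split : z ≡ x * σ + a
    split = lin 4 (λ z m r s → z ⊞ m ≗ r ⊞ s ⇒ goal (z ≗ s ⊞ (r ⊟ m)))
      z M (+ r) (x * σ) (trans (ℤ.a≡a%ℕn+[a/ℕn]*n (z + M) (suc (2 ℕ.* m))) (cong (λ s → + r + x * s) (sym σ≡)))
    lower : - M ≤ a
    lower = lin 2 (λ r m → # 0 ≼ r ⇒ goal (⊟ m ≼ r ⊟ m)) (+ r) M (ℤ.+≤+ ℕ.z≤n)
    upper : a ≤ M
    upper = lin 3 (λ r m s → r ≺ s ⇒ s ≗ # 1 ⊞ 2 ⊠ m ⇒ goal (r ⊟ m ≼ m))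
      (+ r) M σ (subst (+ r <_) (sym σ≡) (ℤ.+<+ (ℤ.n%ℕd<d (z + M) (suc (2 ℕ.* m))))) σ-value

  block-of : ∀ c → ∃[ g ] ∃[ o ] c ≡ σ ⊛ g ⊕ o × InBlock o
  block-of (x , y) with block-coordinate x | block-coordinate y
  ... | g , a , eq , w | g′ , a′ , eq′ , w′ = (g , g′) , (a , a′) , cell-≡ eq eq′ , w , w′

  -- A coordinate of a cell of a block that is far enough both from the middle
  -- and from the boundary of the block that no dent reaches there.
  SolidCoordinate : ℤ → Set
  SolidCoordinate a = (+ 7 ≤ a × a ≤ M - + 6 * ℓ) ⊎ (+ 7 ≤ - a × - a ≤ M - + 6 * ℓ)

  Solid : Cell → Set
  Solid (x , y) = InBlock (x , y) × (SolidCoordinate x ⊎ SolidCoordinate y)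

  solid-coordinate-neg : ∀ {a} → SolidCoordinate a → SolidCoordinate (- a)
  solid-coordinate-neg (inj₂ s) = inj₁ s
  solid-coordinate-neg {a} (inj₁ s) =
    inj₂ (subst (λ b → + 7 ≤ b × b ≤ M - + 6 * ℓ) (sym (ℤ.neg-involutive a)) s)

  within-small : ∀ {a} → Within (+ 7) a → Within M a
  within-small {a} (p , q) =
    lin 3 (λ a l m → ⊟ # 7 ≼ a ⇒ # 1 ≼ l ⇒ 12 ⊠ l ⊞ # 40 ≼ m ⇒ goal (⊟ m ≼ a)) a ℓ M p 1≤l large ,
    lin 3 (λ a l m → a ≼ # 7 ⇒ # 1 ≼ l ⇒ 12 ⊠ l ⊞ # 40 ≼ m ⇒ goal (a ≼ m)) a ℓ M q 1≤l large

  within-zero : Within M 0ℤ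
  within-zero = within-small (ℤ.-≤+ , ℤ.+≤+ ℕ.z≤n)

  solid-seven : SolidCoordinate (+ 7)
  solid-seven = inj₁ (ℤ.≤-refl ,
    lin 2 (λ l m → # 1 ≼ l ⇒ 12 ⊠ l ⊞ # 40 ≼ m ⇒ goal (# 7 ≼ m ⊟ 6 ⊠ l)) ℓ M 1≤l large)

  solid-coordinate-within : ∀ {a} → SolidCoordinate a → Within M a
  solid-coordinate-within {a} (inj₁ (p , q)) =
    lin 3 (λ a l m → # 7 ≼ a ⇒ # 1 ≼ l ⇒ 12 ⊠ l ⊞ # 40 ≼ m ⇒ goal (⊟ m ≼ a)) a ℓ M p 1≤l large ,
    lin 3 (λ a l m → a ≼ m ⊟ 6 ⊠ l ⇒ # 1 ≼ l ⇒ goal (a ≼ m)) a ℓ M q 1≤l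
  solid-coordinate-within {a} (inj₂ (p , q)) =
    lin 3 (λ a l m → ⊟ a ≼ m ⊟ 6 ⊠ l ⇒ # 1 ≼ l ⇒ goal (⊟ m ≼ a)) a ℓ M q 1≤l ,
    lin 3 (λ a l m → # 7 ≼ ⊟ a ⇒ # 1 ≼ l ⇒ 12 ⊠ l ⊞ # 40 ≼ m ⇒ goal (a ≼ m)) a ℓ M p 1≤l large

  solid-loc⁻ : ∀ D {a b} → Solid (loc D a b) → SolidCoordinate a ⊎ SolidCoordinate b
  solid-loc⁻ east (_ , s) = s
  solid-loc⁻ north {a} {b} (_ , inj₁ s) = inj₂
      (subst SolidCoordinate (ℤ.neg-involutive b) (solid-coordinate-neg s))
  solid-loc⁻ north (_ , inj₂ s) = inj₁ s
  solid-loc⁻ west {a} {b} (_ , inj₁ s) = inj₁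
      (subst SolidCoordinate (ℤ.neg-involutive a) (solid-coordinate-neg s))
  solid-loc⁻ west {a} {b} (_ , inj₂ s) = inj₂
      (subst SolidCoordinate (ℤ.neg-involutive b) (solid-coordinate-neg s))
  solid-loc⁻ south (_ , inj₁ s) = inj₂ s
  solid-loc⁻ south {a} {b} (_ , inj₂ s) = inj₁
      (subst SolidCoordinate (ℤ.neg-involutive a) (solid-coordinate-neg s))

  -- The difference of the centres of two blocks that overlap in a solid cell
  -- of both.
  Near : Cell → Set
  Near (x , y) = (Within (M + + 7) x × Within (+ 2 * M) y) ⊎ (Within (+ 2 * M) x × Within (M + + 7) y)

  near-loc : ∀ D {a b} → Near (a , b) → Near (loc D a b)
  near-loc east  n = n
  near-loc north (inj₁ (p , q)) = inj₂ (within-neg q , p)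
  near-loc north (inj₂ (p , q)) = inj₁ (within-neg q , p)
  near-loc west  (inj₁ (p , q)) = inj₁ (within-neg p , within-neg q)
  near-loc west  (inj₂ (p , q)) = inj₂ (within-neg p , within-neg q)
  near-loc south (inj₁ (p , q)) = inj₂ (q , within-neg p)
  near-loc south (inj₂ (p , q)) = inj₁ (q , within-neg p)

  -- The column `6ℓ + 7` of one block is the column `6ℓ + 7 - a` of the other: at least 7 if
  -- `a ≤ 6ℓ`, at most -7 if `a ≥ 6ℓ + 14`. For the 13 shifts in between, the column `6ℓ + 20`
  -- serves. With `a = M + 7` the column `6ℓ + 7` just meets the bound `M - 6ℓ` on the other side.
  common-solid⁺ : ∀ a → 0ℤ ≤ a → a ≤ M + + 7 → ∃[ x ] SolidCoordinate x × SolidCoordinate (x - a)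
  common-solid⁺ a 0≤a a≤ with a ℤ.≤? + 6 * ℓ | + 6 * ℓ + + 14 ℤ.≤? a
  ... | yes p | _ = + 6 * ℓ + + 7 , near-side , inj₁ (
        lin 2 (λ l a → a ≼ 6 ⊠ l ⇒ goal (# 7 ≼ 6 ⊠ l ⊞ # 7 ⊟ a)) ℓ a p ,
        lin 3 (λ l m a → # 0 ≼ a ⇒ 12 ⊠ l ⊞ # 40 ≼ m ⇒ goal (6 ⊠ l ⊞ # 7 ⊟ a ≼ m ⊟ 6 ⊠ l)) ℓ M a 0≤a large)
    where
    near-side : SolidCoordinate (+ 6 * ℓ + + 7)
    near-side = inj₁ (
      lin 1 (λ l → # 1 ≼ l ⇒ goal (# 7 ≼ 6 ⊠ l ⊞ # 7)) ℓ 1≤l ,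
      lin 2 (λ l m → 12 ⊠ l ⊞ # 40 ≼ m ⇒ goal (6 ⊠ l ⊞ # 7 ≼ m ⊟ 6 ⊠ l)) ℓ M large)
  ... | no _ | yes p = + 6 * ℓ + + 7 , inj₁ (
        lin 1 (λ l → # 1 ≼ l ⇒ goal (# 7 ≼ 6 ⊠ l ⊞ # 7)) ℓ 1≤l ,
        lin 2 (λ l m → 12 ⊠ l ⊞ # 40 ≼ m ⇒ goal (6 ⊠ l ⊞ # 7 ≼ m ⊟ 6 ⊠ l)) ℓ M large) , inj₂ (
        lin 2 (λ l a → 6 ⊠ l ⊞ # 14 ≼ a ⇒ goal (# 7 ≼ ⊟ (6 ⊠ l ⊞ # 7 ⊟ a))) ℓ a p ,
        lin 3 (λ l m a → a ≼ m ⊞ # 7 ⇒ goal (⊟ (6 ⊠ l ⊞ # 7 ⊟ a) ≼ m ⊟ 6 ⊠ l)) ℓ M a a≤)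
  ... | no p | no q = + 6 * ℓ + + 20 , inj₁ (
        lin 1 (λ l → # 1 ≼ l ⇒ goal (# 7 ≼ 6 ⊠ l ⊞ # 20)) ℓ 1≤l ,
        lin 2 (λ l m → 12 ⊠ l ⊞ # 40 ≼ m ⇒ goal (6 ⊠ l ⊞ # 20 ≼ m ⊟ 6 ⊠ l)) ℓ M large) , inj₁ (
        lin 2 (λ l a → a ≺ 6 ⊠ l ⊞ # 14 ⇒ goal (# 7 ≼ 6 ⊠ l ⊞ # 20 ⊟ a)) ℓ a (ℤ.≰⇒> q) ,
        lin 3 (λ l m a → 6 ⊠ l ≺ a ⇒ # 1 ≼ l ⇒ 12 ⊠ l ⊞ # 40 ≼ m ⇒ goal (6 ⊠ l ⊞ # 20 ⊟ a ≼ m ⊟ 6 ⊠ l))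
          ℓ M a (ℤ.≰⇒> p) 1≤l large)

  common-solid : ∀ a → Within (M + + 7) a → ∃[ x ] SolidCoordinate x × SolidCoordinate (x - a)
  common-solid a (p , q) with ℤ.≤-total 0ℤ a
  ... | inj₁ 0≤a = common-solid⁺ a 0≤a q
  ... | inj₂ a≤0 with common-solid⁺ (- a) (lin 1 (λ a → a ≼ # 0 ⇒ goal (# 0 ≼ ⊟ a)) a a≤0)
                                          (lin 2 (λ a m → ⊟ (m ⊞ # 7) ≼ a ⇒ goal (⊟ a ≼ m ⊞ # 7)) a M p)
  ...   | x , s , t = - x , solid-coordinate-neg s ,
    subst SolidCoordinate (lin 2 (λ a x → goal (⊟ (x ⊟ ⊟ a) ≗ ⊟ x ⊟ a)) a x) (solid-coordinate-neg t)

  common-coordinate : ∀ a → Within (+ 2 * M) a → ∃[ x ] Within M x × Within M (x - a)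
  common-coordinate a (p , q) with ℤ.≤-total 0ℤ a
  ... | inj₁ 0≤a = M ,
    (lin 2 (λ l m → # 1 ≼ l ⇒ 12 ⊠ l ⊞ # 40 ≼ m ⇒ goal (⊟ m ≼ m)) ℓ M 1≤l large , ℤ.≤-refl) ,
    lin 2 (λ a m → a ≼ 2 ⊠ m ⇒ goal (⊟ m ≼ m ⊟ a)) a M q ,
    lin 2 (λ a m → # 0 ≼ a ⇒ goal (m ⊟ a ≼ m)) a M 0≤a
  ... | inj₂ a≤0 = - M ,
    (ℤ.≤-refl , lin 2 (λ l m → # 1 ≼ l ⇒ 12 ⊠ l ⊞ # 40 ≼ m ⇒ goal (⊟ m ≼ m)) ℓ M 1≤l large) ,
    lin 2 (λ a m → a ≼ # 0 ⇒ goal (⊟ m ≼ ⊟ m ⊟ a)) a M a≤0 ,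
    lin 2 (λ a m → ⊟ (2 ⊠ m) ≼ a ⇒ goal (⊟ m ⊟ a ≼ m)) a M p

  common-solid-cell : ∀ {d} → Near d → ∃[ o ] ∃[ o′ ] Solid o × Solid o′ × o ≡ d ⊕ o′
  common-solid-cell {a , b} (inj₁ (wa , wb)) with common-solid a wa | common-coordinate b wb
  ... | x , s , t | y , u , v = (x , y) , (x - a , y - b) ,
    ((solid-coordinate-within s , u) , inj₁ s) , ((solid-coordinate-within t , v) , inj₁ t) ,
    cell-≡ (restore x a) (restore y b)
    where
    restore : ∀ x a → x ≡ a + (x - a)
    restore = lin 2 (λ x a → goal (x ≗ a ⊞ (x ⊟ a)))
  common-solid-cell {a , b} (inj₂ (wa , wb)) with common-coordinate a wa | common-solid b wb
  ... | x , u , v | y , s , t = (x , y) , (x - a , y - b) ,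
    ((u , solid-coordinate-within s) , inj₂ s) , ((v , solid-coordinate-within t) , inj₂ t) ,
    cell-≡ (restore x a) (restore y b)
    where
    restore : ∀ x a → x ≡ a + (x - a)
    restore = lin 2 (λ x a → goal (x ≗ a ⊞ (x ⊟ a)))

  -- The position, relative to the centre of a block, of the cell in column x and
  -- row y of a dent in the side of the block that faces in direction D.
  dent : Dir → Cell → Cell
  dent D (x , y) = loc D (M + 1ℤ - y) (- (1ℤ + x))

  dent-⊕ : ∀ D t w → dent D (t ⊕ w) ≡ dent D t ⊕ flip D w
  dent-⊕ D (x , y) (x′ , y′) = trans
    (cong₂ (loc D) (lin 3 (λ m y y′ → goal (m ⊞ # 1 ⊟ (y ⊞ y′) ≗ m ⊞ # 1 ⊟ y ⊞ ⊟ y′)) M y y′)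
                   (lin 2 (λ x x′ → goal (⊟ (# 1 ⊞ (x ⊞ x′)) ≗ ⊟ (# 1 ⊞ x) ⊞ ⊟ x′)) x x′))
    (sym (loc-⊕ D (M + 1ℤ - y) (- (1ℤ + x)) (- y′) (- x′)))

  dent-surjective : ∀ D o → ∃[ t ] o ≡ dent D t
  dent-surjective D o with loc-surjective D o
  ... | a , b , eq = (- b - 1ℤ , M + 1ℤ - a) , trans eq (cong₂ (loc D)
    (lin 2 (λ m a → goal (a ≗ m ⊞ # 1 ⊟ (m ⊞ # 1 ⊟ a))) M a)
    (lin 1 (λ b → goal (b ≗ ⊟ (# 1 ⊞ (⊟ b ⊟ # 1)))) b))

  dent-injective : ∀ D {t t′} → dent D t ≡ dent D t′ → t ≡ t′
  dent-injective D {x , y} {x′ , y′} eq = cell-≡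
    (lin 2 (λ x y → ⊟ (# 1 ⊞ x) ≗ ⊟ (# 1 ⊞ y) ⇒ goal (x ≗ y)) x x′ (proj₂ (loc-injective D eq)))
    (lin 3 (λ x y m → m ⊞ # 1 ⊟ x ≗ m ⊞ # 1 ⊟ y ⇒ goal (x ≗ y)) y y′ M (proj₁ (loc-injective D eq)))

  -- The box around a dent that contains the dent and the cells next to it.
  Zone : Cell → Set
  Zone (x , y) = (-1ℤ ≤ x × x ≤ + 6) × 1ℤ ≤ y × y ≤ + 6 * ℓ + 1ℤ

  InnerZone : Cell → Set
  InnerZone (x , y) = (0ℤ ≤ x × x ≤ + 5) × 1ℤ ≤ y × y ≤ + 6 * ℓ

  inner⇒zone : ∀ {t} → InnerZone t → Zone t
  inner⇒zone {x , y} ((p , q) , r , s) =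
    (lin 1 (λ x → # 0 ≼ x ⇒ goal (⊟ # 1 ≼ x)) x p , lin 1 (λ x → x ≼ # 5 ⇒ goal (x ≼ # 6)) x q) ,
    r , lin 2 (λ y l → y ≼ 6 ⊠ l ⇒ goal (y ≼ 6 ⊠ l ⊞ # 1)) y ℓ s

  dent-in-block : ∀ D {t} → Zone t → InBlock (dent D t)
  dent-in-block D {x , y} ((p , q) , r , s) = in-block-loc D
    (lin 3 (λ y l m → y ≼ 6 ⊠ l ⊞ # 1 ⇒ # 1 ≼ l ⇒ 12 ⊠ l ⊞ # 40 ≼ m ⇒ goal
        (⊟ m ≼ m ⊞ # 1 ⊟ y)) y ℓ M s 1≤l large ,
     lin 2 (λ y m → # 1 ≼ y ⇒ goal (m ⊞ # 1 ⊟ y ≼ m)) y M r)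
    (lin 3 (λ x l m → x ≼ # 6 ⇒ # 1 ≼ l ⇒ 12 ⊠ l ⊞ # 40 ≼ m ⇒ goal (⊟ m ≼ ⊟ (# 1 ⊞ x))) x ℓ M q 1≤l large ,
     lin 3 (λ x l m → ⊟ # 1 ≼ x ⇒ # 1 ≼ l ⇒ 12 ⊠ l ⊞ # 40 ≼ m ⇒ goal (⊟ (# 1 ⊞ x) ≼ m)) x ℓ M p 1≤l large)

  dent-not-solid : ∀ D {t} → InnerZone t → ¬ Solid (dent D t)
  dent-not-solid D {x , y} ((p , q) , r , s) solid with solid-loc⁻ D solid
  ... | inj₁ (inj₁ (_ , u)) = lin 3 (λ y l m → m ⊞ # 1 ⊟ y ≼ m ⊟ 6 ⊠ l ⇒ y ≼ 6 ⊠ l ⇒ goal false) y ℓ M u s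
  ... | inj₁ (inj₂ (u , _)) = lin 3
      (λ y l m → # 7 ≼ ⊟ (m ⊞ # 1 ⊟ y) ⇒ y ≼ 6 ⊠ l ⇒ # 1 ≼ l ⇒ 12 ⊠ l ⊞ # 40 ≼ m ⇒ goal
      false) y ℓ M u s 1≤l large
  ... | inj₂ (inj₁ (u , _)) = lin 1 (λ x → # 7 ≼ ⊟ (# 1 ⊞ x) ⇒ # 0 ≼ x ⇒ goal false) x u p
  ... | inj₂ (inj₂ (u , _)) = lin 1 (λ x → # 7 ≼ ⊟ ⊟ (# 1 ⊞ x) ⇒ x ≼ # 5 ⇒ goal false) x u q

  -- Seen in direction `D`, a zone of `D` lies at least `M - 6ℓ` ahead of the centre. A zone of a
  -- neighbouring side lies at most 7 ahead, and one of the opposite side lies behind.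
  dent-unique : ∀ {D D′ t t′} → Zone t → Zone t′ → dent D t ≡ dent D′ t′ → D ≡ D′ × t ≡ t′
  dent-unique {D} {D′} {x , y} {x′ , y′} ((p , q) , r , s) ((p′ , q′) , r′ , s′) eq with relative D D′
  ... | same = refl , dent-injective D eq
  ... | left = ⊥-elim (lin 4 (λ y x l m → m ⊞ # 1 ⊟ y ≗ ⊟ ⊟ (# 1 ⊞ x) ⇒ x ≼ # 6 ⇒
      y ≼ 6 ⊠ l ⊞ # 1 ⇒ # 1 ≼ l ⇒ 12 ⊠ l ⊞ # 40 ≼ m ⇒ goal false)
    y x′ ℓ M (proj₁ (loc-injective D (trans eq (loc-turn D _ _)))) q′ s 1≤l large)
  ... | behind = ⊥-elim (lin 4 (λ y z l m → m ⊞ # 1 ⊟ y ≗ ⊟ (m ⊞ # 1 ⊟ z) ⇒ z ≼ 6 ⊠ l ⊞ # 1 ⇒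
      y ≼ 6 ⊠ l ⊞ # 1 ⇒ # 1 ≼ l ⇒ 12 ⊠ l ⊞ # 40 ≼ m ⇒ goal false)
    y y′ ℓ M (proj₁ (loc-injective D (trans eq (loc-opposite D _ _)))) s′ s 1≤l large)
  ... | right = ⊥-elim (lin 4 (λ y x l m → m ⊞ # 1 ⊟ y ≗ ⊟ ⊟ ⊟ (# 1 ⊞ x) ⇒ ⊟ # 1 ≼ x ⇒
      y ≼ 6 ⊠ l ⊞ # 1 ⇒ # 1 ≼ l ⇒ 12 ⊠ l ⊞ # 40 ≼ m ⇒ goal false)
    y x′ ℓ M (proj₁ (loc-injective D
        (trans eq (trans (loc-turn (opposite D) _ _) (loc-opposite D _ _))))) p′ s 1≤l large)

  shift-centre : ∀ C C′ u v w → C ⊕ u ≡ C′ ⊕ v → C′ ⊕ w ≡ C ⊕ (u ⊕ (⊖ v ⊕ w))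
  shift-centre C C′ u v w eq = cell-≡
    (moved (proj₁ C) (proj₁ C′) (proj₁ u) (proj₁ v) (proj₁ w) (cong proj₁ eq))
    (moved (proj₂ C) (proj₂ C′) (proj₂ u) (proj₂ v) (proj₂ w) (cong proj₂ eq))
    where
    moved : ∀ c c′ u v w → c + u ≡ c′ + v → c′ + w ≡ c + (u + (- v + w))
    moved = lin 5 (λ c c′ u v w → c ⊞ u ≗ c′ ⊞ v ⇒ goal (c′ ⊞ w ≗ c ⊞ (u ⊞ (⊟ v ⊞ w))))

  overlapping : ∀ {C C′ d} → Near d → C′ ≡ C ⊕ d → ∃[ o ] ∃[ o′ ] Solid o × Solid o′ × C ⊕ o ≡ C′ ⊕ o′
  overlapping {C} near refl with common-solid-cell near
  ... | o , o′ , s , s′ , refl = o , o′ , s , s′ , sym (⊕-assoc C _ o′)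

  ⊛-vec : ∀ a D → a ⊛ vec D ≡ loc D a 0ℤ
  ⊛-vec a east  = cell-≡ (ℤ.*-identityʳ a) (ℤ.*-zeroʳ a)
  ⊛-vec a north = cell-≡ (ℤ.*-zeroʳ a) (ℤ.*-identityʳ a)
  ⊛-vec a west  = cell-≡ (trans (ℤ.*-comm a -1ℤ) (ℤ.-1*i≡-i a)) (ℤ.*-zeroʳ a)
  ⊛-vec a south = cell-≡ (ℤ.*-zeroʳ a) (trans (ℤ.*-comm a -1ℤ) (ℤ.-1*i≡-i a))

  -- The innermost cell of a dent.
  deep : Cell
  deep = 0ℤ , + 6 * ℓ - + 2

  deep-depth : Within M (M + 1ℤ - (+ 6 * ℓ - + 2))
  deep-depth =
    lin 2 (λ l m → # 1 ≼ l ⇒ 12 ⊠ l ⊞ # 40 ≼ m ⇒ goal (⊟ m ≼ m ⊞ # 1 ⊟ (6 ⊠ l ⊟ # 2))) ℓ M 1≤l large ,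
    lin 2 (λ l m → # 1 ≼ l ⇒ goal (m ⊞ # 1 ⊟ (6 ⊠ l ⊟ # 2) ≼ m)) ℓ M 1≤l

  deep-column : Within (+ 7) (- (1ℤ + 0ℤ))
  deep-column = ℤ.-≤- ℕ.z≤n , ℤ.-≤+

  -- The cell `deep` is one column off the middle, so along the side the centres differ by no more
  -- than `M + 7`; this is the coordinate in which a solid value common to both is found.
  near-deep : ∀ D {C C′ o} → InBlock o → C ⊕ dent D deep ≡ C′ ⊕ o → ∃[ d ] Near d × C′ ≡ C ⊕ d
  near-deep D {C} {C′} {o} ino eq with loc-surjective D o
  ... | a , b , refl with in-block-loc⁻ D {a} {b} ino
  ...   | wa , wb = loc D (A + - a) (B + - b) ,
          near-loc D (inj₂ (within-sum deep-depth (within-neg wa) (lin 1 (λ m → goal (m ⊞ m ≼ 2 ⊠ m)) M) ,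
                            within-sum deep-column (within-neg wb) (ℤ.≤-reflexive (ℤ.+-comm (+ 7) M)))) ,
          trans (sym (⊕-identityʳ C′)) (trans (shift-centre C C′ (dent D deep) (loc D a b) origin eq)
            (cong (C ⊕_) (trans
              (cong (dent D deep ⊕_) (trans (⊕-identityʳ (⊖ loc D a b)) (loc-⊖ D a b)))
              (loc-⊕ D A B (- a) (- b)))))
    where
    A B : ℤ
    A = M + 1ℤ - (+ 6 * ℓ - + 2)
    B = - (1ℤ + 0ℤ)

  -- A key protrudes into the block at `C′`, so its owner is centred at `C′ ⊕ σ ⊛ vec D′`. If the
  -- key points into the dent but is not fully inserted, then `y ≤ 6ℓ - 3` and the owner comes at
  -- least one row too close. If it arrives from another direction, it is too short to reach `deep`
  -- without its owner overlapping the block at `C`. The hypothesis on `t` says that nothing but the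
  -- tip of the key reaches the last rows.
  near-or-facing : ∀ {D D′ C C′ t} → InnerZone t → (+ 6 * ℓ - + 2 ≤ proj₂ t → t ≡ deep) →
    C ⊕ dent D deep ≡ C′ ⊕ dent D′ t →
    (C ≡ C′ × D ≡ D′) ⊎ (∃[ d ] Near d × C′ ⊕ σ ⊛ vec D′ ≡ C ⊕ d)
  near-or-facing {D} {D′} {C} {C′} {x , y} ((x₁ , x₂) , y₁ , y₂) tip eq = by (relative D D′)
    where
    -- The vector `loc D A B` leads from `C` to the common cell, and `loc D′ P Q` from there to the
    -- centre of the owner of the key.
    A B P Q : ℤ
    A = M + 1ℤ - (+ 6 * ℓ - + 2)
    B = - (1ℤ + 0ℤ)
    P = - (M + 1ℤ - y) + σ
    Q = - - (1ℤ + x) + 0ℤ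

    P≡ : P ≡ M + y
    P≡ = lin 3 (λ y m s → s ≗ # 1 ⊞ 2 ⊠ m ⇒ goal (⊟ (m ⊞ # 1 ⊟ y) ⊞ s ≗ m ⊞ y)) y M σ σ-value

    wP : Within (M + + 6 * ℓ) P
    wP = subst (Within (M + + 6 * ℓ)) (sym P≡)
      (lin 3 (λ y l m → # 1 ≼ y ⇒ # 1 ≼ l ⇒ 12 ⊠ l ⊞ # 40 ≼ m ⇒ goal
          (⊟ (m ⊞ 6 ⊠ l) ≼ m ⊞ y)) y ℓ M y₁ 1≤l large ,
       lin 3 (λ y l m → y ≼ 6 ⊠ l ⇒ goal (m ⊞ y ≼ m ⊞ 6 ⊠ l)) y ℓ M y₂)

    wQ : Within (+ 7) Q
    wQ = lin 1 (λ x → # 0 ≼ x ⇒ goal (⊟ # 7 ≼ ⊟ ⊟ (# 1 ⊞ x) ⊞ # 0)) x x₁ ,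
         lin 1 (λ x → x ≼ # 5 ⇒ goal (⊟ ⊟ (# 1 ⊞ x) ⊞ # 0 ≼ # 7)) x x₂

    14≤ : + 7 + + 7 ≤ M + + 7
    14≤ = lin 2 (λ l m → # 1 ≼ l ⇒ 12 ⊠ l ⊞ # 40 ≼ m ⇒ goal (# 7 ⊞ # 7 ≼ m ⊞ # 7)) ℓ M 1≤l large

    wide : + 7 + (M + + 6 * ℓ) ≤ + 2 * M
    wide = lin 2 (λ l m → # 1 ≼ l ⇒ 12 ⊠ l ⊞ # 40 ≼ m ⇒ goal (# 7 ⊞ (m ⊞ 6 ⊠ l) ≼ 2 ⊠ m)) ℓ M 1≤l large

    centre : ∀ {a b} → loc D′ P Q ≡ loc D a b → C′ ⊕ σ ⊛ vec D′ ≡ C ⊕ loc D (A + a) (B + b)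
    centre {a} {b} eq′ = trans (shift-centre C C′ (dent D deep) (dent D′ (x , y)) (σ ⊛ vec D′) eq)
      (cong (C ⊕_) (trans
        (cong (loc D A B ⊕_) (trans (cong₂ _⊕_ (loc-⊖ D′ (M + 1ℤ - y) (- (1ℤ + x))) (⊛-vec σ D′))
          (trans (loc-⊕ D′ (- (M + 1ℤ - y)) (- - (1ℤ + x)) σ 0ℤ) eq′)))
        (loc-⊕ D A B a b)))

    by : Relative D D′ → (C ≡ C′ × D ≡ D′) ⊎ (∃[ d ] Near d × C′ ⊕ σ ⊛ vec D′ ≡ C ⊕ d)
    by same with + 6 * ℓ - + 2 ℤ.≤? y
    ... | yes le = inj₁ (aligned (tip le) , refl)
      where
      aligned : (x , y) ≡ deep → C ≡ C′
      aligned refl = ⊕-cancelʳ (dent D deep) C C′ eq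
    ... | no ¬le = inj₂ (loc D (A + P) (B + Q) ,
        near-loc D (inj₂ (subst (λ P → Within (+ 2 * M) (A + P)) (sym P≡) depth ,
            within-sum deep-column wQ 14≤)) ,
        centre refl)
      where
      depth : Within (+ 2 * M) (A + (M + y))
      depth =
        lin 3 (λ y l m → # 1 ≼ y ⇒ # 1 ≼ l ⇒ 12 ⊠ l ⊞ # 40 ≼ m ⇒
          goal (⊟ (2 ⊠ m) ≼ (m ⊞ # 1 ⊟ (6 ⊠ l ⊟ # 2)) ⊞ (m ⊞ y))) y ℓ M y₁ 1≤l large ,
        lin 3 (λ y l m → y ≺ 6 ⊠ l ⊟ # 2 ⇒ goal ((m ⊞ # 1 ⊟ (6 ⊠ l ⊟ # 2)) ⊞ (m ⊞ y) ≼ 2 ⊠ m)) y ℓ M (ℤ.≰⇒> ¬le)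
    by left = inj₂ (loc D (A + - Q) (B + P) ,
      near-loc D (inj₁ (within-sum deep-depth (within-neg wQ) ℤ.≤-refl , within-sum deep-column wP wide)) ,
      centre (loc-turn D P Q))
    by behind = inj₂ (loc D (A + - P) (B + - Q) ,
      near-loc D (inj₂ (subst (λ P → Within (+ 2 * M) (A + - P)) (sym P≡) depth ,
                        within-sum deep-column (within-neg wQ) 14≤)) ,
      centre (loc-opposite D P Q))
      where
      depth : Within (+ 2 * M) (A + - (M + y))
      depth =
        lin 3 (λ y l m → y ≼ 6 ⊠ l ⇒ # 1 ≼ l ⇒ 12 ⊠ l ⊞ # 40 ≼ m ⇒
          goal (⊟ (2 ⊠ m) ≼ (m ⊞ # 1 ⊟ (6 ⊠ l ⊟ # 2)) ⊞ ⊟ (m ⊞ y))) y ℓ M y₂ 1≤l large ,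
        lin 3 (λ y l m → # 1 ≼ y ⇒ # 1 ≼ l ⇒ 12 ⊠ l ⊞ # 40 ≼ m ⇒
          goal ((m ⊞ # 1 ⊟ (6 ⊠ l ⊟ # 2)) ⊞ ⊟ (m ⊞ y) ≼ 2 ⊠ m)) y ℓ M y₁ 1≤l large
    by right = inj₂ (loc D (A + - - Q) (B + - P) ,
      near-loc D (inj₁ (within-sum deep-depth (within-neg (within-neg wQ)) ℤ.≤-refl ,
                        within-sum deep-column (within-neg wP) wide)) ,
      centre (trans (loc-turn (opposite D) P Q) (loc-opposite D (- Q) P)))

-- Teeth

infix 4 _≟ᶜ_
_≟ᶜ_ : DecidableEquality Cell
_≟ᶜ_ = ≡-dec ℤ._≟_ ℤ._≟_

tooth? : ∀ c → Dec (Tooth c)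
tooth? (x , y) = (x ℤ.≟ 0ℤ ×-dec ℤ.∣ y ∣ ℕ.≤? 2) ⊎-dec (y ℤ.≟ 0ℤ ×-dec ℤ.∣ x ∣ ℕ.≤? 2)

toothCells : List Cell
toothCells =
  (0ℤ , 0ℤ) ∷ (0ℤ , + 1) ∷ (0ℤ , + 2) ∷ (0ℤ , -[1+ 0 ]) ∷ (0ℤ , -[1+ 1 ]) ∷
  (+ 1 , 0ℤ) ∷ (+ 2 , 0ℤ) ∷ (-[1+ 0 ] , 0ℤ) ∷ (-[1+ 1 ] , 0ℤ) ∷ []

tooth⇒∈ : ∀ {c} → Tooth c → c ∈ toothCells
tooth⇒∈ {_ , + 0}                 (inj₁ (refl , _)) = here refl
tooth⇒∈ {_ , + 1}                 (inj₁ (refl , _)) = there (here refl)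
tooth⇒∈ {_ , + 2}                 (inj₁ (refl , _)) = there (there (here refl))
tooth⇒∈ {_ , + suc (suc (suc _))} (inj₁ (refl , s≤s (s≤s ())))
tooth⇒∈ {_ , -[1+ 0 ]}            (inj₁ (refl , _)) = there (there (there (here refl)))
tooth⇒∈ {_ , -[1+ 1 ]}            (inj₁ (refl , _)) = there (there (there (there (here refl))))
tooth⇒∈ {_ , -[1+ suc (suc _) ]}  (inj₁ (refl , s≤s (s≤s ())))
tooth⇒∈ {+ 0 , _}                 (inj₂ (refl , _)) = here refl
tooth⇒∈ {+ 1 , _}                 (inj₂ (refl , _)) = there (there (there (there (there (here refl)))))
tooth⇒∈ {+ 2 , _}                 (inj₂ (refl , _)) =
  there (there (there (there (there (there (here refl))))))
tooth⇒∈ {+ suc (suc (suc _)) , _} (inj₂ (refl , s≤s (s≤s ())))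
tooth⇒∈ { -[1+ 0 ] , _}           (inj₂ (refl , _)) =
  there (there (there (there (there (there (there (here refl)))))))
tooth⇒∈ { -[1+ 1 ] , _}           (inj₂ (refl , _)) =
  there (there (there (there (there (there (there (there (here refl))))))))
tooth⇒∈ { -[1+ suc (suc _) ] , _} (inj₂ (refl , s≤s (s≤s ())))

within : ∀ {a k} → ℤ.∣ a ∣ ℕ.≤ k → Within (+ k) a
within {+ a} {k} le = ℤ.≤-trans (ℤ.neg-≤-pos {k} {0}) (ℤ.+≤+ z≤n) , ℤ.+≤+ le
within { -[1+ a ]} {suc k} (s≤s le) = ℤ.-≤- le , ℤ.-≤+

within⁻ : ∀ {a k} → Within (+ k) a → ℤ.∣ a ∣ ℕ.≤ k
within⁻ {+ a} (_ , ℤ.+≤+ le) = le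
within⁻ { -[1+ a ]} {suc k} (ℤ.-≤- le , _) = s≤s le

tooth-bounds : ∀ {x y} → Tooth (x , y) → Within (+ 2) x × Within (+ 2) y
tooth-bounds (inj₁ (refl , le)) = within {0ℤ} z≤n , within le
tooth-bounds (inj₂ (refl , le)) = within le , within {0ℤ} z≤n

tooth-swap : ∀ {x y} → Tooth (x , y) → Tooth (y , x)
tooth-swap (inj₁ t) = inj₂ t
tooth-swap (inj₂ t) = inj₁ t

tooth-negʳ : ∀ {x y} → Tooth (x , y) → Tooth (x , - y)
tooth-negʳ {x} {y} (inj₁ (refl , le)) = inj₁ (refl , subst (ℕ._≤ 2) (sym (ℤ.∣-i∣≡∣i∣ y)) le)
tooth-negʳ (inj₂ (refl , le)) = inj₂ (refl , le)

tooth-negˡ : ∀ {x y} → Tooth (x , y) → Tooth (- x , y)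
tooth-negˡ t = tooth-swap (tooth-negʳ (tooth-swap t))

tooth-loc : ∀ D {a b} → Tooth (a , b) → Tooth (loc D a b)
tooth-loc east  t = t
tooth-loc north t = tooth-swap (tooth-negʳ t)
tooth-loc west  t = tooth-negˡ (tooth-negʳ t)
tooth-loc south t = tooth-swap (tooth-negˡ t)

tooth-loc⁻ : ∀ D {a b} → Tooth (loc D a b) → Tooth (a , b)
tooth-loc⁻ east  t = t
tooth-loc⁻ north {a} {b} t = subst (λ c → Tooth (a , c)) (ℤ.neg-involutive b) (tooth-negʳ (tooth-swap t))
tooth-loc⁻ west  {a} {b} t = subst Tooth (cell-≡ (ℤ.neg-involutive a) (ℤ.neg-involutive b))
    (tooth-negˡ (tooth-negʳ t))
tooth-loc⁻ south {a} {b} t = subst (λ c → Tooth (c , b)) (ℤ.neg-involutive a) (tooth-negˡ (tooth-swap t))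

tooth-flip : ∀ D {c} → Tooth c → Tooth (flip D c)
tooth-flip D t = tooth-loc D (tooth-swap (tooth-negˡ (tooth-negʳ t)))

tooth-flip⁻ : ∀ D {c} → Tooth (flip D c) → Tooth c
tooth-flip⁻ D {x , y} t = subst Tooth (cell-≡ (ℤ.neg-involutive x) (ℤ.neg-involutive y))
  (tooth-negˡ (tooth-negʳ (tooth-swap (tooth-loc⁻ D t))))

-- The sixteen cells that share a side with a tooth at the origin without belonging to it.
ring : List Cell
ring =
  (+ 3 , 0ℤ) ∷ (-[1+ 2 ] , 0ℤ) ∷ (0ℤ , + 3) ∷ (0ℤ , -[1+ 2 ]) ∷
  (+ 1 , + 1) ∷ (+ 1 , -[1+ 0 ]) ∷ (-[1+ 0 ] , + 1) ∷ (-[1+ 0 ] , -[1+ 0 ]) ∷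
  (+ 1 , + 2) ∷ (+ 1 , -[1+ 1 ]) ∷ (-[1+ 0 ] , + 2) ∷ (-[1+ 0 ] , -[1+ 1 ]) ∷
  (+ 2 , + 1) ∷ (+ 2 , -[1+ 0 ]) ∷ (-[1+ 1 ] , + 1) ∷ (-[1+ 1 ] , -[1+ 0 ]) ∷ []

-- The centres must differ, since one tooth may cover several of the cells that are inspected.
Conflict : Cell → Cell → Set
Conflict z z′ = ¬ (z ≡ z′) × Any (λ w → Tooth ((z ⊕ w) ⊕ ⊖ z′)) toothCells

conflict? : ∀ z z′ → Dec (Conflict z z′)
conflict? z z′ = ¬? (z ≟ᶜ z′) ×-dec Any.any? (λ w → tooth? ((z ⊕ w) ⊕ ⊖ z′)) toothCells

-- Here u and v are a common cell of a tooth-shaped hole and of a tooth, relative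
-- to their centres.
meets-ring : ∀ {u v} → Tooth u → Tooth v → u ⊕ ⊖ v ≡ origin ⊎ Any (λ w → Tooth (w ⊕ ⊖ (u ⊕ ⊖ v))) ring
meets-ring t t′ = All.lookup (All.lookup (from-yes (All.all? (λ u → All.all? (λ v →
  (u ⊕ ⊖ v ≟ᶜ origin) ⊎-dec Any.any? (λ w → tooth? (w ⊕ ⊖ (u ⊕ ⊖ v))) ring) toothCells) toothCells))
  (tooth⇒∈ t)) (tooth⇒∈ t′)

ring-outside : All (λ w → ¬ Tooth w × ℤ.∣ proj₁ w ∣ ℕ.≤ 3 × ℤ.∣ proj₂ w ∣ ℕ.≤ 3) ring
ring-outside = from-yes (All.all? (λ w → ¬? (tooth? w) ×-dec
  (ℤ.∣ proj₁ w ∣ ℕ.≤? 3 ×-dec ℤ.∣ proj₂ w ∣ ℕ.≤? 3)) ring)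

-- Cells of the body around the innermost cell of a dent, relative to the
-- latter, that keep teeth out of the dent.
walls : List Cell
walls = (-1ℤ , 0ℤ) ∷ (1ℤ , 0ℤ) ∷ (0ℤ , 1ℤ) ∷ (-1ℤ , -[1+ 1 ]) ∷ []

-- The first three walls leave only the tip of an arm that lies along the dent; the crossbar of that
-- tooth, two rows nearer to the mouth, then hits the fourth.
meets-walls : ∀ {o} → Tooth o → Any (λ w → Tooth (w ⊕ o)) walls
meets-walls t = All.lookup
    (from-yes (All.all? (λ o → Any.any? (λ w → tooth? (w ⊕ o)) walls) toothCells)) (tooth⇒∈ t)

-- The search is nested, one stage per cell, so that a conflict cuts it off before the later cells
-- are tried.
Crowded₄ : (z₁ z₂ z₃ : Cell) → Cell → Set
Crowded₄ z₁ z₂ z₃ o₄ = Conflict origin z₄ ⊎ Conflict z₁ z₄ ⊎ Conflict z₂ z₄ ⊎ Conflict z₃ z₄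
  where z₄ = (+ 2 , + 2) ⊕ ⊖ o₄

Crowded₃ : (z₁ z₂ : Cell) → Cell → Set
Crowded₃ z₁ z₂ o₃ = (Conflict origin z₃ ⊎ Conflict z₁ z₃) ⊎ All (Crowded₄ z₁ z₂ z₃) toothCells
  where z₃ = (+ 2 , 1ℤ) ⊕ ⊖ o₃

Crowded₂ : (z₁ : Cell) → Cell → Set
Crowded₂ z₁ o₂ = (Conflict origin z₂ ⊎ Conflict z₁ z₂) ⊎ All (Crowded₃ z₁ z₂) toothCells
  where z₂ = (1ℤ , + 2) ⊕ ⊖ o₂

-- Teeth that cover the four cells in one corner of a tooth at the origin
-- cannot all be disjoint from it and from each other.
Crowded₁ : Cell → Set
Crowded₁ o₁ = Conflict origin z₁ ⊎ All (Crowded₂ z₁) toothCells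
  where z₁ = (1ℤ , 1ℤ) ⊕ ⊖ o₁

opaque
  crowded : All Crowded₁ toothCells
  crowded = from-yes (All.all? (λ o₁ → let z₁ = (1ℤ , 1ℤ) ⊕ ⊖ o₁ in
   conflict? origin z₁ ⊎-dec All.all? (λ o₂ → let z₂ = (1ℤ , + 2) ⊕ ⊖ o₂ in
   (conflict? origin z₂ ⊎-dec conflict? z₁ z₂) ⊎-dec All.all? (λ o₃ → let z₃ = (+ 2 , 1ℤ) ⊕ ⊖ o₃ in
   (conflict? origin z₃ ⊎-dec conflict? z₁ z₃) ⊎-dec All.all? (λ o₄ → let z₄ = (+ 2 , + 2) ⊕ ⊖ o₄ in
   conflict? origin z₄ ⊎-dec conflict? z₁ z₄ ⊎-dec conflict? z₂ z₄ ⊎-dec conflict? z₃ z₄)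
   toothCells) toothCells) toothCells) toothCells)

-- Keys and locks

module Dented (scaling : Scale) where

  open Scale scaling
  open Scaled scaling

  toothRow : Fin l → ℤ
  toothRow j = + 6 * + toℕ j + + 4

  toothRow≡ : ∀ j → + (6 ℕ.* suc (toℕ j) ℕ.∸ 2) ≡ toothRow j
  toothRow≡ j = trans (cong (λ k → + (k ℕ.∸ 2)) (trans (ℕ.*-suc 6 (toℕ j)) (ℕ.+-comm 6 (6 ℕ.* toℕ j))))
    (trans (cong +_ (ℕ.+-∸-assoc (6 ℕ.* toℕ j) {6} {2} (s≤s (s≤s z≤n))))
      (cong (_+ + 4) (ℤ.pos-* 6 (toℕ j))))

  topRow≡ : + (6 ℕ.* l ℕ.∸ 2) ≡ + 6 * ℓ - + 2
  topRow≡ = trans (lemma l (subst (1ℤ ≤_) ℓ≡ 1≤l)) (cong (λ k → + 6 * k - + 2) (sym ℓ≡))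
    where
    lemma : ∀ k → 1ℤ ≤ + k → + (6 ℕ.* k ℕ.∸ 2) ≡ + 6 * + k - + 2
    lemma zero (ℤ.+≤+ ())
    lemma (suc k) _ = trans (cong (λ k → + (k ℕ.∸ 2)) (trans (ℕ.*-suc 6 k) (ℕ.+-comm 6 (6 ℕ.* k))))
      (trans (cong +_ (ℕ.+-∸-assoc (6 ℕ.* k) {6} {2} (s≤s (s≤s z≤n))))
      (trans (cong (_+ + 4) (ℤ.pos-* 6 k))
        (lin 1 (λ k → goal (6 ⊠ k ⊞ # 4 ≗ 6 ⊠ (# 1 ⊞ k) ⊟ # 2)) (+ k))))

  data Spine : Cell → Set where
    spine : ∀ {y} → 1ℤ ≤ y → y ≤ + 6 * ℓ - + 2 → Spine (0ℤ , y)

  toothOffset : Fin l → Cell → Cell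
  toothOffset j (x , y) = x - + 3 , y - toothRow j

  ToothAt : Fin l → Cell → Set
  ToothAt j t = Tooth (toothOffset j t)

  toothCentre : Fin l → Cell
  toothCentre j = + 3 , toothRow j

  toothCentre-offset : ∀ j t → toothCentre j ⊕ toothOffset j t ≡ t
  toothCentre-offset j (x , y) = cell-≡ (lin 1 (λ x → goal (# 3 ⊞ (x ⊟ # 3) ≗ x)) x)
                                        (lin 2 (λ y r → goal (r ⊞ (y ⊟ r) ≗ y)) y (toothRow j))

  offset-toothCentre : ∀ j u → toothOffset j (toothCentre j ⊕ u) ≡ u
  offset-toothCentre j (x , y) = cell-≡ (lin 1 (λ x → goal (# 3 ⊞ x ⊟ # 3 ≗ x)) x)
                                        (lin 2 (λ y r → goal (r ⊞ y ⊟ r ≗ y)) y (toothRow j))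

  toothed-cases : ∀ {S t} → Toothed l S t → Spine t ⊎ (∃[ j ] j ∈ˢ S × ToothAt j t)
  toothed-cases {t = x , y} (inj₁ (refl , p , q)) = inj₁ (spine p (subst (y ≤_) topRow≡ q))
  toothed-cases {t = x , y} (inj₂ (j , j∈ , h)) =
    inj₂ (j , j∈ , subst (λ r → Tooth (x - + 3 , y - r)) (toothRow≡ j) h)

  spine⇒toothed : ∀ {S t} → Spine t → Toothed l S t
  spine⇒toothed (spine {y} p q) = inj₁ (refl , p , subst (y ≤_) (sym topRow≡) q)

  toothAt⇒toothed : ∀ {S j t} → j ∈ˢ S → ToothAt j t → Toothed l S t
  toothAt⇒toothed {j = j} {x , y} j∈ h =
    inj₂ (j , j∈ , subst (λ r → Tooth (x - + 3 , y - r)) (sym (toothRow≡ j)) h)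

  toothed? : ∀ S t → Dec (Toothed l S t)
  toothed? S (x , y) =
    (x ℤ.≟ 0ℤ ×-dec 1ℤ ℤ.≤? y ×-dec y ℤ.≤? + (6 ℕ.* l ℕ.∸ 2)) ⊎-dec
    Fin.any? (λ j → j ∈? S ×-dec tooth? (x - + 3 , y - + (6 ℕ.* suc (toℕ j) ℕ.∸ 2)))

  toothed-⊆ : ∀ {S S′ t} → S ⊆ˢ S′ → Toothed l S t → Toothed l S′ t
  toothed-⊆ S⊆S′ (inj₁ r) = inj₁ r
  toothed-⊆ S⊆S′ (inj₂ (j , j∈ , h)) = inj₂ (j , S⊆S′ j∈ , h)

  toothAt-bounds : ∀ {j x y} → ToothAt j (x , y) →
    (1ℤ ≤ x × x ≤ + 5) × toothRow j - + 2 ≤ y × y ≤ toothRow j + + 2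
  toothAt-bounds {j} {x} {y} h with tooth-bounds h
  ... | (p , q) , r , s =
    (lin 1 (λ x → ⊟ # 2 ≼ x ⊟ # 3 ⇒ goal (# 1 ≼ x)) x p , lin 1 (λ x → x ⊟ # 3 ≼ # 2 ⇒ goal (x ≼ # 5)) x q) ,
    lin 2 (λ y r → ⊟ # 2 ≼ y ⊟ r ⇒ goal (r ⊟ # 2 ≼ y)) y (toothRow j) r ,
    lin 2 (λ y r → y ⊟ r ≼ # 2 ⇒ goal (y ≼ r ⊞ # 2)) y (toothRow j) s

  index-bound : ∀ (j : Fin l) → + toℕ j ≤ ℓ - 1ℤ
  index-bound j = lin 2 (λ j l → j ≺ l ⇒ goal (j ≼ l ⊟ # 1)) (+ toℕ j) ℓ
    (subst (+ toℕ j <_) (sym ℓ≡) (ℤ.+<+ (Fin.toℕ<n j)))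

  toothed-inner : ∀ {S t} → Toothed l S t → InnerZone t
  toothed-inner {t = t} h with toothed-cases h
  ... | inj₁ (spine {y} p q) = (ℤ.≤-refl , ℤ.+≤+ z≤n) , p ,
    lin 2 (λ y l → y ≼ 6 ⊠ l ⊟ # 2 ⇒ goal (y ≼ 6 ⊠ l)) y ℓ q
  toothed-inner {t = x , y} h | inj₂ (j , _ , h′) with toothAt-bounds {j} h′
  ... | (p , q) , r , s = (ℤ.≤-trans (ℤ.+≤+ z≤n) p , q) ,
    lin 2 (λ y j → 6 ⊠ j ⊞ # 4 ⊟ # 2 ≼ y ⇒ # 0 ≼ j ⇒ goal (# 1 ≼ y)) y (+ toℕ j) r (ℤ.+≤+ z≤n) ,
    lin 3 (λ y j l → y ≼ 6 ⊠ j ⊞ # 4 ⊞ # 2 ⇒ j ≼ l ⊟ # 1 ⇒ goal (y ≼ 6 ⊠ l)) y (+ toℕ j) ℓ s (index-bound j)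

  spine-not-toothAt : ∀ {j t} → Spine t → ¬ ToothAt j t
  spine-not-toothAt {j} (spine {y} _ _) h with () ← ℤ.drop‿+≤+ (proj₁ (proj₁ (toothAt-bounds {j} {0ℤ} {y} h)))

  -- Tooth rows are 6 apart, which exceeds `2 + 3`: a tooth extends over 2 rows on either side of
  -- its centre, the ring around it over 3.
  toothRow-near : ∀ i j y → Within (+ 2) (y - toothRow i) → Within (+ 3) (y - toothRow j) → i ≡ j
  toothRow-near i j y (p , q) (p′ , q′) with ℤ.<-cmp (+ toℕ i) (+ toℕ j)
  ... | tri≈ _ eq _ = Fin.toℕ-injective (ℤ.+-injective eq)
  ... | tri< lt _ _ = ⊥-elim
      (lin 3 (λ y i j → y ⊟ (6 ⊠ i ⊞ # 4) ≼ # 2 ⇒ ⊟ # 3 ≼ y ⊟ (6 ⊠ j ⊞ # 4) ⇒ i ≺ j ⇒ goal false)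
    y (+ toℕ i) (+ toℕ j) q p′ lt)
  ... | tri> _ _ gt = ⊥-elim
      (lin 3 (λ y i j → ⊟ # 2 ≼ y ⊟ (6 ⊠ i ⊞ # 4) ⇒ y ⊟ (6 ⊠ j ⊞ # 4) ≼ # 3 ⇒ j ≺ i ⇒ goal false)
    y (+ toℕ i) (+ toℕ j) p q′ gt)

  toothAt-unique : ∀ {i j t} → ToothAt i t → ToothAt j t → i ≡ j
  toothAt-unique {i} {j} {x , y} h h′ with tooth-bounds h | tooth-bounds h′
  ... | _ , w | _ , (p , q) = toothRow-near i j y w
      (ℤ.≤-trans (ℤ.-≤- (s≤s z≤n)) p , ℤ.≤-trans q (ℤ.+≤+ (s≤s (s≤s z≤n))))

  toothCentre-toothAt : ∀ j → ToothAt j (toothCentre j)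
  toothCentre-toothAt j = inj₁ (refl , subst (λ y → ℤ.∣ y ∣ ℕ.≤ 2) (sym (ℤ.+-inverseʳ (toothRow j))) z≤n)

  toothCentre∈ : ∀ {S j} → Toothed l S (toothCentre j) → j ∈ˢ S
  toothCentre∈ {S} {j} h with toothed-cases h
  ... | inj₂ (i , i∈ , h′) = subst (_∈ˢ S)
      (toothAt-unique {i} {j} {toothCentre j} h′ (toothCentre-toothAt j)) i∈

  Topless : Subset l → Set
  Topless S = ∀ {j} → j ∈ˢ S → + toℕ j ≤ ℓ - + 2

  -- The last tooth allowed is centred at row `6ℓ - 8` and ends at row `6ℓ - 6`, short of the end of
  -- the rectangle at row `6ℓ - 2`.
  toothed-tip : ∀ {S t} → Topless S → Toothed l S t → + 6 * ℓ - + 2 ≤ proj₂ t → t ≡ deep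
  toothed-tip topless h le with toothed-cases h
  ... | inj₁ (spine {y} p q) = cong (0ℤ ,_) (ℤ.≤-antisym q le)
  toothed-tip {t = x , y} topless h le | inj₂ (j , j∈ , h′) = ⊥-elim
    (lin 3 (λ y j l → y ≼ 6 ⊠ j ⊞ # 4 ⊞ # 2 ⇒ j ≼ l ⊟ # 2 ⇒ 6 ⊠ l ⊟ # 2 ≼ y ⇒ goal false) y (+ toℕ j) ℓ
      (proj₂ (proj₂ (toothAt-bounds {j} {x} h′))) (topless j∈) le)

  walls-solid : ∀ {S} → Topless S → All (λ w → Zone (deep ⊕ w) × ¬ Toothed l S (deep ⊕ w)) walls
  walls-solid topless =
    (((ℤ.≤-refl , ℤ.-≤+) , lower 0ℤ ℤ.-≤+ , upper 0ℤ (ℤ.+≤+ z≤n)) , side) ∷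
    (((ℤ.-≤+ , ℤ.+≤+ (s≤s z≤n)) , lower 0ℤ ℤ.-≤+ , upper 0ℤ (ℤ.+≤+ z≤n)) , beside topless) ∷
    (((ℤ.-≤+ , ℤ.+≤+ z≤n) , lower 1ℤ ℤ.-≤+ , upper 1ℤ (ℤ.+≤+ (s≤s z≤n))) , below topless) ∷
    (((ℤ.≤-refl , ℤ.-≤+) , lower -[1+ 1 ] (ℤ.-≤- (s≤s z≤n)) , upper -[1+ 1 ] ℤ.-≤+) , side) ∷ []
    where
    lower : ∀ a → -[1+ 2 ] ≤ a → 1ℤ ≤ + 6 * ℓ - + 2 + a
    lower a p = lin 2 (λ a l → ⊟ # 3 ≼ a ⇒ # 1 ≼ l ⇒ goal (# 1 ≼ 6 ⊠ l ⊟ # 2 ⊞ a)) a ℓ p 1≤l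
    upper : ∀ a → a ≤ 1ℤ → + 6 * ℓ - + 2 + a ≤ + 6 * ℓ + 1ℤ
    upper a p = lin 2 (λ a l → a ≼ # 1 ⇒ goal (6 ⊠ l ⊟ # 2 ⊞ a ≼ 6 ⊠ l ⊞ # 1)) a ℓ p
    side : ∀ {S y} → ¬ Toothed l S (-1ℤ , y)
    side h with () ← proj₁ (proj₁ (toothed-inner h))
    beside : ∀ {S} → Topless S → ¬ Toothed l S (1ℤ , + 6 * ℓ - + 2 + 0ℤ)
    beside topless h with toothed-tip topless h (ℤ.≤-reflexive (sym (ℤ.+-identityʳ _)))
    ... | ()
    below : ∀ {S} → Topless S → ¬ Toothed l S (0ℤ , + 6 * ℓ - + 2 + 1ℤ)
    below topless h with toothed-tip topless h
        (ℤ.≤-trans (ℤ.≤-reflexive (sym (ℤ.+-identityʳ _))) (ℤ.+-monoʳ-≤ (+ 6 * ℓ - + 2) (ℤ.+≤+ z≤n)))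
    ... | eq = lin 1 (λ l → 6 ⊠ l ⊟ # 2 ⊞ # 1 ≗ 6 ⊠ l ⊟ # 2 ⇒ goal false) ℓ (cong proj₂ eq)

  -- The one ring cell that a lock can contain is the cell of the rectangle to which the tooth is
  -- attached. The ring avoids the tooth itself, and its rows are too far from the other teeth.
  ring-solid : ∀ j {w} → w ∈ ring →
    Zone (toothCentre j ⊕ w) × ∀ {S} → Toothed l S (toothCentre j ⊕ w) → Spine (toothCentre j ⊕ w)
  ring-solid j {x , y} w∈ with All.lookup ring-outside w∈
  ... | ¬tooth , (bx , by) = zone , λ h → on-spine (toothed-cases h)
    where
    wx : Within (+ 3) x
    wx = within bx
    wy : Within (+ 3) y
    wy = within by
    zone : Zone (toothCentre j ⊕ (x , y))
    zone =
      (lin 1 (λ x → ⊟ # 3 ≼ x ⇒ goal (⊟ # 1 ≼ # 3 ⊞ x)) x (proj₁ wx) ,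
       lin 1 (λ x → x ≼ # 3 ⇒ goal (# 3 ⊞ x ≼ # 6)) x (proj₂ wx)) ,
      lin 2 (λ y j → ⊟ # 3 ≼ y ⇒ # 0 ≼ j ⇒ goal (# 1 ≼ 6 ⊠ j ⊞ # 4 ⊞ y)) y (+ toℕ j) (proj₁ wy) (ℤ.+≤+ z≤n) ,
      lin 3 (λ y j l → y ≼ # 3 ⇒ j ≼ l ⊟ # 1 ⇒ goal (6 ⊠ j ⊞ # 4 ⊞ y ≼ 6 ⊠ l ⊞ # 1)) y (+ toℕ j) ℓ
          (proj₂ wy) (index-bound j)
    on-spine : ∀ {S} → Spine (toothCentre j ⊕ (x , y)) ⊎ (∃[ i ] i ∈ˢ S × ToothAt i (toothCentre j ⊕ (x , y))) →
      Spine (toothCentre j ⊕ (x , y))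
    on-spine (inj₁ s) = s
    on-spine (inj₂ (i , _ , h)) = ⊥-elim
        (¬tooth (subst Tooth (offset-toothCentre j (x , y))
        (subst (λ i → ToothAt i (toothCentre j ⊕ (x , y))) i≡j h)))
      where
      i≡j : i ≡ j
      i≡j = toothRow-near i j (toothRow j + y) (proj₂ (tooth-bounds h))
        (subst (Within (+ 3)) (sym (cong proj₂ (offset-toothCentre j (x , y)))) wy)

-- Labeled tiles

quarterTurn-⊕ : ∀ a b → quarterTurn (a ⊕ b) ≡ quarterTurn a ⊕ quarterTurn b
quarterTurn-⊕ (x , y) (x′ , y′) = cell-≡ (ℤ.neg-distrib-+ y y′) refl

quarterTurn-⊛ : ∀ k a → quarterTurn (k ⊛ a) ≡ k ⊛ quarterTurn a
quarterTurn-⊛ k (x , y) = cell-≡ (ℤ.neg-distribʳ-* k y) refl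

quarterTurn-vec : ∀ d → quarterTurn (vec d) ≡ vec (turn d)
quarterTurn-vec east  = refl
quarterTurn-vec north = refl
quarterTurn-vec west  = refl
quarterTurn-vec south = refl

quarterTurn-injective : ∀ {a b} → quarterTurn a ≡ quarterTurn b → a ≡ b
quarterTurn-injective eq = cell-≡ (cong proj₂ eq) (ℤ.neg-injective (cong proj₁ eq))

turn-injective : ∀ {d d′} → turn d ≡ turn d′ → d ≡ d′
turn-injective {d} {d′} eq = trans (sym (opposite-involutive d))
  (trans (cong (λ d → turn (turn (turn d))) eq) (opposite-involutive d′))

fold-turns : ∀ k {a b} → fold a quarterTurn k ≡ fold b quarterTurn k → a ≡ b
fold-turns zero    eq = eq
fold-turns (suc k) eq = fold-turns k (quarterTurn-injective eq)

rotate-⊕ : ∀ r a b → rotate r (a ⊕ b) ≡ rotate r a ⊕ rotate r b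
rotate-⊕ r a b = go (toℕ r)
  where
  go : ∀ k → fold (a ⊕ b) quarterTurn k ≡ fold a quarterTurn k ⊕ fold b quarterTurn k
  go zero    = refl
  go (suc k) = trans (cong quarterTurn (go k)) (quarterTurn-⊕ (fold a quarterTurn k) (fold b quarterTurn k))

rotate-⊛ : ∀ r k a → rotate r (k ⊛ a) ≡ k ⊛ rotate r a
rotate-⊛ r k a = go (toℕ r)
  where
  go : ∀ j → fold (k ⊛ a) quarterTurn j ≡ k ⊛ fold a quarterTurn j
  go zero    = refl
  go (suc j) = trans (cong quarterTurn (go j)) (quarterTurn-⊛ k (fold a quarterTurn j))

rotate-vec : ∀ r d → rotate r (vec d) ≡ vec (rotateDir r d)
rotate-vec r d = go (toℕ r)
  where
  go : ∀ j → fold (vec d) quarterTurn j ≡ vec (fold d turn j)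
  go zero    = refl
  go (suc j) = trans (cong quarterTurn (go j)) (quarterTurn-vec (fold d turn j))

rotateDir-turn : ∀ r d → rotateDir r (turn d) ≡ turn (rotateDir r d)
rotateDir-turn r d = go (toℕ r)
  where
  go : ∀ j → fold (turn d) turn j ≡ turn (fold d turn j)
  go zero    = refl
  go (suc j) = cong turn (go j)

rotateDir-opposite : ∀ r d → rotateDir r (opposite d) ≡ opposite (rotateDir r d)
rotateDir-opposite r d = trans (rotateDir-turn r (turn d)) (cong turn (rotateDir-turn r d))

rotate-injective : ∀ r {a b} → rotate r a ≡ rotate r b → a ≡ b
rotate-injective r = fold-turns (toℕ r)

rotate-surjective : ∀ r c → ∃[ c′ ] rotate r c′ ≡ c
rotate-surjective zero c = c , refl
rotate-surjective (suc zero) (x , y) = (y , - x) , cell-≡ (ℤ.neg-involutive x) refl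
rotate-surjective (suc (suc zero)) (x , y) = (- x , - y) , cell-≡ (ℤ.neg-involutive x) (ℤ.neg-involutive y)
rotate-surjective (suc (suc (suc zero))) (x , y) =
  (- y , x) , cell-≡ (ℤ.neg-involutive x) (ℤ.neg-involutive y)

rotateDir-surjective : ∀ r D → ∃[ d ] rotateDir r d ≡ D
rotateDir-surjective zero                   D = D , refl
rotateDir-surjective (suc zero)             D = turn (opposite D) , opposite-involutive D
rotateDir-surjective (suc (suc zero))       D = opposite D , opposite-involutive D
rotateDir-surjective (suc (suc (suc zero))) D = turn D , opposite-involutive D

_≟ᵈ_ : ∀ (D D′ : Dir) → Dec (D ≡ D′)
D ≟ᵈ D′ with relative D D′
... | same   = yes refl
... | left   = no (turn≢ D)
  where
  turn≢ : ∀ D → ¬ D ≡ turn D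
  turn≢ east  ()
  turn≢ north ()
  turn≢ west  ()
  turn≢ south ()
... | behind = no (opposite≢ D)
  where
  opposite≢ : ∀ D → ¬ D ≡ opposite D
  opposite≢ east  ()
  opposite≢ north ()
  opposite≢ west  ()
  opposite≢ south ()
... | right  = no (right≢ D)
  where
  right≢ : ∀ D → ¬ D ≡ turn (opposite D)
  right≢ east  ()
  right≢ north ()
  right≢ west  ()
  right≢ south ()

rotation-unique : ∀ d {r r′} → rotateDir r d ≡ rotateDir r′ d → r ≡ r′
rotation-unique d {r} {r′} = by d r r′
  where
  by : ∀ d r r′ → rotateDir r d ≡ rotateDir r′ d → r ≡ r′
  by east  = from-yes (Fin.all? λ r → Fin.all? λ r′ →
      (rotateDir r east ≟ᵈ rotateDir r′ east) →-dec (r Fin.≟ r′))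
  by north = from-yes (Fin.all? λ r → Fin.all? λ r′ →
      (rotateDir r north ≟ᵈ rotateDir r′ north) →-dec (r Fin.≟ r′))
  by west  = from-yes (Fin.all? λ r → Fin.all? λ r′ →
      (rotateDir r west ≟ᵈ rotateDir r′ west) →-dec (r Fin.≟ r′))
  by south = from-yes (Fin.all? λ r → Fin.all? λ r′ →
      (rotateDir r south ≟ᵈ rotateDir r′ south) →-dec (r Fin.≟ r′))

vec-opposite : ∀ D → vec (opposite D) ≡ ⊖ vec D
vec-opposite east  = refl
vec-opposite north = refl
vec-opposite west  = refl
vec-opposite south = refl

otherSide-involutive : ∀ s → otherSide (otherSide s) ≡ s
otherSide-involutive (c , d) = cong₂ _,_
  (trans (cong ((c ⊕ vec d) ⊕_) (vec-opposite d)) (cancelʳ c (vec d))) (opposite-involutive d)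

⊕-swap : ∀ a b c → (a ⊕ b) ⊕ c ≡ (a ⊕ c) ⊕ b
⊕-swap a b c = trans (⊕-assoc a b c) (trans (cong (a ⊕_) (⊕-comm b c)) (sym (⊕-assoc a c b)))

moveSide-otherSide : ∀ {I} (p : Placement I) s → moveSide p (otherSide s) ≡ otherSide (moveSide p s)
moveSide-otherSide p (c , d) = cong₂ _,_
  (trans (cong (_⊕ shift p) (trans (rotate-⊕ (rot p) c (vec d))
      (cong (rotate (rot p) c ⊕_) (rotate-vec (rot p) d))))
         (⊕-swap (rotate (rot p) c) (vec (rotateDir (rot p) d)) (shift p)))
  (rotateDir-opposite (rot p) d)

⊛-⊕ : ∀ k a b → k ⊛ (a ⊕ b) ≡ k ⊛ a ⊕ k ⊛ b
⊛-⊕ k (x , y) (x′ , y′) = cell-≡ (ℤ.*-distribˡ-+ k x x′) (ℤ.*-distribˡ-+ k y y′)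

⊕-cancelˡ : ∀ a b c → a ⊕ b ≡ a ⊕ c → b ≡ c
⊕-cancelˡ a b c eq = ⊕-cancelʳ a b c (trans (⊕-comm b a) (trans eq (⊕-comm a c)))

open DecMembership _≟ᶜ_ using () renaming (_∈?_ to _∈ᶜ?_)

-- Keys and locks whose uppermost places for a tooth are not used, so that the
-- tips of the keys and the innermost cells of the locks all look the same.
record Labels {n} (P : Fin n → Polyomino) (scaling : Scale) : Set where
  open Scale scaling
  open Dented scaling
  field
    enough        : 6 ℕ.* l ℕ.+ 6 ℕ.< m
    key           : Edge P → Fin l
    lock          : Edge P → Subset l
    key-injective : ∀ {e e′} → key e ≡ key e′ → e ≡ e′
    key-topless   : ∀ e → Topless ⁅ key e ⁆
    lock-topless  : ∀ e → Topless (lock e)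

module KLTiles {n} (P : Fin n → Polyomino) (scaling : Scale) (labels : Labels P scaling) where

  open Scale scaling
  open Scaled scaling
  open Dented scaling
  open Labels labels

  labeling : KLLabeling P
  labeling = record { len = l ; halfScale = m ; large = enough ; key = key ; lock = lock }

  Piece : Set
  Piece = Placement (Fin n)

  record Occupies (p : Piece) (g : Cell) : Set where
    constructor occupying
    field covering : covered (λ i c → c ∈ cells (P i)) p g

  record HasSide (p : Piece) (e : Edge P) (s : Side) : Set where
    constructor has-side
    field
      of-tile : proj₁ e ≡ tile p
      at-side : moveSide p (edgeSide {P = P} e) ≡ s

  side-inside : ∀ {p e g D} → HasSide p e (g , D) → Occupies p g
  side-inside {e = i , record { cell = c ; inside = c∈ }} (has-side refl refl) =
    occupying (c , recompute (c ∈ᶜ? cells (P i)) c∈ , refl)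

  side-outside : ∀ {p e g D} → HasSide p e (g , D) → ¬ Occupies p (g ⊕ vec D)
  side-outside {p} {i , record { cell = c ; dir = d ; outside = c∉ }} (has-side refl refl)
      (occupying (c′ , c′∈ , eq)) =
    ⊥-elim-irr (c∉ (subst (_∈ cells (P i)) c≡ c′∈))
    where
    c≡ : c′ ≡ c ⊕ vec d
    c≡ = rotate-injective (rot p) (⊕-cancelʳ (shift p) (rotate (rot p) c′) (rotate (rot p) (c ⊕ vec d))
      (trans eq (sym (cong proj₁ (moveSide-otherSide p (c , d))))))

  side-here : ∀ {p g} D → Occupies p g → ¬ Occupies p (g ⊕ vec D) → ∃[ e ] HasSide p e (g , D)
  side-here {p} D (occupying (c , c∈ , refl)) ¬occ with rotateDir-surjective (rot p) D
  ... | d , refl = (tile p , record { cell = c ; dir = d ; inside = c∈ ; outside = λ c′∈ → ¬occ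
    (occupying (c ⊕ vec d , c′∈ , cong proj₁ (moveSide-otherSide p (c , d)))) }) , has-side refl refl

  occupies? : ∀ p g → Dec (Occupies p g)
  occupies? p g with rotate-surjective (rot p) (g ⊕ ⊖ shift p)
  ... | c , eq = map′ (λ c∈ → occupying (c , c∈ , trans (cong (_⊕ shift p) eq) (cancelʳ′ g (shift p))))
    (λ { (occupying (c′ , c′∈ , eq′)) → subst (_∈ cells (P (tile p)))
      (rotate-injective (rot p) (trans
          (trans (sym (cancelʳ _ (shift p))) (cong (_⊕ (⊖ shift p)) eq′)) (sym eq))) c′∈ })
    (c ∈ᶜ? cells (P (tile p)))

  side-unique : ∀ {p q e s} → HasSide p e s → HasSide q e s → p ≡ q
  side-unique {place i r v} {place .i r′ v′} {_ , e} (has-side refl eq) (has-side refl eq′)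
    with rotation-unique (EdgeOf.dir e) {r} {r′} (trans (cong proj₂ eq) (sym (cong proj₂ eq′)))
  ... | refl = cong (place i r)
      (⊕-cancelˡ (rotate r (EdgeOf.cell e)) v v′ (trans (cong proj₁ eq) (sym (cong proj₁ eq′))))

  -- The position o of the block at the cell g is covered by the labeled tile that
  -- is scaled up from p.
  data Covers (p : Piece) (g o : Cell) : Set where
    body : Occupies p g →
           (∀ {e D t} → HasSide p e (g , D) → Toothed l (lock e) t → ¬ o ≡ dent D t) → Covers p g o
    bump : ∀ {e D t} → HasSide p e (otherSide (g , D)) → Toothed l ⁅ key e ⁆ t → o ≡ dent D t → Covers p g o

  -- The base `O` is a parameter because the labeled tiles of a tiling are not known in advance to
  -- share one grid.
  scale : Cell → Piece → Placement (Maybe (Fin n))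
  scale O p = place (just (tile p)) (rot p) (O ⊕ σ ⊛ shift p)

  Covered : Placement (Maybe (Fin n)) → Cell → Set
  Covered = covered (klShape P labeling)

  in-block-rotate : ∀ r {o} → InBlock o → InBlock (rotate r o)
  in-block-rotate r {o} ino = go (toℕ r)
    where
    go : ∀ k → InBlock (fold o quarterTurn k)
    go zero    = ino
    go (suc k) = within-neg (proj₂ (go k)) , proj₁ (go k)

  in-block-rotate⁻ : ∀ r {o} → InBlock (rotate r o) → InBlock o
  in-block-rotate⁻ r {o} = go (toℕ r)
    where
    go : ∀ k → InBlock (fold o quarterTurn k) → InBlock o
    go zero    ino = ino
    go (suc k) (p , q) = go k (q , within-neg⁻ p)

  move-body : ∀ O p c o → move (scale O p) (σ ⊛ c ⊕ o) ≡ (O ⊕ σ ⊛ move p c) ⊕ rotate (rot p) o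
  move-body O p c o = trans (cong (_⊕ (O ⊕ σ ⊛ shift p)) (trans (rotate-⊕ (rot p) (σ ⊛ c) o)
      (cong (_⊕ rotate (rot p) o) (rotate-⊛ (rot p) σ c))))
    (trans (rearrange (σ ⊛ rotate (rot p) c) (rotate (rot p) o) O (σ ⊛ shift p))
      (cong (λ w → (O ⊕ w) ⊕ rotate (rot p) o) (sym (⊛-⊕ σ (rotate (rot p) c) (shift p)))))
    where
    one : ∀ a b c d → a + b + (c + d) ≡ c + (a + d) + b
    one = lin 4 (λ a b c d → goal (a ⊞ b ⊞ (c ⊞ d) ≗ c ⊞ (a ⊞ d) ⊞ b))
    rearrange : ∀ a b c d → (a ⊕ b) ⊕ (c ⊕ d) ≡ (c ⊕ (a ⊕ d)) ⊕ b
    rearrange (a , a′) (b , b′) (c , c′) (d , d′) = cell-≡ (one a b c d) (one a′ b′ c′ d′)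

  -- A row `y` of a lock lies `M + y` from the centre of the neighbouring block, hence
  -- `σ - (M + y) = M + 1 - y` from the centre of its own block. This ties `dent` to the `frame` in
  -- which keys and locks are defined.
  frame-dent : ∀ s t → frame m (otherSide s) t ≡ σ ⊛ proj₁ s ⊕ dent (proj₂ s) t
  frame-dent (c , d) (x , y) = trans (cong₂ (λ s k → s ⊛ (c ⊕ vec d) ⊕ (k + y) ⊛ vec (opposite d) ⊕
      (1ℤ + x) ⊛ vec (turn (opposite d))) (sym σ≡) (sym M≡)) (begin
    σ ⊛ (c ⊕ vec d) ⊕ (M + y) ⊛ vec (opposite d) ⊕ (1ℤ + x) ⊛ vec (turn (opposite d))
      ≡⟨ cong₂ _⊕_ (cong₂ _⊕_ (trans (⊛-⊕ σ c (vec d)) (cong (σ ⊛ c ⊕_) (⊛-vec σ d)))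
           (trans (⊛-vec (M + y) (opposite d)) (loc-opposite d (M + y) 0ℤ)))
           (trans (⊛-vec (1ℤ + x) (turn (opposite d)))
               (trans (loc-turn (opposite d) (1ℤ + x) 0ℤ) (loc-opposite d (- 0ℤ) (1ℤ + x)))) ⟩
    ((σ ⊛ c ⊕ loc d σ 0ℤ) ⊕ loc d (- (M + y)) (- 0ℤ)) ⊕ loc d (- - 0ℤ) (- (1ℤ + x))
      ≡⟨ trans (cong (_⊕ loc d (- - 0ℤ) (- (1ℤ + x))) (⊕-assoc (σ ⊛ c) (loc d σ 0ℤ) (loc d (- (M + y)) (- 0ℤ))))
           (⊕-assoc (σ ⊛ c) (loc d σ 0ℤ ⊕ loc d (- (M + y)) (- 0ℤ)) (loc d (- - 0ℤ) (- (1ℤ + x)))) ⟩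
    σ ⊛ c ⊕ ((loc d σ 0ℤ ⊕ loc d (- (M + y)) (- 0ℤ)) ⊕ loc d (- - 0ℤ) (- (1ℤ + x)))
      ≡⟨ cong (σ ⊛ c ⊕_) (trans (cong (_⊕ loc d (- - 0ℤ) (- (1ℤ + x))) (loc-⊕ d σ 0ℤ (- (M + y)) (- 0ℤ)))
           (loc-⊕ d (σ + - (M + y)) (0ℤ + - 0ℤ) (- - 0ℤ) (- (1ℤ + x)))) ⟩
    σ ⊛ c ⊕ loc d (σ + - (M + y) + - - 0ℤ) (0ℤ + - 0ℤ + - (1ℤ + x))
      ≡⟨ cong₂ (λ a b → σ ⊛ c ⊕ loc d a b)
           (lin 3 (λ s m y → s ≗ # 1 ⊞ 2 ⊠ m ⇒ goal (s ⊞ ⊟ (m ⊞ y) ⊞ ⊟ ⊟ # 0 ≗ m ⊞ # 1 ⊟ y)) σ M y σ-value)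
           (lin 1 (λ x → goal (# 0 ⊞ ⊟ # 0 ⊞ ⊟ (# 1 ⊞ x) ≗ ⊟ (# 1 ⊞ x))) x) ⟩
    σ ⊛ c ⊕ dent d (x , y) ∎)
    where open ≡-Reasoning

  rotate-dent : ∀ r D t → rotate r (dent D t) ≡ dent (rotateDir r D) t
  rotate-dent r D (x , y) = go (toℕ r)
    where
    quarter : ∀ D a b → quarterTurn (loc D a b) ≡ loc (turn D) a b
    quarter east  a b = refl
    quarter north a b = refl
    quarter west  a b = cell-≡ (ℤ.neg-involutive b) refl
    quarter south a b = cell-≡ (ℤ.neg-involutive a) refl
    go : ∀ k → fold (dent D (x , y)) quarterTurn k ≡ dent (fold D turn k) (x , y)
    go zero    = refl
    go (suc k) = trans (cong quarterTurn (go k)) (quarter (fold D turn k) (M + 1ℤ - y) (- (1ℤ + x)))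

  move-dent : ∀ O p s t → move (scale O p) (frame m (otherSide s) t) ≡
              (O ⊕ σ ⊛ proj₁ (moveSide p s)) ⊕ dent (proj₂ (moveSide p s)) t
  move-dent O p (c , d) t = trans (cong (move (scale O p)) (frame-dent (c , d) t))
    (trans (move-body O p c (dent d t)) (cong ((O ⊕ σ ⊛ move p c) ⊕_) (rotate-dent (rot p) d t)))

  move-bump : ∀ O p s t → move (scale O p) (frame m s t) ≡
    (O ⊕ σ ⊛ proj₁ (otherSide (moveSide p s))) ⊕ dent (proj₂ (otherSide (moveSide p s))) t
  move-bump O p s t = trans (cong (λ s → move (scale O p) (frame m s t)) (sym (otherSide-involutive s)))
    (trans (move-dent O p (otherSide s) t)
      (cong (λ s → (O ⊕ σ ⊛ proj₁ s) ⊕ dent (proj₂ s) t) (moveSide-otherSide p s)))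

  based-unique : ∀ O {g g′ o o′} → InBlock o → InBlock o′ →
      (O ⊕ σ ⊛ g) ⊕ o ≡ (O ⊕ σ ⊛ g′) ⊕ o′ → g ≡ g′ × o ≡ o′
  based-unique O {g} {g′} {o} {o′} ino ino′ eq = block-unique ino ino′ (⊕-cancelˡ O (σ ⊛ g ⊕ o) (σ ⊛ g′ ⊕ o′)
    (trans (sym (⊕-assoc O (σ ⊛ g) o)) (trans eq (⊕-assoc O (σ ⊛ g′) o′))))

  covered⇒covers : ∀ O p g {o} → InBlock o → Covered (scale O p) ((O ⊕ σ ⊛ g) ⊕ o) → Covers p g o
  covered⇒covers O p g {o} ino (c₀ , inj₁ ((c , c∈ , a , b , a≤ , b≤ , c₀≡) , ¬dent) , eq)
    with based-unique O {move p c} {g} (in-block-rotate (rot p) inab) ino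
           (trans (sym (move-body O p c (a , b))) (trans (cong (move (scale O p)) (sym c₀≡σ)) eq))
    where
    inab : InBlock (a , b)
    inab = subst (λ k → Within k a × Within k b) (sym M≡) (within a≤ , within b≤)
    c₀≡σ : c₀ ≡ σ ⊛ c ⊕ (a , b)
    c₀≡σ = trans c₀≡ (cong (λ s → s ⊛ c ⊕ (a , b)) (sym σ≡))
  ... | refl , refl = body (occupying (c , c∈ , refl)) λ { {_ , e} {D} {t} (has-side refl side≡) toothed o≡ →
    ¬dent (e , t , toothed , fold-turns (toℕ (rot p)) (⊕-cancelʳ (O ⊕ σ ⊛ shift p) _ _
      (trans (move-dent O p (EdgeOf.side e) t) (trans (cong₂ (λ s o → (O ⊕ σ ⊛ proj₁ s) ⊕ o) side≡
        (trans (cong (λ s → dent (proj₂ s) t) side≡) (sym o≡))) (sym eq))))) }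
  covered⇒covers O p g {o} ino (c₀ , inj₂ (e , t , toothed , refl) , eq)
    with based-unique O (dent-in-block (proj₂ (otherSide (moveSide p (EdgeOf.side e))))
        (inner⇒zone (toothed-inner toothed))) ino
           (trans (sym (move-bump O p (EdgeOf.side e) t)) eq)
  ... | refl , refl = bump (has-side refl
      (sym (otherSide-involutive (moveSide p (EdgeOf.side e))))) toothed refl

  covers⇒covered : ∀ O {p g o} → InBlock o → Covers p g o → Covered (scale O p) ((O ⊕ σ ⊛ g) ⊕ o)
  covers⇒covered O {p} {_} {o} ino (body (occupying (c , c∈ , refl)) ¬dent) with rotate-surjective (rot p) o
  ... | (a , b) , refl = σ ⊛ c ⊕ (a , b) , inj₁ ((c , c∈ , a , b , within⁻ (proj₁ inab) , within⁻ (proj₂ inab) ,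
          cong (λ s → s ⊛ c ⊕ (a , b)) σ≡) , λ { (e , t , toothed , eq) →
      let g≡ , o≡ = hit e toothed eq in
      ¬dent {tile p , e} (has-side refl (cong₂ _,_ (sym g≡) refl)) toothed o≡ }) ,
      move-body O p c (a , b)
    where
    inab : Within (+ m) a × Within (+ m) b
    inab = subst (λ k → Within k a × Within k b) M≡ (in-block-rotate⁻ (rot p) ino)
    hit : ∀ e {S t} → Toothed l S t → frame m (otherSide (EdgeOf.side e)) t ≡ σ ⊛ c ⊕ (a , b) →
          move p c ≡ move p (EdgeOf.cell e) × rotate (rot p) (a , b) ≡ dent (rotateDir (rot p) (EdgeOf.dir e)) t
    hit e {t = t} toothed eq = based-unique O ino
      (dent-in-block (rotateDir (rot p) (EdgeOf.dir e)) (inner⇒zone (toothed-inner toothed)))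
      (trans (sym (move-body O p c (a , b)))
        (trans (cong (move (scale O p)) (sym eq)) (move-dent O p (EdgeOf.side e) t)))
  covers⇒covered O {p} {g} {o} ino (bump {_ , e} {D} {t} (has-side refl side≡) toothed refl) =
    frame m (EdgeOf.side e) t , inj₂ (e , t , toothed , refl) ,
    trans (move-bump O p (EdgeOf.side e) t)
      (cong (λ s → (O ⊕ σ ⊛ proj₁ s) ⊕ dent (proj₂ s) t)
          (trans (cong otherSide side≡) (otherSide-involutive (g , D))))

-- Regions of placed tiles

easternmost : ∀ {cs : List Cell} {c} → c ∈ cs → ∃[ c ] c ∈ cs × c ⊕ vec east ∉ cs
easternmost {cs} {c} c∈ = e , e∈ (argmax-sel proj₁ c cs) , λ e+∈ →
  lin 1 (λ x → x ⊞ # 1 ≼ x ⇒ goal false) (proj₁ e) (All.lookup (f[xs]≤f[argmax] {f = proj₁} c cs) e+∈)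
  where
  e : Cell
  e = argmax proj₁ c cs
  e∈ : e ≡ c ⊎ e ∈ cs → e ∈ cs
  e∈ (inj₁ eq) = subst (_∈ cs) (sym eq) c∈
  e∈ (inj₂ e∈) = e∈

module KLRegions {n} (P : Fin n → Polyomino) (scaling : Scale) (labels : Labels P scaling) where

  open Scale scaling
  open Scaled scaling
  open Dented scaling
  open Labels labels
  open KLTiles P scaling labels

  base : Cell → Cell → Cell
  base O g = O ⊕ σ ⊛ g

  bump-outside : ∀ {p e g} D → HasSide p e (otherSide (g , D)) → ¬ Occupies p g
  bump-outside {p} {g = g} D h occ =
    side-outside h (subst (Occupies p) (sym (cong proj₁ (otherSide-involutive (g , D)))) occ)

  solid-covered : ∀ O {p g o} → Occupies p g → Solid o → Covered (scale O p) (base O g ⊕ o)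
  solid-covered O occ solid = covers⇒covered O (proj₁ solid) (body occ
    λ { {D = D} h toothed refl → dent-not-solid D (toothed-inner toothed) solid })

  solid-occupied : ∀ O p g {o} → Solid o → Covered (scale O p) (base O g ⊕ o) → Occupies p g
  solid-occupied O p g solid cov with covered⇒covers O p g (proj₁ solid) cov
  ... | body occ _ = occ
  ... | bump {D = D} _ toothed refl = ⊥-elim (dent-not-solid D (toothed-inner toothed) solid)

  dent-covers : ∀ O p g D {t} → Zone t → Covered (scale O p) (base O g ⊕ dent D t) → Covers p g (dent D t)
  dent-covers O p g D zone = covered⇒covers O p g (dent-in-block D zone)

  dent-uncovered : ∀ O {p e g D t} → HasSide p e (g , D) → Toothed l (lock e) t →
    ¬ Covered (scale O p) (base O g ⊕ dent D t)
  dent-uncovered O {p} {g = g} {D} h toothed cov with dent-covers O p g D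
      (inner⇒zone (toothed-inner toothed)) cov
  ... | body _ ¬dent = ¬dent h toothed refl
  ... | bump {D = D′} h′ _ _ = bump-outside D′ h′ (side-inside h)

  key-covered : ∀ O {p e g} D {t} → HasSide p e (otherSide (g , D)) → Toothed l ⁅ key e ⁆ t →
    Covered (scale O p) (base O g ⊕ dent D t)
  key-covered O D h toothed =
    covers⇒covered O (dent-in-block D (inner⇒zone (toothed-inner toothed))) (bump h toothed refl)

  toothed-deep : ∀ {S} → Toothed l S deep
  toothed-deep = spine⇒toothed (spine (lin 1 (λ l → # 1 ≼ l ⇒ goal (# 1 ≼ 6 ⊠ l ⊟ # 2)) ℓ 1≤l) ℤ.≤-refl)

  translate-side : ∀ {p e c D} v → HasSide p e (c , D) → HasSide (translate v p) e (c ⊕ v , D)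
  translate-side {p} {_ , e} v (has-side refl refl) = has-side refl
    (cong (_, rotateDir (rot p) (EdgeOf.dir e)) (sym (⊕-assoc (rotate (rot p) (EdgeOf.cell e)) (shift p) v)))

  scale-translate : ∀ O v p → scale (base O v) p ≡ scale O (translate v p)
  scale-translate O v (place i r s) = cong (place (just i) r)
    (trans (⊕-assoc O (σ ⊛ v) (σ ⊛ s)) (cong (O ⊕_) (trans (⊕-comm (σ ⊛ v) (σ ⊛ s)) (sym (⊛-⊕ σ s v)))))

  ⊛-⊖ : ∀ k a → k ⊛ (⊖ a) ≡ ⊖ (k ⊛ a)
  ⊛-⊖ k (x , y) = cell-≡ (sym (ℤ.neg-distribʳ-* k x)) (sym (ℤ.neg-distribʳ-* k y))

  rebase : ∀ O O′ g g′ → base O g ≡ base O′ g′ → O′ ≡ base O (g ⊕ ⊖ g′)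
  rebase O O′ g g′ eq = trans (sym (cancelʳ O′ (σ ⊛ g′)))
    (trans (cong (_⊕ (⊖ (σ ⊛ g′))) (sym eq)) (trans (⊕-assoc O (σ ⊛ g) (⊖ (σ ⊛ g′)))
      (cong (O ⊕_) (trans (cong (σ ⊛ g ⊕_) (sym (⊛-⊖ σ g′))) (sym (⊛-⊕ σ g (⊖ g′)))))))

  locate : ∀ O c → ∃[ g ] ∃[ o ] c ≡ base O g ⊕ o × InBlock o
  locate O c with block-of (c ⊕ ⊖ O)
  ... | g , o , eq , ino = g , o , trans (sym (cancelʳ′ c O)) (trans (cong (_⊕ O) eq)
    (trans (⊕-comm (σ ⊛ g ⊕ o) O) (sym (⊕-assoc O (σ ⊛ g) o)))) , ino

  -- What reaches the dead end is a body or a key. By `near-deep` and `near-or-facing`, only a fully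
  -- inserted key does so without the tile covering a solid position of the block `g`. In that case
  -- the tile is rewritten as a piece on the grid of `O`.
  facing-or-overlapping : ∀ O g D O′ p′ → Covered (scale O′ p′) (base O g ⊕ dent D deep) →
    (∃[ p ] ∃[ e ] scale O′ p′ ≡ scale O p × HasSide p e (otherSide (g , D))) ⊎
    (∃[ o ] Solid o × Covered (scale O′ p′) (base O g ⊕ o))
  facing-or-overlapping O g D O′ p′ cov with locate O′ (base O g ⊕ dent D deep)
  ... | g′ , o′ , eq , ino with covered⇒covers O′ p′ g′ ino (subst (Covered (scale O′ p′)) eq cov)
  ...   | body occ _ with near-deep D {base O g} {base O′ g′} ino eq
  ...     | d , near , centre with overlapping {base O g} near centre
  ...       | o , o″ , solid , solid″ , eq′ =
    inj₂ (o , solid , subst (Covered (scale O′ p′)) (sym eq′) (solid-covered O′ occ solid″))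
  facing-or-overlapping O g D O′ p′ cov | g′ , _ , eq , ino | bump {e} {D′} {t} h toothed refl
    with near-or-facing {D} {D′} {base O g} {base O′ g′} (toothed-inner toothed)
        (toothed-tip (key-topless e) toothed) eq
  ... | inj₁ (centre , refl) = inj₁ (translate (g ⊕ ⊖ g′) p′ , e ,
          trans (cong (λ O → scale O p′) (rebase O O′ g g′ centre)) (scale-translate O (g ⊕ ⊖ g′) p′) ,
          subst (λ c → HasSide (translate (g ⊕ ⊖ g′) p′) e (c , opposite D)) moved
              (translate-side (g ⊕ ⊖ g′) h))
    where
    moved : (g′ ⊕ vec D) ⊕ (g ⊕ ⊖ g′) ≡ g ⊕ vec D
    moved = trans (⊕-swap g′ (vec D) (g ⊕ ⊖ g′))
        (cong (_⊕ vec D) (trans (⊕-comm g′ (g ⊕ ⊖ g′)) (cancelʳ′ g g′)))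
  ... | inj₂ (d , near , centre) with overlapping {base O g} near centre
  ...   | o , o″ , solid , solid″ , eq′ = inj₂ (o , solid , subst (Covered (scale O′ p′))
          (trans (cong (_⊕ o″) (sym next)) (sym eq′)) (solid-covered O′ (side-inside h) solid″))
    where
    next : base O′ g′ ⊕ σ ⊛ vec D′ ≡ base O′ (g′ ⊕ vec D′)
    next = trans (⊕-assoc O′ (σ ⊛ g′) (σ ⊛ vec D′)) (cong (O′ ⊕_) (sym (⊛-⊕ σ g′ (vec D′))))

  some-side : ∀ p → ∃[ e ] ∃[ g ] ∃[ D ] HasSide p e (g , D)
  some-side p with nonempty (P (tile p))
  ... | _ , c₀∈ with easternmost c₀∈
  ...   | c , c∈ , c+∉ = e , moveSide p (c , east) .proj₁ , moveSide p (c , east) .proj₂ , has-side refl refl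
    where
    e : Edge P
    e = tile p , record { cell = c ; dir = east ; inside = c∈ ; outside = c+∉ }

  key-toothed : ∀ e → Toothed l ⁅ key e ⁆ (toothCentre (key e))
  key-toothed e = toothAt⇒toothed {j = key e} {toothCentre (key e)} (x∈⁅x⁆ (key e))
      (toothCentre-toothAt (key e))

  key-unique : ∀ {e e′} → Toothed l ⁅ key e ⁆ (toothCentre (key e′)) → e′ ≡ e
  key-unique {e} {e′} toothed = key-injective (x∈⁅y⁆⇒x≡y (key e) (toothCentre∈ {j = key e′} toothed))

  -- No two edges have the same key, so a key tells which edge is where.
  region-unique : ∀ O p O′ p′ → Covered (scale O p) ≐ Covered (scale O′ p′) →
    scale O p ≡ scale O′ p′
  region-unique O p O′ p′ (p⊆p′ , p′⊆p) with some-side p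
  ... | e , g , D , h with subst (HasSide p e) (sym (otherSide-involutive (g , D))) h
  ...   | h° with facing-or-overlapping O (g ⊕ vec D) (opposite D) O′ p′
                    (p⊆p′ (key-covered O (opposite D) h° toothed-deep))
  ...     | inj₂ (o , solid , cov) = ⊥-elim (side-outside h (solid-occupied O p (g ⊕ vec D) solid (p′⊆p cov)))
  -- The tip only fixes the grid. The tooth of the key identifies the edge, and an edge on a given
  -- side determines the piece.
  ...     | inj₁ (q , e′ , q≡ , h′)
    with dent-covers O q (g ⊕ vec D) (opposite D) (inner⇒zone (toothed-inner (key-toothed e)))
           (subst (λ a → Covered a (base O (g ⊕ vec D) ⊕ dent (opposite D) (toothCentre (key e)))) q≡
             (p⊆p′ (key-covered O (opposite D) h° (key-toothed e))))
  ... | body occ _ = ⊥-elim (bump-outside (opposite D) h′ occ)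
  ... | bump {e″} {D″} {t} h″ toothed eq
    with dent-unique {opposite D} {D″} {toothCentre (key e)} {t}
           (inner⇒zone (toothed-inner (key-toothed e))) (inner⇒zone (toothed-inner toothed)) eq
  ... | refl , refl with key-unique toothed
  ...   | refl = trans (cong (scale O) (side-unique h° h″)) (sym q≡)

  tooth : Rotation → Cell → Placement (Maybe (Fin n))
  tooth = place nothing

  tooth-rotate : ∀ r {c} → Tooth c → Tooth (rotate r c)
  tooth-rotate r {c} t = go (toℕ r)
    where
    go : ∀ k → Tooth (fold c quarterTurn k)
    go zero    = t
    go (suc k) = tooth-loc north (go k)

  tooth-rotate⁻ : ∀ r {c} → Tooth (rotate r c) → Tooth c
  tooth-rotate⁻ r {c} = go (toℕ r)
    where
    go : ∀ k → Tooth (fold c quarterTurn k) → Tooth c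
    go zero    t = t
    go (suc k) t = go k (tooth-loc⁻ north t)

  tooth-covered : ∀ r z {o} → Tooth o → Covered (tooth r z) (z ⊕ o)
  tooth-covered r z {o} t with rotate-surjective r o
  ... | c , refl = c , tooth-rotate⁻ r t , ⊕-comm (rotate r c) z

  covered-tooth : ∀ r z {c} → Covered (tooth r z) c → ∃[ o ] Tooth o × c ≡ z ⊕ o
  covered-tooth r z (c₀ , t , refl) = rotate r c₀ , tooth-rotate r t , ⊕-comm (rotate r c₀) z

  -- A tooth is too small for two opposite solid cells.
  not-tooth : ∀ O p r z → ¬ Covered (scale O p) ≐ Covered (tooth r z)
  not-tooth O p r z (p⊆t , _) with some-side p
  ... | _ , g , _ , h with covered-tooth r z
      (p⊆t (solid-covered O (side-inside h)
      ((solid-coordinate-within solid-seven , within-zero) , inj₁ solid-seven)))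
                         | covered-tooth r z (p⊆t (solid-covered O (side-inside h)
                             ((within-neg (solid-coordinate-within solid-seven) , within-zero) , inj₁
                             (solid-coordinate-neg solid-seven))))
  ... | o , t , eq | o′ , t′ , eq′ = lin 4
      (λ b z x y → b ⊞ # 7 ≗ z ⊞ x ⇒ b ⊟ # 7 ≗ z ⊞ y ⇒ x ≼ # 2 ⇒ ⊟ # 2 ≼ y ⇒ goal false)
    (proj₁ (base O g)) (proj₁ z) (proj₁ o) (proj₁ o′) (cong proj₁ eq) (cong proj₁ eq′)
    (proj₂ (proj₁ (tooth-bounds t))) (proj₁ (proj₁ (tooth-bounds t′)))

  tooth-centre-unique : ∀ r z r′ z′ → Covered (tooth r z) ≐ Covered (tooth r′ z′) → z ≡ z′
  tooth-centre-unique r z r′ z′ (z⊆z′ , _) = cell-≡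
    (centred (proj₁ z) (proj₁ z′) (bounds (inj₂ (refl , s≤s (s≤s z≤n))) .proj₁)
        (bounds (inj₂ (refl , s≤s (s≤s z≤n))) .proj₁))
    (centred (proj₂ z) (proj₂ z′) (bounds (inj₁ (refl , s≤s (s≤s z≤n))) .proj₂)
        (bounds (inj₁ (refl , s≤s (s≤s z≤n))) .proj₂))
    where
    bounds : ∀ {a b} → Tooth (a , b) →
        Within (+ 2) (proj₁ z + a - proj₁ z′) × Within (+ 2) (proj₂ z + b - proj₂ z′)
    bounds {a} {b} t with covered-tooth r′ z′ (z⊆z′ (tooth-covered r z t))
    ... | o , t′ , eq = subst (Within (+ 2)) (shifted _ (proj₁ z′) _ (cong proj₁ eq))
        (proj₁ (tooth-bounds t′)) ,
                        subst (Within (+ 2)) (shifted _ (proj₂ z′) _ (cong proj₂ eq)) (proj₂ (tooth-bounds t′))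
      where
      shifted : ∀ a z o → a ≡ z + o → o ≡ a - z
      shifted = lin 3 (λ a z o → a ≗ z ⊞ o ⇒ goal (o ≗ a ⊟ z))
    centred : ∀ z z′ → Within (+ 2) (z + + 2 - z′) → Within (+ 2) (z + -[1+ 1 ] - z′) → z ≡ z′
    centred z z′ (_ , p) (q , _) = lin 2
        (λ z z′ → z ⊞ # 2 ⊟ z′ ≼ # 2 ⇒ ⊟ # 2 ≼ z ⊟ # 2 ⊟ z′ ⇒ goal (z ≗ z′)) z z′ p q

  tooth-same : ∀ r z r′ → Covered (tooth r z) ≐ Covered (tooth r′ z)
  tooth-same r z r′ = half r r′ , half r′ r
    where
    half : ∀ r r′ {c} → Covered (tooth r z) c → Covered (tooth r′ z) c
    half r r′ cov with covered-tooth r z cov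
    ... | o , t , refl = tooth-covered r′ z t

  scale-injective : ∀ O {p q} → scale O p ≡ scale O q → p ≡ q
  scale-injective O {place i r s} {place j r′ s′} eq = go (cong tile eq) (cong rot eq) (cong shift eq)
    where
    go : just i ≡ just j → r ≡ r′ → O ⊕ σ ⊛ s ≡ O ⊕ σ ⊛ s′ → place i r s ≡ place j r′ s′
    go refl refl eq = cong (place i r)
        (proj₁ (block-unique (within-zero , within-zero) (within-zero , within-zero)
        (cong (_⊕ origin) (⊕-cancelˡ O (σ ⊛ s) (σ ⊛ s′) eq))))

-- Tilings by labeled polyominoes and teeth

any-dir? : {Q : Dir → Set} → (∀ D → Dec (Q D)) → Dec (∃[ D ] Q D)
any-dir? Q? = map′ from to (Q? east ⊎-dec Q? north ⊎-dec Q? west ⊎-dec Q? south)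
  where
  from : _ → _
  from (inj₁ q)                      = east  , q
  from (inj₂ (inj₁ q))               = north , q
  from (inj₂ (inj₂ (inj₁ q)))        = west  , q
  from (inj₂ (inj₂ (inj₂ q)))        = south , q
  to : _ → _
  to (east  , q) = inj₁ q
  to (north , q) = inj₂ (inj₁ q)
  to (west  , q) = inj₂ (inj₂ (inj₁ q))
  to (south , q) = inj₂ (inj₂ (inj₂ q))

rotateDir-injective : ∀ r {d d′} → rotateDir r d ≡ rotateDir r d′ → d ≡ d′
rotateDir-injective zero                   eq = eq
rotateDir-injective (suc zero)             eq = turn-injective eq
rotateDir-injective (suc (suc zero))       eq = turn-injective (turn-injective eq)
rotateDir-injective (suc (suc (suc zero))) eq = turn-injective (turn-injective (turn-injective eq))

module KLSpots {n} (P : Fin n → Polyomino) (scaling : Scale) (labels : Labels P scaling) where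

  open Scale scaling
  open Scaled scaling
  open Dented scaling
  open Labels labels
  open KLTiles P scaling labels
  open KLRegions P scaling labels

  edge-unique : ∀ {p e e′ s} → HasSide p e s → HasSide p e′ s → e ≡ e′
  edge-unique {place i r v} {_ , record { cell = c ; dir = d }} {_ , record { cell = c′ ; dir = d′ }}
              (has-side refl eq) (has-side refl eq′)
    with rotateDir-injective r {d} {d′} (trans (cong proj₂ eq) (sym (cong proj₂ eq′)))
       | rotate-injective r {c} {c′}
           (⊕-cancelʳ v (rotate r c) (rotate r c′) (trans (cong proj₁ eq) (sym (cong proj₁ eq′))))
  ... | refl | refl = refl

  InDent : Piece → Cell → Cell → Set
  InDent p g o = ∃[ D ] ∃[ e ] ∃[ t ] HasSide p e (g , D) × Toothed l (lock e) t × o ≡ dent D t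

  in-dent? : ∀ p g o → Dec (InDent p g o)
  in-dent? p g o with occupies? p g
  ... | no ¬occ = no λ { (_ , _ , _ , h , _) → ¬occ (side-inside h) }
  ... | yes occ = any-dir? at-direction
    where
    at-direction : ∀ D → Dec (∃[ e ] ∃[ t ] HasSide p e (g , D) × Toothed l (lock e) t × o ≡ dent D t)
    at-direction D with occupies? p (g ⊕ vec D) | dent-surjective D o
    ... | yes occ′ | _ = no λ { (_ , _ , h , _) → side-outside h occ′ }
    ... | no ¬occ′ | t , o≡ with side-here D occ ¬occ′
    ...   | e , h = map′ (λ toothed → e , t , h , toothed , o≡)
      (λ { (e′ , t′ , h′ , toothed , o≡′) → subst₂ (λ e t → Toothed l (lock e) t)
        (edge-unique h′ h) (dent-injective D (trans (sym o≡′) o≡)) toothed })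
      (toothed? (lock e) t)

  body-covered : ∀ O {p g o} → InBlock o → Occupies p g → ¬ InDent p g o → Covered (scale O p) (base O g ⊕ o)
  body-covered O ino occ ¬dent = covers⇒covered O ino
    (body occ λ {e} {D} {t} h toothed o≡ → ¬dent (D , e , t , h , toothed , o≡))

  -- Zones of different sides are disjoint and a side of a piece carries only one edge, so no other
  -- dent can remove the position from the body.
  beside-dent-covered : ∀ O {p e g D t} → HasSide p e (g , D) → Zone t → ¬ Toothed l (lock e) t →
    Covered (scale O p) (base O g ⊕ dent D t)
  beside-dent-covered O {p} {e} {g} {D} {t} h zone ¬toothed =
    body-covered O (dent-in-block D zone) (side-inside h) λ { (D′ , e′ , t′ , h′ , toothed , eq) →
      not-in h′ toothed (dent-unique {D} {D′} {t} {t′} zone (inner⇒zone (toothed-inner toothed)) eq) }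
    where
    not-in : ∀ {D′ e′ t′} → HasSide p e′ (g , D′) → Toothed l (lock e′) t′ → ¬ (D ≡ D′ × t ≡ t′)
    not-in h′ toothed (refl , refl) with edge-unique h h′
    ... | refl = ¬toothed toothed

  dent-step : ∀ O g D t w → base O g ⊕ dent D (t ⊕ w) ≡ (base O g ⊕ dent D t) ⊕ flip D w
  dent-step O g D t w = trans (cong (base O g ⊕_) (dent-⊕ D t w))
      (sym (⊕-assoc (base O g) (dent D t) (flip D w)))

  -- Since the base is free, every placement of a labeled polyomino has the form `scale O p`, with
  -- its shift absorbed into `O`.
  data View : Placement (Maybe (Fin n)) → Set where
    labeled : ∀ O p → View (scale O p)
    lone    : ∀ r z → View (tooth r z)

  ⊛-origin : ∀ k → k ⊛ origin ≡ origin
  ⊛-origin k = cell-≡ (ℤ.*-zeroʳ k) (ℤ.*-zeroʳ k)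

  view : ∀ q → View q
  view (place nothing r z)  = lone r z
  view (place (just i) r s) = subst View
    (cong (place (just i) r) (trans (cong (s ⊕_) (⊛-origin σ)) (⊕-identityʳ s))) (labeled s (place i r origin))

  -- Coherence of a tiling by `KL` only compares regions. For labeled polyominoes this becomes an
  -- equality of placements, which later steps rewrite with; for teeth it does not, because of their
  -- rotations.
  labeled-unique : ∀ {q} O p → Covered q ≐ Covered (scale O p) → q ≡ scale O p
  labeled-unique {q} O p regions = by (view q) regions
    where
    by : ∀ {q} → View q → Covered q ≐ Covered (scale O p) → q ≡ scale O p
    by (labeled O′ p′) regions = region-unique O′ p′ O p regions
    by (lone r z) (⊆ , ⊇) = ⊥-elim (not-tooth O p r z (⊇ , ⊆))

  tooth-step : ∀ r z {D v w x} → x ≡ z ⊕ flip D v → Tooth (w ⊕ v) → Covered (tooth r z) (x ⊕ flip D w)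
  tooth-step r z {D} {v} {w} refl t = subst (Covered (tooth r z))
    (trans (cong (z ⊕_) (trans (flip-⊕ D w v) (⊕-comm (flip D w) (flip D v))))
        (sym (⊕-assoc z (flip D v) (flip D w))))
    (tooth-covered r z (tooth-flip D t))

  -- A solid position that stands for its block.
  anchor : Cell
  anchor = + 7 , 0ℤ

  anchor-solid : Solid anchor
  anchor-solid = (solid-coordinate-within solid-seven , within-zero) , inj₁ solid-seven

  spot : Cell → Cell → Cell
  spot O g = base O g ⊕ anchor

  spot-covered : ∀ O {p g} → Occupies p g → Covered (scale O p) (spot O g)
  spot-covered O occ = solid-covered O occ anchor-solid

  spot-occupied : ∀ O p g → Covered (scale O p) (spot O g) → Occupies p g
  spot-occupied O p g = solid-occupied O p g anchor-solid

module KLTiling {n} (P : Fin n → Polyomino) (scaling : Scale) (labels : Labels P scaling) {μ : Motions}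
  (T : Tiling μ (KL P (KLTiles.labeling P scaling labels))) where

  open Scale scaling
  open Scaled scaling
  open Dented scaling
  open Labels labels
  open KLTiles P scaling labels
  open KLRegions P scaling labels
  open KLSpots P scaling labels
  open Tiling T

  -- The labeled tiles of the tiling are scaled up from the pieces f g, with O
  -- as the centre of the block of the cell (0 , 0).
  record Charts (O : Cell) (f : Cell → Piece) : Set where
    constructor charting
    field spot-tile : ∀ g → at (spot O g) ≡ scale O (f g)

  open Charts public

  Charted : Cell → Cell → Set
  Charted O g = ∃[ p ] at (spot O g) ≡ scale O p

  opaque
    same-region : ∀ {c c′ x} → Covered (at c) x → Covered (at c′) x → Covered (at c) ≐ Covered (at c′)
    same-region {c} {c′} {x} cov cov′ with coherent {c} {x} cov | coherent {c′} {x} cov′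
    ... | (a , b) | (a′ , b′) = (λ y → a′ (b y)) , (λ y → a (b′ y))

    same-tile : ∀ {c x} O p → at c ≡ scale O p → Covered (scale O p) x → at x ≡ scale O p
    same-tile {c} {x} O p eq cov = labeled-unique O p
      (subst (λ q → Covered (at x) ≐ Covered q) eq (coherent {c} {x} (subst (λ q → Covered q x) (sym eq) cov)))

    both-labeled : ∀ {c c′ x} O p O′ p′ → at c ≡ scale O p → at c′ ≡ scale O′ p′ →
      Covered (scale O p) x → Covered (scale O′ p′) x → scale O p ≡ scale O′ p′
    both-labeled {c} {c′} O p O′ p′ eq eq′ cov cov′ =
      trans (sym (same-tile {c} O p eq cov)) (same-tile {c′} O′ p′ eq′ cov′)

    labeled-not-tooth : ∀ {c c′ x} O p r z → at c ≡ scale O p → at c′ ≡ tooth r z →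
      Covered (scale O p) x → ¬ Covered (tooth r z) x
    labeled-not-tooth {c} {c′} {x} O p r z eq eq′ cov cov′ = not-tooth O p r z
      (subst₂ (λ q q′ → Covered q ≐ Covered q′) eq eq′
        (same-region {c} {c′} {x} (subst (λ q → Covered q x) (sym eq) cov)
            (subst (λ q → Covered q x) (sym eq′) cov′)))

    -- If the lock lacks the index, the centre of the tooth of the key falls into the body of `p`.
    -- The two tiles then coincide, although one occupies `g` and the other does not.
    key-fits : ∀ {c c′} O p p′ {e e′ g D} → at c ≡ scale O p → at c′ ≡ scale O p′ →
      HasSide p e (g , D) → HasSide p′ e′ (otherSide (g , D)) → key e′ ∈ˢ lock e
    key-fits {c} {c′} O p p′ {e} {e′} {g} {D} eq eq′ h h′ with key e′ ∈? lock e
    ... | yes k∈ = k∈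
    ... | no k∉ = ⊥-elim (bump-outside D h′ (subst (λ p → Occupies p g) (scale-injective O
      (both-labeled {c} {c′} O p O p′ eq eq′
        (beside-dent-covered O h (inner⇒zone (toothed-inner (key-toothed e′)))
            (λ toothed → k∉ (toothCentre∈ {j = key e′} toothed)))
        (key-covered O D h′ (key-toothed e′)))) (side-inside h)))

    -- The dead end of the lock must be covered. A tooth there would hit a wall; a labeled polyomino
    -- that overlaps a solid position of `g` would be `p` itself, which leaves its own dead end
    -- empty. Only the inserted key remains.
    neighbour : ∀ {c} O p {e g D} → at c ≡ scale O p → HasSide p e (g , D) →
      ∃[ c′ ] ∃[ p′ ] ∃[ e′ ] at c′ ≡ scale O p′ × HasSide p′ e′ (otherSide (g , D))
    neighbour {c} O p {e} {g} {D} eq h = by (view (at x)) refl (covers x)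
      where
      x : Cell
      x = base O g ⊕ dent D deep

      by : ∀ {q} → View q → at x ≡ q → Covered (at x) x →
        ∃[ c′ ] ∃[ p′ ] ∃[ e′ ] at c′ ≡ scale O p′ × HasSide p′ e′ (otherSide (g , D))
      by (labeled O′ p′) eq′ cov with facing-or-overlapping O g D O′ p′ (subst (λ q → Covered q x) eq′ cov)
      ... | inj₁ (p″ , e′ , eq″ , h′) = x , p″ , e′ , trans eq′ eq″ , h′
      ... | inj₂ (o , solid , cov′) = ⊥-elim (dent-uncovered O h (toothed-deep {lock e})
        (subst (λ q → Covered q x)
            (trans eq′ (sym (both-labeled {c} {x} O p O′ p′ eq eq′
            (solid-covered O (side-inside h) solid) cov′))) cov))
      by (lone r z) eq′ cov with covered-tooth r z (subst (λ q → Covered q x) eq′ cov)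
      ... | o , t , x≡ with flip-surjective D o
      ...   | v , refl with find (meets-walls (tooth-flip⁻ D t))
      ...     | w , w∈ , t′ with All.lookup (walls-solid (lock-topless e)) w∈
      ...       | zone , ¬toothed = ⊥-elim (labeled-not-tooth {c} {x} O p r z eq eq′
        (subst (Covered (scale O p)) (dent-step O g D deep w) (beside-dent-covered O h zone ¬toothed))
        (tooth-step r z {D} {v} {w} x≡ t′))

    chart-occupies : ∀ {O f} → Charts O f → ∀ g → Occupies (f g) g
    chart-occupies {O} {f} chart g = spot-occupied O (f g) g
        (subst (λ q → Covered q (spot O g)) (spot-tile chart g) (covers (spot O g)))

    chart-tile : ∀ {O f c p g} → Charts O f → at c ≡ scale O p → Occupies p g → f g ≡ p
    chart-tile {O} {f} {c} {p} {g} chart eq occ = scale-injective O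
      (trans (sym (spot-tile chart g)) (same-tile {c} O p eq (spot-covered O occ)))

    -- A step either stays within the piece or crosses one of its sides, and `neighbour` provides
    -- the piece beyond it.
    charted-step : ∀ O D {g} → Charted O g → Charted O (g ⊕ vec D)
    charted-step O D {g} (p , eq) with occupies? p (g ⊕ vec D)
    ... | yes occ = p , same-tile {spot O g} O p eq (spot-covered O occ)
    ... | no ¬occ with side-here D
        (spot-occupied O p g (subst (λ q → Covered q (spot O g)) eq (covers (spot O g)))) ¬occ
    ...   | e , h with neighbour {spot O g} O p eq h
    ...     | c′ , p′ , _ , eq′ , h′ = p′ , same-tile {c′} O p′ eq′ (spot-covered O (side-inside h′))

    charted-steps : ∀ O D k {g} → Charted O g → Charted O (g ⊕ loc D (+ k) 0ℤ)
    charted-steps O D zero {g} ch = subst (Charted O)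
        (sym (trans (cong (g ⊕_) (loc-zero D)) (⊕-identityʳ g))) ch
      where
      loc-zero : ∀ D → loc D 0ℤ 0ℤ ≡ origin
      loc-zero east  = refl
      loc-zero north = refl
      loc-zero west  = refl
      loc-zero south = refl
    charted-steps O D (suc k) {g} ch = subst (Charted O) (step≡ g) (charted-step O D (charted-steps O D k ch))
      where
      vec-loc : ∀ D → vec D ≡ loc D 1ℤ 0ℤ
      vec-loc east  = refl
      vec-loc north = refl
      vec-loc west  = refl
      vec-loc south = refl
      step≡ : ∀ g → (g ⊕ loc D (+ k) 0ℤ) ⊕ vec D ≡ g ⊕ loc D (+ suc k) 0ℤ
      step≡ g = trans (⊕-assoc g (loc D (+ k) 0ℤ) (vec D))
          (cong (g ⊕_) (trans (cong (loc D (+ k) 0ℤ ⊕_) (vec-loc D))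
        (trans (loc-⊕ D (+ k) 0ℤ 1ℤ 0ℤ) (cong (λ a → loc D a 0ℤ) (ℤ.+-comm (+ k) 1ℤ)))))

    charted-all : ∀ O {g} → Charted O g → ∀ g′ → Charted O g′
    charted-all O {g} ch g′ = subst (Charted O) (trans (⊕-comm g (g′ ⊕ ⊖ g)) (cancelʳ′ g′ g)) (reach (g′ ⊕ ⊖ g))
      where
      along : ∀ D D′ {g} → (∀ k → loc D′ (+ suc k) 0ℤ ≡ loc D -[1+ k ] 0ℤ) → Charted O g → ∀ a →
          Charted O (g ⊕ loc D a 0ℤ)
      along D D′ back ch (+ k) = charted-steps O D k ch
      along D D′ {g} back ch -[1+ k ] = subst (λ v → Charted O (g ⊕ v)) (back k) (charted-steps O D′ (suc k) ch)
      reach : ∀ v → Charted O (g ⊕ v)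
      reach (a , b) = subst (Charted O)
        (trans (⊕-assoc g (a , 0ℤ) (- 0ℤ , b)) (cong (g ⊕_) (cell-≡ (ℤ.+-identityʳ a) (ℤ.+-identityˡ b))))
        (along north south (λ _ → refl) (along east west (λ _ → refl) ch a) b)

    chart : ∀ O {c p} → at c ≡ scale O p → ∃[ f ] Charts O f
    chart O {c} {p} eq with some-side p
    ... | _ , g , _ , h = (λ g′ → proj₁ (all g′)) , charting λ g′ → proj₂ (all g′)
      where
      all : ∀ g′ → Charted O g′
      all = charted-all O {g} (p , same-tile {c} O p eq (spot-covered O (side-inside h)))

    -- Blocks that overlap have a common solid cell.
    aligned : ∀ {O f c} O′ p′ → Charts O f → at c ≡ scale O′ p′ → ∃[ p ] scale O′ p′ ≡ scale O p
    aligned {O} {f} {c} O′ p′ chart eq with some-side p′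
    ... | _ , g′ , _ , h with locate O (base O′ g′)
    ...   | g , o , C′≡ , ((p , q) , (r , s)) with overlapping {base O g} {base O′ g′} near C′≡
      where
      near : Near o
      near = inj₁ ((lin 2 (λ x m → ⊟ m ≼ x ⇒ goal (⊟ (m ⊞ # 7) ≼ x)) (proj₁ o) M p ,
                    lin 2 (λ x m → x ≼ m ⇒ goal (x ≼ m ⊞ # 7)) (proj₁ o) M q) ,
                   (lin 3 (λ x l m → ⊟ m ≼ x ⇒ # 1 ≼ l ⇒ 12 ⊠ l ⊞ # 40 ≼ m ⇒ goal (⊟ (2 ⊠ m) ≼ x))
                       (proj₂ o) ℓ M r 1≤l large ,
                    lin 3 (λ x l m → x ≼ m ⇒ # 1 ≼ l ⇒ 12 ⊠ l ⊞ # 40 ≼ m ⇒ goal (x ≼ 2 ⊠ m))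
                        (proj₂ o) ℓ M s 1≤l large))
    ...     | o₁ , o₂ , solid₁ , solid₂ , eq″ = f g , both-labeled {c} {spot O g} O′ p′ O
        (f g) eq (spot-tile chart g)
      (solid-covered O′ (side-inside h) solid₂)
      (subst (Covered (scale O (f g))) eq″ (solid-covered O (chart-occupies chart g) solid₁))

    -- If a tooth covers the origin, the four cells in one of its corners are inspected in turn. By
    -- `crowded`, they cannot all be covered by teeth.
    some-labeled : ∃[ O ] ∃[ p ] ∃[ c ] at c ≡ scale O p
    some-labeled = by (view (at origin)) refl
      where
      Found : Set
      Found = ∃[ O ] ∃[ p ] ∃[ c ] at c ≡ scale O p

      no-conflict : ∀ z a b {c c′ r r′} → at c ≡ tooth r (z ⊕ a) → at c′ ≡ tooth r′ (z ⊕ b) → ¬ Conflict a b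
      no-conflict z a b {c} {c′} {r} {r′} eq eq′ (a≢b , meet) with find meet
      ... | w , w∈ , t = a≢b (⊕-cancelˡ z a b (tooth-centre-unique r (z ⊕ a) r′ (z ⊕ b)
        (subst₂ (λ q q′ → Covered q ≐ Covered q′) eq eq′ (same-region {c} {c′} {(z ⊕ a) ⊕ w}
          (subst (λ q → Covered q ((z ⊕ a) ⊕ w)) (sym eq) (tooth-covered r (z ⊕ a) (All.lookup teeth w∈)))
          (subst (λ q → Covered q ((z ⊕ a) ⊕ w)) (sym eq′)
            (subst (Covered (tooth r′ (z ⊕ b))) (there≡ z a b w) (tooth-covered r′ (z ⊕ b) t)))))))
        where
        teeth : All Tooth toothCells
        teeth = from-yes (All.all? tooth? toothCells)
        there≡ : ∀ z a b w → (z ⊕ b) ⊕ ((a ⊕ w) ⊕ ⊖ b) ≡ (z ⊕ a) ⊕ w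
        there≡ (z , z′) (a , a′) (b , b′) (w , w′) = cell-≡ (one z a b w) (one z′ a′ b′ w′)
          where
          one : ∀ z a b w → z + b + (a + w + - b) ≡ z + a + w
          one = lin 4 (λ z a b w → goal (z ⊞ b ⊞ (a ⊞ w ⊞ ⊟ b) ≗ z ⊞ a ⊞ w))

      look : ∀ z k → Found ⊎ (∃[ r ] ∃[ o ] Tooth o × at (z ⊕ k) ≡ tooth r (z ⊕ (k ⊕ ⊖ o)))
      look z k = go (view (at (z ⊕ k))) refl
        where
        go : ∀ {q} → View q → at (z ⊕ k) ≡ q →
            Found ⊎ (∃[ r ] ∃[ o ] Tooth o × at (z ⊕ k) ≡ tooth r (z ⊕ (k ⊕ ⊖ o)))
        go (labeled O p) eq = inj₁ (O , p , z ⊕ k , eq)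
        go (lone r y) eq with covered-tooth r y (subst (λ q → Covered q (z ⊕ k)) eq (covers (z ⊕ k)))
        ... | o , t , k≡ = inj₂ (r , o , t , trans eq (cong (tooth r) (trans (sym (cancelʳ y o))
          (trans (cong (_⊕ (⊖ o)) (sym k≡)) (⊕-assoc z k (⊖ o))))))

      corner : ∀ z r c → at c ≡ tooth r (z ⊕ origin) → Found
      corner z r c eq with look z (1ℤ , 1ℤ)
      ... | inj₁ found = found
      ... | inj₂ (_ , o₁ , t₁ , eq₁) with All.lookup crowded (tooth⇒∈ t₁)
      ...   | inj₁ conflict = ⊥-elim (no-conflict z origin _ {c} eq eq₁ conflict)
      ...   | inj₂ s₂ with look z (1ℤ , + 2)
      ...     | inj₁ found = found
      ...     | inj₂ (_ , o₂ , t₂ , eq₂) with All.lookup s₂ (tooth⇒∈ t₂)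
      ...       | inj₁ (inj₁ conflict) = ⊥-elim (no-conflict z origin _ {c} eq eq₂ conflict)
      ...       | inj₁ (inj₂ conflict) = ⊥-elim (no-conflict z _ _ eq₁ eq₂ conflict)
      ...       | inj₂ s₃ with look z (+ 2 , 1ℤ)
      ...         | inj₁ found = found
      ...         | inj₂ (_ , o₃ , t₃ , eq₃) with All.lookup s₃ (tooth⇒∈ t₃)
      ...           | inj₁ (inj₁ conflict) = ⊥-elim (no-conflict z origin _ {c} eq eq₃ conflict)
      ...           | inj₁ (inj₂ conflict) = ⊥-elim (no-conflict z _ _ eq₁ eq₃ conflict)
      ...           | inj₂ s₄ with look z (+ 2 , + 2)
      ...             | inj₁ found = found
      ...             | inj₂ (_ , o₄ , t₄ , eq₄) with All.lookup s₄ (tooth⇒∈ t₄)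
      ...               | inj₁ conflict = ⊥-elim (no-conflict z origin _ {c} eq eq₄ conflict)
      ...               | inj₂ (inj₁ conflict) = ⊥-elim (no-conflict z _ _ eq₁ eq₄ conflict)
      ...               | inj₂ (inj₂ (inj₁ conflict)) = ⊥-elim (no-conflict z _ _ eq₂ eq₄ conflict)
      ...               | inj₂ (inj₂ (inj₂ conflict)) = ⊥-elim (no-conflict z _ _ eq₃ eq₄ conflict)

      by : ∀ {q} → View q → at origin ≡ q → Found
      by (labeled O p) eq = O , p , origin , eq
      by (lone r z) eq = corner z r origin (trans eq (cong (tooth r) (sym (⊕-identityʳ z))))

    -- The charted pieces fill every block except for the dents, and a tooth cannot share a cell
    -- with a body.
    tooth-in-dent : ∀ {O f x r z} → Charts O f → at x ≡ tooth r z →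
      ∃[ g ] ∃[ D ] ∃[ e ] ∃[ t ] HasSide (f g) e (g , D) × Toothed l (lock e) t × x ≡ base O g ⊕ dent D t
    tooth-in-dent {O} {f} {x} {r} {z} chart eq with locate O x
    ... | g , o , x≡ , ino with in-dent? (f g) g o
    ...   | yes (D , e , t , h , toothed , refl) = g , D , e , t , h , toothed , x≡
    ...   | no ¬dent = ⊥-elim (labeled-not-tooth {spot O g} {x} {x} O (f g) r z (spot-tile chart g) eq
      (subst (Covered (scale O (f g))) (sym x≡) (body-covered O ino (chart-occupies chart g) ¬dent))
      (subst (λ q → Covered q x) eq (covers x)))

    -- The rectangle of the lock is filled by the key of the neighbour, so `x` lies in a hole for a
    -- tooth. A tooth that does not fill this hole exactly covers a cell of its ring; there it meets
    -- the body of `p` or, where the hole is attached, the key.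
    tooth-in-hole : ∀ {O c x p e g D t r z} → at c ≡ scale O p → HasSide p e (g , D) → Toothed l (lock e) t →
      x ≡ base O g ⊕ dent D t → at x ≡ tooth r z →
      ∃[ j ] ToothAt j t × z ≡ base O g ⊕ dent D (toothCentre j)
    tooth-in-hole {O} {c} {x} {p} {e} {g} {D} {t} {r} {z} eq h toothed x≡ eqᵗ with neighbour {c} O p eq h
    ... | c′ , p′ , _ , eq′ , h′ with toothed-cases toothed
    ...   | inj₁ s = ⊥-elim (labeled-not-tooth {c′} {x} {x} O p′ r z eq′ eqᵗ
      (subst (Covered (scale O p′)) (sym x≡) (key-covered O D h′ (spine⇒toothed s)))
      (subst (λ q → Covered q x) eqᵗ (covers x)))
    ...   | inj₂ (j , j∈ , hole) with covered-tooth r z (subst (λ q → Covered q x) eqᵗ (covers x))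
    ...     | o , tₒ , x≡z with flip-surjective D o
    ...       | v , refl = go (meets-ring {u} {v} hole (tooth-flip⁻ D tₒ))
      where
      u : Cell
      u = toothOffset j t

      B : Cell
      B = base O g

      t≡ : toothCentre j ⊕ u ≡ t
      t≡ = toothCentre-offset j t

      go : u ⊕ ⊖ v ≡ origin ⊎ Any (λ w → Tooth (w ⊕ ⊖ (u ⊕ ⊖ v))) ring →
        ∃[ j ] ToothAt j t × z ≡ B ⊕ dent D (toothCentre j)
      go (inj₁ u-v≡0) = j , hole , ⊕-cancelʳ (flip D v) z (B ⊕ dent D (toothCentre j))
        (trans (sym x≡z) (trans x≡ (trans (cong (λ t → B ⊕ dent D t) (sym t≡))
          (trans (dent-step O g D (toothCentre j) u)
              (cong (λ u → (B ⊕ dent D (toothCentre j)) ⊕ flip D u) u≡v)))))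
        where
        u≡v : u ≡ v
        u≡v = ⊕-cancelʳ (⊖ v) u v (trans u-v≡0 (sym (⊕-inverseʳ v)))
      go (inj₂ meet) with find meet
      ... | w , w∈ , t′ = ⊥-elim (by (toothed? (lock e) (toothCentre j ⊕ w)))
        where
        y : Cell
        y = B ⊕ dent D (toothCentre j ⊕ w)

        y≡ : x ⊕ flip D (w ⊕ ⊖ u) ≡ y
        y≡ = trans (cong (_⊕ flip D (w ⊕ ⊖ u)) x≡) (trans (sym (dent-step O g D t (w ⊕ ⊖ u)))
          (cong (λ t → B ⊕ dent D t) (trans (cong (_⊕ (w ⊕ ⊖ u)) (sym t≡)) (moved (toothCentre j) u w))))
          where
          one : ∀ a u w → a + u + (w + - u) ≡ a + w
          one = lin 3 (λ a u w → goal (a ⊞ u ⊞ (w ⊞ ⊟ u) ≗ a ⊞ w))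
          moved : ∀ a u w → (a ⊕ u) ⊕ (w ⊕ ⊖ u) ≡ a ⊕ w
          moved (a , a′) (u , u′) (w , w′) = cell-≡ (one a u w) (one a′ u′ w′)

        reaches : Covered (tooth r z) y
        reaches = subst (Covered (tooth r z)) y≡
            (tooth-step r z {D} {v} {w ⊕ ⊖ u} x≡z (subst Tooth (moved w u v) t′))
          where
          one : ∀ w u v → w + - (u + - v) ≡ w + - u + v
          one = lin 3 (λ w u v → goal (w ⊞ ⊟ (u ⊞ ⊟ v) ≗ w ⊞ ⊟ u ⊞ v))
          moved : ∀ w u v → w ⊕ ⊖ (u ⊕ ⊖ v) ≡ (w ⊕ ⊖ u) ⊕ v
          moved (w , w′) (u , u′) (v , v′) = cell-≡ (one w u v) (one w′ u′ v′)

        by : ¬ Dec (Toothed l (lock e) (toothCentre j ⊕ w))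
        by (no ¬toothed) = labeled-not-tooth {c} {x} {y} O p r z eq eqᵗ
          (beside-dent-covered O h (proj₁ (ring-solid j w∈)) ¬toothed) reaches
        by (yes toothed′) = labeled-not-tooth {c′} {x} {y} O p′ r z eq′ eqᵗ
          (key-covered O D h′ (spine⇒toothed (proj₂ (ring-solid j w∈) toothed′))) reaches

-- The bijection

module KLBijection {n} (P : Fin n → Polyomino) (G : UndirectedGraph (Edge P))
  (scaling : Scale) (labels : Labels P scaling)
  (fits⇒adj : ∀ {e e′} → Labels.key labels e′ ∈ˢ Labels.lock labels e → UndirectedGraph.Adj G e e′)
  (adj⇒fits : ∀ {e e′} → UndirectedGraph.Adj G e e′ → Labels.key labels e′ ∈ˢ Labels.lock labels e)
  (μ : Motions) where

  open UndirectedGraph G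
  open Scale scaling
  open Scaled scaling
  open Dented scaling
  open Labels labels
  open KLTiles P scaling labels
  open KLRegions P scaling labels
  open KLSpots P scaling labels
  open KLTiling P scaling labels

  Tilingᴷᴸ : Set
  Tilingᴷᴸ = Tiling μ (KL P labeling)

  Matched : Set
  Matched = Setoid.Carrier (matchedTilings P G μ)

  opaque
    some-chart : ∀ (T : Tilingᴷᴸ) → ∃[ O ] ∃[ f ] Charts T O f
    some-chart T with some-labeled T
    ... | O , p , c , eq with chart T O eq
    ...   | f , ch = O , f , ch

  -- The chart is an arbitrary choice; another one changes the result by a translation, which `_≈_`
  -- ignores.
  forward : Tilingᴷᴸ → Matched
  forward T with some-chart T
  ... | O , f , ch = record
    { at       = f
    ; allowed  = λ g → subst (λ q → Allowed μ (rot q)) (spot-tile ch g) (Tiling.allowed T (spot O g))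
    ; covers   = λ g → Occupies.covering (chart-occupies T ch g)
    ; coherent = λ {g} cov → chart-tile T {c = spot O g} ch (spot-tile ch g) (occupying cov)
    } , λ c c′ e e′ e∈ e′∈ facing → fits⇒adj
          (key-fits T O (f c) (f c′) (spot-tile ch c) (spot-tile ch c′)
              (has-side e∈ refl) (has-side e′∈ facing))

  translate-occupies : ∀ {p g} v → Occupies p g → Occupies (translate v p) (g ⊕ v)
  translate-occupies {p} v (occupying (c , c∈ , refl)) =
    occupying (c , c∈ , sym (⊕-assoc (rotate (rot p) c) (shift p) v))

  -- By `aligned`, `O′` is a block centre of the grid of `O`, so the bases differ by `σ ⊛ w`; after
  -- shrinking this is the translation by `w`.
  charts-unique : ∀ (T : Tilingᴷᴸ) {O O′ f f′} → Charts T O f → Charts T O′ f′ →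
    ∃[ w ] O′ ≡ base O w × (∀ g → f (g ⊕ w) ≡ translate w (f′ g))
  charts-unique T {O} {O′} {f} {f′} ch ch′ with aligned T O′ (f′ origin) ch (spot-tile ch′ origin)
  ... | p , eq = w , O′≡ , λ g → chart-tile T ch
    (trans (spot-tile ch′ g) (trans (cong (λ O → scale O (f′ g)) O′≡) (scale-translate O w (f′ g))))
    (translate-occupies w (chart-occupies T ch′ g))
    where
    w : Cell
    w = shift p ⊕ ⊖ shift (f′ origin)
    O′≡ : O′ ≡ base O w
    O′≡ = rebase O O′ (shift p) (shift (f′ origin)) (sym (cong shift eq))

  translate-scale : ∀ v O p → translate v (scale O p) ≡ scale (O ⊕ v) p
  translate-scale v O p = cong (place (just (tile p)) (rot p)) (⊕-swap O (σ ⊛ shift p) v)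

  opaque
    chart-translate : ∀ {T U : Tilingᴷᴸ} {O f} ((v , _) : T ≈ U) → Charts T O f → Charts U (O ⊕ v) f
    chart-translate {T} {U} {O} {f} (v , agree) ch = charting λ g → labeled-unique (O ⊕ v) (f g)
      (subst₂ (λ c q → Covered (Tiling.at U c) ≐ Covered q)
        (trans (⊕-swap (base O g) anchor v) (cong (_⊕ anchor) (⊕-swap O (σ ⊛ g) v)))
        (trans (cong (translate v) (spot-tile ch g)) (translate-scale v O (f g)))
        (agree (spot O g)))

  forward-cong : ∀ {T U : Tilingᴷᴸ} → T ≈ U → proj₁ (forward T) ≈ proj₁ (forward U)
  forward-cong {T} {U} T≈U with some-chart T | some-chart U
  ... | O , f , ch | O′ , f′ , ch′ with charts-unique U ch′ (chart-translate T≈U ch)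
  ...   | w , _ , eq = w , eq

  Corresponds : (T U : Tilingᴷᴸ) → Cell → Set
  Corresponds T U v = ∀ c O p → Tiling.at T c ≡ scale O p → Tiling.at U (c ⊕ v) ≡ translate v (Tiling.at T c)

  corresponds : ∀ (T U : Tilingᴷᴸ) {O O′ f f′} → Charts T O f → Charts U O′ f′ → ∀ v w → O ⊕ v ≡ base O′ w →
    (∀ g → f′ (g ⊕ w) ≡ translate w (f g)) → Corresponds T U v
  corresponds T U {O} {O′} {f} {f′} ch ch′ v w O+v≡ f′≡ c Oᶜ pᶜ eqᶜ with aligned T Oᶜ pᶜ ch eqᶜ
  ... | p , eq with some-side p
  ...   | _ , g , _ , h = trans (same-tile U (O ⊕ v) p spot≡ covered′) (sym at≡)
    where
    f≡ : f g ≡ p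
    f≡ = chart-tile T ch (trans eqᶜ eq) (side-inside h)
    spot≡ : Tiling.at U (spot O′ (g ⊕ w)) ≡ scale (O ⊕ v) p
    spot≡ = trans (spot-tile ch′ (g ⊕ w)) (trans (cong (scale O′) (trans (f′≡ g) (cong (translate w) f≡)))
      (trans (sym (scale-translate O′ w p)) (cong (λ O → scale O p) (sym O+v≡))))
    at≡ : translate v (Tiling.at T c) ≡ scale (O ⊕ v) p
    at≡ = trans (cong (translate v) (trans eqᶜ eq)) (translate-scale v O p)
    covered′ : Covered (scale (O ⊕ v) p) (c ⊕ v)
    covered′ with subst (λ q → Covered q c) (trans eqᶜ eq) (Tiling.covers T c)
    ... | c₀ , c₀∈ , refl = c₀ , c₀∈ , trans (cong (rotate (rot p) c₀ ⊕_) (sym (⊕-swap O (σ ⊛ shift p) v)))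
      (sym (⊕-assoc (rotate (rot p) c₀) (O ⊕ σ ⊛ shift p) v))

  -- `corresponds`, applied in both directions, matches labeled tiles with labeled tiles and so
  -- teeth with teeth. A tooth fills a hole in a lock, and the same hole of the corresponding lock
  -- holds the tooth of the other tiling.
  forward-injective : ∀ {T U : Tilingᴷᴸ} → proj₁ (forward T) ≈ proj₁ (forward U) → T ≈ U
  forward-injective {T} {U} eq with some-chart T | some-chart U
  forward-injective {T} {U} (w , f′≡) | O , f , ch | O′ , f′ , ch′ = v , agree
    where
    module T = Tiling T
    module U = Tiling U

    -- The translation that takes the grid of `T` to that of `U`, with the block of `g` going to
    -- that of `g ⊕ w`.
    v : Cell
    v = base O′ w ⊕ ⊖ O

    O+v≡ : O ⊕ v ≡ base O′ w
    O+v≡ = trans (⊕-comm O v) (cancelʳ′ (base O′ w) O)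

    O′-v≡ : O′ ⊕ ⊖ v ≡ base O (⊖ w)
    O′-v≡ = trans (back O O′ (σ ⊛ w)) (cong (O ⊕_) (sym (⊛-⊖ σ w)))
      where
      one : ∀ o o′ s → o′ + - (o′ + s + - o) ≡ o + - s
      one = lin 3 (λ o o′ s → goal (o′ ⊞ ⊟ (o′ ⊞ s ⊞ ⊟ o) ≗ o ⊞ ⊟ s))
      back : ∀ O O′ S → O′ ⊕ ⊖ ((O′ ⊕ S) ⊕ ⊖ O) ≡ O ⊕ ⊖ S
      back (o , p) (o′ , p′) (s , s′) = cell-≡ (one o o′ s) (one p p′ s′)

    f≡ : ∀ g → f (g ⊕ ⊖ w) ≡ translate (⊖ w) (f′ g)
    f≡ g = trans (sym (back (f (g ⊕ ⊖ w))))
        (cong (translate (⊖ w)) (trans (sym (f′≡ (g ⊕ ⊖ w))) (cong f′ (cancelʳ′ g w))))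
      where
      back : ∀ p → translate (⊖ w) (translate w p) ≡ p
      back p = cong (place (tile p) (rot p)) (cancelʳ (shift p) w)

    over : ∀ g x → (base O g ⊕ x) ⊕ v ≡ base O′ (g ⊕ w) ⊕ x
    over g x = trans (⊕-swap (base O g) x v) (cong (_⊕ x) (trans (⊕-swap O (σ ⊛ g) v)
      (trans (cong (_⊕ σ ⊛ g) O+v≡) (trans (⊕-assoc O′ (σ ⊛ w) (σ ⊛ g)) (cong (O′ ⊕_)
      (trans (⊕-comm (σ ⊛ w) (σ ⊛ g)) (sym (⊛-⊕ σ g w))))))))

    onward : Corresponds T U v
    onward = corresponds T U ch ch′ v w O+v≡ f′≡

    and-back : Corresponds U T (⊖ v)
    and-back = corresponds U T ch′ ch (⊖ v) (⊖ w) O′-v≡ f≡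

    agree : ∀ c → Covered (U.at (c ⊕ v)) ≐ Covered (translate v (T.at c))
    agree c = by (view (T.at c)) (view (U.at (c ⊕ v))) refl refl
      where
      by : ∀ {q q′} → View q → View q′ → T.at c ≡ q → U.at (c ⊕ v) ≡ q′ →
          Covered (U.at (c ⊕ v)) ≐ Covered (translate v (T.at c))
      by (labeled Oᶜ p) _ eq _ = subst (λ q → Covered (U.at (c ⊕ v)) ≐ Covered q) (onward c Oᶜ p eq)
          ((λ x → x) , (λ x → x))
      -- Carrying the labeled tile of `U` back to `T` would make a tooth equal to a labeled
      -- polyomino.
      by (lone r z) (labeled Oᶜ p) eq eq′ with trans (sym eq) (trans (cong T.at (sym (cancelʳ c v)))
                                                  (trans (and-back (c ⊕ v) Oᶜ p eq′)
                                                      (cong (translate (⊖ v)) eq′)))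
      ... | ()
      by (lone r z) (lone r′ z′) eq eq′ with tooth-in-dent T ch eq
      ... | g , D , e , t , h , toothed , c≡ with tooth-in-hole T {O} (spot-tile ch g) h toothed c≡ eq
               | tooth-in-hole U {O′} {p = f′ (g ⊕ w)} {e} {g ⊕ w} {D} {t} (spot-tile ch′ (g ⊕ w))
                   (subst (λ p → HasSide p e (g ⊕ w , D)) (sym (f′≡ g)) (translate-side w h)) toothed c+v≡ eq′
        where
        c+v≡ : c ⊕ v ≡ base O′ (g ⊕ w) ⊕ dent D t
        c+v≡ = trans (cong (_⊕ v) c≡) (over g (dent D t))
      ... | j , hole , refl | j′ , hole′ , refl with toothAt-unique {j} {j′} {t} hole hole′
      ...   | refl = subst₂ (λ q q′ → Covered q ≐ Covered q′) (sym eq′)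
          (trans (cong (tooth r) (sym (over g (dent D (toothCentre j))))) (cong (translate v) (sym eq)))
        (tooth-same r′ z′ r)

  -- The tiling by labeled polyominoes and teeth built from a matched tiling

  module Backward (matched : Matched) where

    V : Tiling μ (polyominoTiles P G)
    V = proj₁ matched

    module V = Tiling V

    f : Cell → Piece
    f = V.at

    occupied : ∀ g → Occupies (f g) g
    occupied g = occupying (V.covers g)

    occupant : ∀ {g g′} → Occupies (f g) g′ → f g′ ≡ f g
    occupant {g} {g′} (occupying cov) = V.coherent {g} {g′} cov

    Facing : Edge P → Cell → Dir → Set
    Facing e g D = HasSide (f (g ⊕ vec D)) e (otherSide (g , D))

    facing-edge : ∀ {e g D} → HasSide (f g) e (g , D) → ∃[ e′ ] Facing e′ g D
    facing-edge {e} {g} {D} h = side-here (opposite D) (occupied (g ⊕ vec D)) λ occ →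
      side-outside h (subst (λ p → Occupies p (g ⊕ vec D))
        (sym (occupant (subst (Occupies (f (g ⊕ vec D))) (cong proj₁ (otherSide-involutive (g , D))) occ)))
        (occupied (g ⊕ vec D)))

    facing-adjacent : ∀ {e e′ g D} → HasSide (f g) e (g , D) → Facing e′ g D → Adj e e′
    facing-adjacent {e} {e′} {g} {D} (has-side e∈ eq) (has-side e′∈ eq′) =
      proj₂ matched g (g ⊕ vec D) e e′ e∈ e′∈ (trans eq′ (cong otherSide (sym eq)))

    holeCentre : Cell → Dir → Fin l → Cell
    holeCentre g D j = base origin g ⊕ dent D (toothCentre j)

    -- A hole gets a tooth exactly if the facing key does not put its own tooth there. The condition
    -- ranges over all facing edges, which avoids choosing one; by `edge-unique` there is at most
    -- one.
    data IsTile : Placement (Maybe (Fin n)) → Set where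
      piece  : ∀ g → IsTile (scale origin (f g))
      filler : ∀ g D e j → HasSide (f g) e (g , D) → j ∈ˢ lock e →
               (∀ {e′} → Facing e′ g D → ¬ key e′ ≡ j) → IsTile (tooth zero (holeCentre g D j))

    OwnerAt : Cell → Set
    OwnerAt c = ∃[ q ] IsTile q × Covered q c

    dent-owner : ∀ {g D e e′ t} → HasSide (f g) e (g , D) → Facing e′ g D → Toothed l (lock e) t →
      OwnerAt (base origin g ⊕ dent D t)
    dent-owner {g} {D} {e} {e′} {t} h h′ toothed with toothed-cases toothed
    ... | inj₁ s = scale origin (f (g ⊕ vec D)) , piece (g ⊕ vec D) , key-covered origin D h′ (spine⇒toothed s)
    ... | inj₂ (j , j∈ , hole) with key e′ Fin.≟ j
    ...   | yes refl = scale origin (f (g ⊕ vec D)) , piece (g ⊕ vec D) ,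
      key-covered origin D h′ (toothAt⇒toothed {j = key e′} {t} (x∈⁅x⁆ (key e′)) hole)
    ...   | no k≢j = tooth zero (holeCentre g D j) ,
      filler g D e j h j∈ (λ h″ k≡j → k≢j (trans (cong key (edge-unique h′ h″)) k≡j)) ,
      subst (Covered (tooth zero (holeCentre g D j)))
        (trans (sym (dent-step origin g D (toothCentre j) (toothOffset j t)))
          (cong (λ t → base origin g ⊕ dent D t) (toothCentre-offset j t)))
        (tooth-covered zero (holeCentre g D j) (tooth-flip D hole))

    opaque
      owner : ∀ c → OwnerAt c
      owner c with locate origin c
      ... | g , o , c≡ , ino with in-dent? (f g) g o
      ...   | no ¬dent = scale origin (f g) , piece g ,
        subst (Covered (scale origin (f g))) (sym c≡) (body-covered origin ino (occupied g) ¬dent)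
      ...   | yes (D , e , t , h , toothed , o≡) with facing-edge h
      ...     | e′ , h′ = subst OwnerAt (sym (trans c≡ (cong (base origin g ⊕_) o≡))) (dent-owner h h′ toothed)

    -- The constructors record which part of a tile lies at the position and where it sits in a
    -- dent. These data exclude each other and determine the tile, so disjointness reduces to
    -- comparing constructors.
    data Owns (g o : Cell) : Placement (Maybe (Fin n)) → Set where
      by-body  : ¬ InDent (f g) g o → Owns g o (scale origin (f g))
      by-key   : ∀ {D e e′ t} → HasSide (f g) e (g , D) → Facing e′ g D → Toothed l (lock e) t →
                 Toothed l ⁅ key e′ ⁆ t → o ≡ dent D t → Owns g o (scale origin (f (g ⊕ vec D)))
      by-tooth : ∀ {D e j t} → HasSide (f g) e (g , D) → (∀ {e′} → Facing e′ g D → ¬ key e′ ≡ j) →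
                 Toothed l (lock e) t → ToothAt j t → o ≡ dent D t → Owns g o (tooth zero (holeCentre g D j))

    owns : ∀ {q g o} → InBlock o → IsTile q → Covered q (base origin g ⊕ o) → Owns g o q
    owns {g = g} {o} ino (piece g′) cov with covered⇒covers origin (f g′) g ino cov
    ... | body occ ¬dent = subst (λ p → Owns g o (scale origin p)) (occupant occ)
      (by-body λ { (D , e , t , h , toothed , o≡) →
        ¬dent (subst (λ p → HasSide p e (g , D)) (occupant occ) h) toothed o≡ })
    ... | bump {e′} {D} {t} h′ toothed o≡ = subst (λ p → Owns g o (scale origin p)) (occupant (side-inside h′))
      (by-key (proj₂ ahead) h″ (toothed-⊆ fits toothed) toothed o≡)
      where
      h″ : Facing e′ g D
      h″ = subst (λ p → HasSide p e′ (otherSide (g , D))) (sym (occupant (side-inside h′))) h′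
      back : (g ⊕ vec D) ⊕ vec (opposite D) ≡ g
      back = cong proj₁ (otherSide-involutive (g , D))
      ahead : ∃[ e ] HasSide (f g) e (g , D)
      ahead with facing-edge h″
      ... | e , h = e , subst₂ (λ p s → HasSide p e s) (cong f back) (otherSide-involutive (g , D)) h
      -- The matching rule enters here: adjacency places the tooth of the key inside the lock, so
      -- that the key covers nothing of the body.
      fits : ⁅ key e′ ⁆ ⊆ˢ lock (proj₁ ahead)
      fits k∈ = subst (_∈ˢ lock (proj₁ ahead)) (sym (x∈⁅y⁆⇒x≡y (key e′) k∈))
          (adj⇒fits (facing-adjacent (proj₂ ahead) h″))
    owns {g = g} {o} ino (filler g′ D e j h j∈ unkeyed) cov with covered-tooth zero (holeCentre g′ D j) cov
    ... | o′ , t , eq with flip-surjective D o′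
    ...   | u , refl = go (based-unique origin ino (dent-in-block D (inner⇒zone (toothed-inner toothed)))
                            (trans eq (sym (dent-step origin g′ D (toothCentre j) u))))
      where
      hole : ToothAt j (toothCentre j ⊕ u)
      hole = subst Tooth (sym (offset-toothCentre j u)) (tooth-flip⁻ D t)
      toothed : Toothed l (lock e) (toothCentre j ⊕ u)
      toothed = toothAt⇒toothed {j = j} {toothCentre j ⊕ u} j∈ hole
      go : g ≡ g′ × o ≡ dent D (toothCentre j ⊕ u) → Owns g o (tooth zero (holeCentre g′ D j))
      go (refl , refl) = by-tooth {t = toothCentre j ⊕ u} h unkeyed toothed hole refl

    same-dent : ∀ {D D′ e e′ t t′} → Toothed l (lock e) t → Toothed l (lock e′) t′ →
        dent D t ≡ dent D′ t′ → D ≡ D′ × t ≡ t′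
    same-dent toothed toothed′ = dent-unique (inner⇒zone (toothed-inner toothed))
        (inner⇒zone (toothed-inner toothed′))

    opaque
      key-not-tooth : ∀ {D D′ e e′ t t′ e″ j g} → Facing e′ g D → (∀ {e′} → Facing e′ g D′ → ¬ key e′ ≡ j) →
        Toothed l (lock e) t → Toothed l (lock e″) t′ → Toothed l ⁅ key e′ ⁆ t → ToothAt j t′ →
            ¬ dent D t ≡ dent D′ t′
      key-not-tooth {D} {D′} {e} {e′} {t} {t′} {e″} {j} h′ unkeyed toothed toothed′ keyed hole eq
        with same-dent {D} {D′} {e} {e″} {t} {t′} toothed toothed′ eq
      ... | refl , refl with toothed-cases keyed
      ...   | inj₁ s = spine-not-toothAt {j} s hole
      ...   | inj₂ (i , i∈ , hole′) = unkeyed h′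
          (trans (sym (x∈⁅y⁆⇒x≡y (key e′) i∈)) (toothAt-unique {i} {j} {t} hole′ hole))

      owns-unique : ∀ {g o q q′} → Owns g o q → Owns g o q′ → q ≡ q′
      owns-unique (by-body _) (by-body _) = refl
      owns-unique (by-body ¬dent) (by-key h _ toothed _ o≡) = ⊥-elim (¬dent (_ , _ , _ , h , toothed , o≡))
      owns-unique (by-body ¬dent) (by-tooth h _ toothed _ o≡) = ⊥-elim (¬dent (_ , _ , _ , h , toothed , o≡))
      owns-unique (by-key h _ toothed _ o≡) (by-body ¬dent) = ⊥-elim (¬dent (_ , _ , _ , h , toothed , o≡))
      owns-unique (by-tooth h _ toothed _ o≡) (by-body ¬dent) = ⊥-elim (¬dent (_ , _ , _ , h , toothed , o≡))
      owns-unique (by-key {D} {e} {t = t} _ _ toothed _ o≡) (by-key {D′} {e′} {t = t′} _ _ toothed′ _ o≡′)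
        with same-dent {D} {D′} {e} {e′} {t} {t′} toothed toothed′ (trans (sym o≡) o≡′)
      ... | refl , refl = refl
      owns-unique {g} (by-key {D} {e} {e₁} {t} _ h′ toothed keyed o≡)
          (by-tooth {D′} {e′} {j} {t′} _ unkeyed toothed′ hole o≡′) =
        ⊥-elim (key-not-tooth {D} {D′} {e} {e₁} {t} {t′} {e′} {j} {g} h′ unkeyed toothed toothed′ keyed
            hole (trans (sym o≡) o≡′))
      owns-unique {g} (by-tooth {D′} {e′} {j} {t′} _ unkeyed toothed′ hole o≡′)
          (by-key {D} {e} {e₁} {t} _ h′ toothed keyed o≡) =
        ⊥-elim (key-not-tooth {D} {D′} {e} {e₁} {t} {t′} {e′} {j} {g} h′ unkeyed toothed toothed′ keyed
            hole (trans (sym o≡) o≡′))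
      owns-unique (by-tooth {D} {e} {j} {t} _ _ toothed hole o≡)
          (by-tooth {D′} {e′} {j′} {t′} _ _ toothed′ hole′ o≡′)
        with same-dent {D} {D′} {e} {e′} {t} {t′} toothed toothed′ (trans (sym o≡) o≡′)
      ... | refl , refl with toothAt-unique {j} {j′} {t} hole hole′
      ...   | refl = refl

      tile-unique : ∀ {q q′ c} → IsTile q → IsTile q′ → Covered q c → Covered q′ c → q ≡ q′
      tile-unique {q} {q′} {c} is is′ cov cov′ with locate origin c
      ... | g , o , c≡ , ino = owns-unique (owns ino is (subst (Covered q) c≡ cov))
          (owns ino is′ (subst (Covered q′) c≡ cov′))

    backward : Tilingᴷᴸ
    backward = record
      { at       = λ c → proj₁ (owner c)
      ; allowed  = λ c → allowed (proj₁ (proj₂ (owner c)))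
      ; covers   = λ c → proj₂ (proj₂ (owner c))
      ; coherent = λ {c} {c′} cov → subst (λ q → Covered (proj₁ (owner c′)) ≐ Covered q)
          (tile-unique (proj₁ (proj₂ (owner c′))) (proj₁ (proj₂ (owner c))) (proj₂ (proj₂ (owner c′))) cov)
          ((λ x → x) , (λ x → x))
      }
      where
      unturned : ∀ μ → Allowed μ zero
      unturned translations             = refl
      unturned translationsAndRotations = tt
      allowed : ∀ {q} → IsTile q → Allowed μ (rot q)
      allowed (piece g)              = V.allowed g
      allowed (filler _ _ _ _ _ _ _) = unturned μ

    backward-chart : Charts backward origin f
    backward-chart = charting λ g → tile-unique (proj₁ (proj₂ (owner (spot origin g)))) (piece g)
      (proj₂ (proj₂ (owner (spot origin g)))) (spot-covered origin (occupied g))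

    -- The given tiling is a chart of the constructed one, and the chart that `forward` happens to
    -- choose differs from it by a translation.
    forward-backward : proj₁ (forward backward) ≈ V
    forward-backward with some-chart backward
    ... | O , f′ , ch with charts-unique backward backward-chart ch
    ...   | w , _ , eq = w , eq

  bijection : Bijection (tilings μ (KL P labeling)) (matchedTilings P G μ)
  bijection = record
    { to        = forward
    ; cong      = forward-cong
    ; bijective = (λ {T} {U} → forward-injective {T} {U}) , λ matched → Backward.backward matched ,
        λ {T} T≈ → Setoid.trans (tilings μ (polyominoTiles P G))
          {proj₁ (forward T)} {proj₁ (forward (Backward.backward matched))} {proj₁ matched}
          (forward-cong {T} {Backward.backward matched} T≈) (Backward.forward-backward matched)
    }

-- The labels

module _ {n} (P : Fin n → Polyomino) where

  edgesAt : ∀ i → Cell → Dir → List (Edge P)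
  edgesAt i c d with c ∈ᶜ? cells (P i) | c ⊕ vec d ∈ᶜ? cells (P i)
  ... | yes c∈ | no c∉ = (i , record { cell = c ; dir = d ; inside = c∈ ; outside = c∉ }) ∷ []
  ... | _      | _     = []

  edges : List (Edge P)
  edges = List.concatMap (λ i → List.concatMap (λ c → List.concatMap (edgesAt i c)
    (east ∷ north ∷ west ∷ south ∷ [])) (cells (P i))) (List.allFin n)

  edges-complete : ∀ e → e ∈ edges
  edges-complete (i , record { cell = c ; dir = d ; inside = c∈ ; outside = c∉ }) =
    ∈-concatMap⁺ _ (lose (∈-allFin i) (∈-concatMap⁺ _ (lose (recompute (c ∈ᶜ? cells (P i)) c∈)
      (∈-concatMap⁺ (edgesAt i c) (lose (dir∈ d) at)))))
    where
    dir∈ : ∀ d → d ∈ east ∷ north ∷ west ∷ south ∷ []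
    dir∈ east  = here refl
    dir∈ north = there (here refl)
    dir∈ west  = there (there (here refl))
    dir∈ south = there (there (there (here refl)))
    at : (i , record { cell = c ; dir = d ; inside = c∈ ; outside = c∉ }) ∈ edgesAt i c d
    at with c ∈ᶜ? cells (P i) | c ⊕ vec d ∈ᶜ? cells (P i)
    ... | yes _   | no _    = here refl
    ... | yes _   | yes c∈′ = ⊥-elim-irr (c∉ c∈′)
    ... | no ¬c∈  | _       = ⊥-elim-irr (¬c∈ c∈)

  count : ℕ
  count = List.length edges

  number : Edge P → Fin count
  number e = Any.index (edges-complete e)

  number-injective : ∀ {e e′} → number e ≡ number e′ → e ≡ e′
  number-injective {e} {e′} eq = trans (Any.lookup-index (edges-complete e))
    (trans (cong (List.lookup edges) eq) (sym (Any.lookup-index (edges-complete e′))))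

  scaling : Scale
  scaling = record
    { l     = suc count
    ; m     = 12 ℕ.* suc count ℕ.+ 40
    ; ℓ≡    = refl
    ; M≡    = refl
    ; σ≡    = refl
    ; 1≤l   = ℤ.+≤+ (s≤s z≤n)
    ; large = ℤ.≤-reflexive (cong (_+ + 40) (sym (ℤ.pos-* 12 (suc count))))
    }

  module _ (G : UndirectedGraph (Edge P)) where

    open UndirectedGraph G

    edgeKey : Edge P → Fin (suc count)
    edgeKey e = inject₁ (number e)

    fits? : ∀ e (j : Fin (suc count)) → Dec (Any (λ e′ → edgeKey e′ ≡ j × Adj e e′) edges)
    fits? e j = Any.any? (λ e′ → edgeKey e′ Fin.≟ j ×-dec adj? e e′) edges

    edgeLock : Edge P → Subset (suc count)
    edgeLock e = Vec.tabulate (λ j → does (fits? e j))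

    lock⇒ : ∀ {e j} → j ∈ˢ edgeLock e → ∃[ e′ ] edgeKey e′ ≡ j × Adj e e′
    lock⇒ {e} {j} j∈ with fits? e j | trans
        (sym (Vec.lookup∘tabulate (λ j → does (fits? e j)) j)) (Vec.[]=⇒lookup j∈)
    ... | yes fits | _ with find fits
    ...   | e′ , _ , eq , adj = e′ , eq , adj

    lock⇐ : ∀ {e e′} → Adj e e′ → edgeKey e′ ∈ˢ edgeLock e
    lock⇐ {e} {e′} adj = Vec.lookup⇒[]= (edgeKey e′) (edgeLock e)
      (trans (Vec.lookup∘tabulate (λ j → does (fits? e j)) (edgeKey e′)) yes!)
      where
      yes! : does (fits? e (edgeKey e′)) ≡ true
      yes! with fits? e (edgeKey e′)
      ... | yes _   = refl
      ... | no ¬fits = contradiction (lose (edges-complete e′) (refl , adj)) ¬fits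

    edgeKey-injective : ∀ {e e′} → edgeKey e ≡ edgeKey e′ → e ≡ e′
    edgeKey-injective eq = number-injective (Fin.inject₁-injective eq)

    edgeKey-bound : ∀ e → + toℕ (edgeKey e) ≤ + suc count - + 2
    edgeKey-bound e = lin 2 (λ k c → # 1 ⊞ k ≼ c ⇒ goal (k ≼ # 1 ⊞ c ⊟ # 2)) (+ toℕ (edgeKey e)) (+ count)
      (ℤ.+≤+ (subst (ℕ._< count) (sym (Fin.toℕ-inject₁ (number e))) (Fin.toℕ<n (number e))))

    labels : Labels P scaling
    labels = record
      { enough        = ℕ.+-mono-≤-< (ℕ.*-monoˡ-≤ (suc count) {6} {12} (ℕ.m≤m+n 6 6)) (ℕ.m≤m+n 7 33)
      ; key           = edgeKey
      ; lock          = edgeLock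
      ; key-injective = edgeKey-injective
      ; key-topless   = λ e {j} j∈ → subst (λ j → + toℕ j ≤ + suc count - + 2)
          (sym (x∈⁅y⁆⇒x≡y (edgeKey e) j∈)) (edgeKey-bound e)
      ; lock-topless  = λ e j∈ → topless (lock⇒ {e} j∈)
      }
      where
      topless : ∀ {e j} → ∃[ e′ ] edgeKey e′ ≡ j × Adj e e′ → + toℕ j ≤ + suc count - + 2
      topless (e′ , refl , _) = edgeKey-bound e′

    fits⇒adj : ∀ {e e′} → edgeKey e′ ∈ˢ edgeLock e → Adj e e′
    fits⇒adj {e} {e′} k∈ with lock⇒ {e} k∈
    ... | e″ , eq , adj = subst (Adj e) (edgeKey-injective eq) adj

theorem2p4 : (μ : Motions) (n : ℕ) (P : Fin n → Polyomino) (G : UndirectedGraph (Edge P)) →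
    Σ[ L ∈ KLLabeling P ] Bijection (tilings μ (KL P L)) (matchedTilings P G μ)
theorem2p4 μ n P G =
  KLTiles.labeling P (scaling P) (labels P G) ,
  KLBijection.bijection P G (scaling P) (labels P G) (fits⇒adj P G) (lock⇐ P G) μ
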